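{- Let $a,b\geq 0$ be integers and let $\mathcal{T}$ be any flag triangulation of the boundary $\partial P_{K_{a+1,b+1}}$ into unimodular lattice simplices. Write its $h$-polynomial as $h(t)=\sum_{i\ge 0}\gamma_i t^i(1+t)^{a+b+1-2i}$. Then $\sum_i\gamma_i t^i$ is the $f$-polynomial of a flag balanced simplicial complex.
   Context: $P_G=\mathrm{conv}(e_v-e_w,\,e_w-e_v : vw\in E)\subset\mathbb{R}^V$ is the symmetric edge polytope of a finite simple graph $G=(V,E)$; $K_{a+1,b+1}$ is the complete bipartite graph with parts of sizes $a+1,b+1$; $P_{K_{a+1,b+1}}$ has dimension $a+b+1$, so its boundary is an $(a+b)$-dimensional sphere. A lattice simplex is unimodular if its vertices affinely generate the lattice $\mathbb{Z}^V\cap\operatorname{aff}(\text{simplex})$. A simplicial complex is flag if every minimal non-face has two elements; a $(d-1)$-dimensional complex is balanced if its vertices admit a coloring with $d$ colors such that the vertices of every face receive distinct colors. For a $(d-1)$-dimensional simplicial complex with $f_{i}$ faces of dimension $i$ ($f_{ -1}=1$), the $f$-polynomial is $f(t)=\sum_{i=0}^{d} f_{i-1}t^{i}$ and the $h$-polynomial $h(t)=\sum_i h_it^i$ is defined by $f(t)=\sum_{i=0}^{d}h_it^i(1+t)^{d-i}$. -}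

module Defs where

open import Data.Nat as ℕ using (ℕ; zero; suc; _∸_; ⌊_/2⌋)
open import Data.Integer as ℤ using (ℤ; +_)
open import Data.Rational as ℚ using (ℚ; 0ℚ; 1ℚ)
open import Data.Fin as Fin using (Fin; _↑ˡ_; _↑ʳ_)
open import Data.Fin.Subset using (Subset; _∈_; _∉_; _⊆_; _⊂_; _∩_; ⊥; ∣_∣)
open import Data.Bool using (Bool; true; false; if_then_else_; _∧_)
open import Data.List as List using (List; []; _∷_; length; lookup; concatMap; upTo; allFin; replicate; _++_)
open import Data.Vec using (Vec; []; _∷_)
open import Data.Product using (Σ; _×_; _,_; ∃)
open import Relation.Nullary using (¬_; does)
open import Relation.Binary.PropositionalEquality using (_≡_)
open import Data.Nat.ListAction using (sum)

sumℚ : {m : ℕ} → (Fin m → ℚ) → ℚ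
sumℚ {zero}  f = 0ℚ
sumℚ {suc m} f = f Fin.zero ℚ.+ sumℚ (λ j → f (Fin.suc j))

sumℤ : {m : ℕ} → (Fin m → ℤ) → ℤ
sumℤ {zero}  f = + 0
sumℤ {suc m} f = f Fin.zero ℤ.+ sumℤ (λ j → f (Fin.suc j))

sumℕ : {m : ℕ} → (Fin m → ℕ) → ℕ
sumℕ {zero}  f = 0
sumℕ {suc m} f = f Fin.zero ℕ.+ sumℕ (λ j → f (Fin.suc j))

Pt : ℕ → Set
Pt n = Fin n → ℚ

_≐_ : {n : ℕ} → Pt n → Pt n → Set
x ≐ y = ∀ i → x i ≡ y i

toℚ : ℤ → ℚ
toℚ z = z ℚ./ 1

lincomb : {m n : ℕ} → (Fin m → ℚ) → (Fin m → Pt n) → Pt n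
lincomb λs p i = sumℚ (λ j → λs j ℚ.* p j i)

InConvHull : {m n : ℕ} → (Fin m → Pt n) → Pt n → Set
InConvHull {m} p x = Σ (Fin m → ℚ) λ λs →
  (∀ j → 0ℚ ℚ.≤ λs j) × (sumℚ λs ≡ 1ℚ) × (lincomb λs p ≐ x)

e : {n : ℕ} → Fin n → Pt n
e v i = if does (v Fin.≟ i) then 1ℚ else 0ℚ

_-ᵖ_ : {n : ℕ} → Pt n → Pt n → Pt n
(x -ᵖ y) i = x i ℚ.- y i

sepGens : {n : ℕ} → List (Fin n × Fin n) → List (Pt n)
sepGens = concatMap (λ { (v , w) → (e v -ᵖ e w) ∷ (e w -ᵖ e v) ∷ [] })

InSEP : {n : ℕ} → List (Fin n × Fin n) → Pt n → Set
InSEP E = InConvHull (lookup (sepGens E))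

Kbip : (a b : ℕ) → List (Fin (suc a ℕ.+ suc b) × Fin (suc a ℕ.+ suc b))
Kbip a b = concatMap (λ i → List.map (λ j → (i ↑ˡ suc b , suc a ↑ʳ j)) (allFin (suc b)))
                     (allFin (suc a))

-- (relative) boundary of a convex set P:
-- x ∈ P is not in the relative interior, i.e. there is y ∈ P such that the
-- segment from y through x cannot be prolonged beyond x inside P.
Boundary : {n : ℕ} → (Pt n → Set) → Pt n → Set
Boundary {n} P x = P x × Σ (Pt n) λ y → P y ×
  ((ε : ℚ) → 0ℚ ℚ.< ε → ¬ P (λ i → x i ℚ.+ ε ℚ.* (x i ℚ.- y i)))

record Complex (m : ℕ) : Set where
  field
    isFace    : Subset m → Bool
    emptyFace : isFace ⊥ ≡ true
    downward  : ∀ S T → T ⊆ S → isFace S ≡ true → isFace T ≡ true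
open Complex public

Face : {m : ℕ} → Complex m → Subset m → Set
Face Δ S = isFace Δ S ≡ true

IsFlag : {m : ℕ} → Complex m → Set
IsFlag {m} Δ = ∀ (S : Subset m) → isFace Δ S ≡ false →
  (∀ T → T ⊂ S → Face Δ T) → ∣ S ∣ ≡ 2

IsBalanced : {m : ℕ} → Complex m → Set
IsBalanced {m} Δ = Σ ℕ λ d →
  (Σ (Subset m) λ S → Face Δ S × ∣ S ∣ ≡ d) ×
  (∀ S → Face Δ S → ∣ S ∣ ℕ.≤ d) ×
  Σ (Fin m → Fin d) λ κ → ∀ S → Face Δ S → ∀ i j → i ∈ S → j ∈ S → κ i ≡ κ j → i ≡ j

allSubsets : (m : ℕ) → List (Subset m)
allSubsets zero    = [] ∷ []
allSubsets (suc m) = List.map (true ∷_) (allSubsets m) ++ List.map (false ∷_) (allSubsets m)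

-- number of faces with exactly k vertices (= f_{k-1})
faceCount : {m : ℕ} → Complex m → ℕ → ℕ
faceCount {m} Δ k = sum (List.map
  (λ S → if isFace Δ S ∧ does (∣ S ∣ ℕ.≟ k) then 1 else 0) (allSubsets m))

Poly : Set
Poly = List ℤ

coeff : Poly → ℕ → ℤ
coeff []      _       = + 0
coeff (c ∷ p) zero    = c
coeff (c ∷ p) (suc k) = coeff p k

_≈ᴾ_ : Poly → Poly → Set
p ≈ᴾ q = ∀ k → coeff p k ≡ coeff q k

_+ᴾ_ : Poly → Poly → Poly
[]      +ᴾ q       = q
(c ∷ p) +ᴾ []      = c ∷ p
(c ∷ p) +ᴾ (d ∷ q) = (c ℤ.+ d) ∷ (p +ᴾ q)

_*ᴾ_ : Poly → Poly → Poly
[]      *ᴾ q = []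
(c ∷ p) *ᴾ q = List.map (c ℤ.*_) q +ᴾ (+ 0 ∷ (p *ᴾ q))

_^ᴾ_ : Poly → ℕ → Poly
p ^ᴾ zero  = + 1 ∷ []
p ^ᴾ suc k = p *ᴾ (p ^ᴾ k)

mono : ℤ → ℕ → Poly
mono c i = replicate i (+ 0) ++ (c ∷ [])

onePlusT : Poly
onePlusT = + 1 ∷ + 1 ∷ []

sumᴾ : {m : ℕ} → (Fin m → Poly) → Poly
sumᴾ {zero}  f = []
sumᴾ {suc m} f = f Fin.zero +ᴾ sumᴾ (λ j → f (Fin.suc j))

-- f-polynomial  f(t) = Σ_{i=0}^{d} f_{i-1} t^i  (all face sizes ≤ m)
fPoly : {m : ℕ} → Complex m → Poly
fPoly {m} Δ = List.map (λ k → + faceCount Δ k) (upTo (suc m))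

hExpansion : (d : ℕ) → (Fin (suc d) → ℤ) → Poly
hExpansion d h = sumᴾ (λ i → mono (h i) (Fin.toℕ i) *ᴾ (onePlusT ^ᴾ (d ∸ Fin.toℕ i)))

polyOf : {k : ℕ} → (Fin k → ℤ) → Poly
polyOf c = sumᴾ (λ i → mono (c i) (Fin.toℕ i))

γExpansion : (d : ℕ) → (Fin (suc ⌊ d /2⌋) → ℤ) → Poly
γExpansion d γ = sumᴾ (λ i → mono (γ i) (Fin.toℕ i) *ᴾ (onePlusT ^ᴾ (d ∸ (Fin.toℕ i ℕ.+ Fin.toℕ i))))

-- Triangulations of a set B ⊆ ℚ^n into unimodular lattice simplices.
-- The simplices are conv φ(σ) for faces σ of an abstract complex Δ,
-- with lattice vertices φ : Fin m → ℤ^n.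

record UnimodularTriangulation (n : ℕ) (B : Pt n → Set) : Set where
  field
    m   : ℕ
    Δ   : Complex m
    φ   : Fin m → Fin n → ℤ
  φℚ : Fin m → Pt n
  φℚ j i = toℚ (φ j i)
  InSimplex : Subset m → Pt n → Set
  InSimplex σ x = Σ (Fin m → ℚ) λ λs →
    (∀ j → 0ℚ ℚ.≤ λs j) × (∀ j → j ∉ σ → λs j ≡ 0ℚ) ×
    (sumℚ λs ≡ 1ℚ) × (lincomb λs φℚ ≐ x)
  InAffine : Subset m → Pt n → Set
  InAffine σ x = Σ (Fin m → ℚ) λ λs →
    (∀ j → j ∉ σ → λs j ≡ 0ℚ) × (sumℚ λs ≡ 1ℚ) × (lincomb λs φℚ ≐ x)
  field
    affIndep  : ∀ σ → Face Δ σ → (λs : Fin m → ℚ) → (∀ j → j ∉ σ → λs j ≡ 0ℚ) →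
                sumℚ λs ≡ 0ℚ → lincomb λs φℚ ≐ (λ _ → 0ℚ) → ∀ j → λs j ≡ 0ℚ
    inside    : ∀ σ → Face Δ σ → ∀ x → InSimplex σ x → B x
    covers    : ∀ x → B x → Σ (Subset m) λ σ → Face Δ σ × InSimplex σ x
    meet      : ∀ σ τ → Face Δ σ → Face Δ τ → ∀ x →
                InSimplex σ x → InSimplex τ x → InSimplex (σ ∩ τ) x
    unimodular : ∀ σ → Face Δ σ → (z : Fin n → ℤ) → InAffine σ (λ i → toℚ (z i)) →
                 Σ (Fin m → ℤ) λ κ → (∀ j → j ∉ σ → κ j ≡ + 0) × (sumℤ κ ≡ + 1) ×
                 (∀ i → sumℤ (λ j → κ j ℤ.* φ j i) ≡ z i)

-- Consider the norm max(|x|₁ , |y|₁) on the lattice of pairs (x , y) ∈ ℤ^(a+1) × ℤ^(b+1) of total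
-- sum zero; P is its unit ball.  A unimodular triangulation of ∂P matches the lattice points of norm
-- N > 0 with the vectors c ∈ ℕ^m of sum N supported on faces, so the f-polynomial, evaluated at
-- t = s/(1-s), is the generating function H(s) of the lattice points by norm, and h(s) = (1-s)^(a+b+1) H(s).
-- Dropping one coordinate of x and of y and sorting by (u , v) = (max(|x⁺| , |y⁻|) , max(|x⁻| , |y⁺|))
-- gives H = (1 - s²) D with D(N) = Σ_{u+v=N} W_a(u , v) W_b(u , v), where W_a(u , v) counts the x ∈ ℤ^a
-- with |x⁺| ≤ u and |x⁻| ≤ v.  Expanding the W's over sign patterns into binomial coefficients and these
-- into polynomials orthogonal for the weight sᵘ yields h(s) = Σ_i γ_i sⁱ (1+s)^(a+b+1-2i), with γ_i the
-- number of pairs of words in {0,+,-}^a and {0,+,-}^b having the same numbers of + and of -, i in total.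
-- Matching the k-th + (or -) of one word with the k-th + (or -) of the other turns these pairs into the
-- cliques of a graph on the 2ab signed cells (p , q , ±).  Its clique complex is flag, and colouring a
-- cell by its row or its column, whichever are fewer, shows that it is balanced.
module Submission where

open import Defs
open import Data.Bool using (Bool; true; false; if_then_else_; _∧_; _∨_; _xor_)
import Data.Bool.Properties as Boolₚ
open import Data.Empty using (⊥; ⊥-elim)
open import Data.Fin as Fin using (Fin; _↑ˡ_; _↑ʳ_)
import Data.Fin.Properties as Finₚ
open import Data.Fin.Subset using (Nonempty; Subset; _∈_; _∉_; _⊆_; _⊂_; _∩_; ∣_∣) renaming (⊥ to ∅)
import Data.Fin.Subset.Properties as Subsetₚ
open import Data.Integer as ℤ using (ℤ; +_; -[1+_]) renaming (_+_ to _+ᶻ_; _*_ to _*ᶻ_)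
import Data.Integer.Properties as ℤₚ
open import Algebra.Properties.AbelianGroup ℤₚ.+-0-abelianGroup using ()
  renaming (∙-cancelˡ to +ᶻ-cancelˡ; ∙-cancelʳ to +ᶻ-cancelʳ)
open import Data.Integer.Tactic.RingSolver using (solve-∀)
open import Data.List as List using (List; []; _∷_; _++_; length; allFin)
open import Data.List.Membership.Propositional using () renaming (_∈_ to _∈ˡ_)
open import Data.List.Membership.Propositional.Properties
  using (∈-lookup; ∈-map⁺; ∈-map⁻; ∈-++⁺ˡ; ∈-++⁺ʳ; ∈-++⁻; ∈-filter⁺; ∈-filter⁻; ∈-∃++; ∈-concatMap⁺; ∈-concatMap⁻; ∈-allFin)
import Data.List.Properties as Listₚ
open import Data.List.Relation.Unary.All as All using (All)
import Data.List.Relation.Unary.All.Properties as Allₚ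
open import Data.List.Relation.Unary.AllPairs using ([]; _∷_)
open import Data.List.Relation.Unary.Any as Any using (Any)
import Data.List.Relation.Unary.Any.Properties as Anyₚ
open import Data.List.Relation.Unary.Unique.Propositional using (Unique)
import Data.List.Relation.Unary.Unique.Propositional.Properties as Uniqueₚ
open import Data.Nat as ℕ using (ℕ; zero; suc; _+_; _*_; _∸_; _≤_; _<_; z≤n; s≤s; ⌊_/2⌋; _<ᵇ_; _≡ᵇ_)
open import Data.Nat.ListAction using (sum)
import Data.Nat.ListAction.Properties as Sumₚ
import Data.Nat.Properties as ℕₚ
import Data.Nat.Tactic.RingSolver as ℕSolver
open import Data.Product using (Σ; _×_; _,_; proj₁; proj₂)
open import Data.Rational as ℚ using (ℚ; 0ℚ; 1ℚ; ½) renaming (_+_ to _+ℚ_; _*_ to _*ℚ_; _-_ to _-ℚ_; -_ to -ℚ_)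
import Data.Rational.Properties as ℚₚ
open import Data.Rational.Solver using (module +-*-Solver)
open +-*-Solver using (_:=_; _:+_; _:*_; _:-_; :-_; con) renaming (solve to solveℚ)
import Data.Rational.Unnormalised as ℚᵘ
import Data.Rational.Unnormalised.Properties as ℚᵘₚ
open import Data.Sum using (_⊎_; inj₁; inj₂; [_,_]′)
open import Data.Vec as Vec using (Vec; []; _∷_; here; there)
import Data.Vec.Properties as Vecₚ
open import Function using (_∘_; id)
open import Level using (0ℓ)
open import Relation.Binary.PropositionalEquality using (_≡_; _≢_; refl; sym; trans; cong; cong₂; subst; subst₂; _≗_)
open import Relation.Nullary using (¬_; Dec; yes; no; does)
open import Relation.Nullary.Decidable using (dec-true; dec-false; _×-dec_; ¬?)
open import Relation.Unary using (Pred; Decidable)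

-- Integer sequences as formal power series

-- Why powers of 1+s appear: put θ = s/(1-s). In a sum over sign words a letter contributes 1, θ +
-- X₊ or θ + X₋ according to its sign, and 1 + (θ + X₊) + (θ + X₋) = (1 + 2θ) + X₊ + X₋. Regrouping
-- thus moves θ from the nonzero letters to the zero letters, whose weight becomes 1 + 2θ =
-- (1+s)/(1-s). What remains on the nonzero letters are pure powers of X₊ and X₋, and orthogonality
-- leaves only the pairs of words that agree in the number of + and in the number of -. With i
-- nonzero letters in each word there are a+b-2i zero letters, hence (1+s)^(a+b-2i); the last factor
-- 1+s is the one in 1-s² = (1-s)(1+s). All letters carry the same denominator 1-s, so the
-- denominators leave the sum together. No series is ever inverted: 1/(1-s) is the operator of
-- partial sums, and it is cancelled because it is injective. Sums over words are defined one letter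
-- at a time, so the identities above become inductions that treat a single letter. On the geometric
-- side the boundary is only tested at points z/N with z integral, and cardinalities are compared as
-- lengths of duplicate-free lists linked by a relation.

Seq : Set
Seq = ℕ → ℤ

infixl 6 _⊕_
infixr 7 _⊙_

_⊕_ : Seq → Seq → Seq
(f ⊕ g) n = f n +ᶻ g n

_⊙_ : ℤ → Seq → Seq
(c ⊙ f) n = c *ᶻ f n

𝟘 : Seq
𝟘 _ = + 0

δ : Seq
δ zero    = + 1
δ (suc _) = + 0

shift : Seq → Seq
shift f zero    = + 0
shift f (suc n) = f n

psum : Seq → Seq
psum f zero    = f 0
psum f (suc n) = psum f n +ᶻ f (suc n)

J : Seq → Seq
J f = shift (psum f)

iter : {A : Set} → (A → A) → ℕ → A → A
iter F zero    x = x
iter F (suc n) x = F (iter F n x)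

⊕-cong : ∀ {f f′ g g′} → f ≗ f′ → g ≗ g′ → (f ⊕ g) ≗ (f′ ⊕ g′)
⊕-cong p q n = cong₂ _+ᶻ_ (p n) (q n)

⊙-cong : ∀ c {f g} → f ≗ g → (c ⊙ f) ≗ (c ⊙ g)
⊙-cong c p n = cong (c *ᶻ_) (p n)

≗-trans : ∀ {f g h : Seq} → f ≗ g → g ≗ h → f ≗ h
≗-trans p q n = trans (p n) (q n)

≗-sym : ∀ {f g : Seq} → f ≗ g → g ≗ f
≗-sym p n = sym (p n)

-- Equality of sequences is pointwise throughout, so compatibility with it, `resp`, has to be part
-- of linearity.
record Linear (F : Seq → Seq) : Set where
  field
    resp  : ∀ {f g} → f ≗ g → F f ≗ F g
    add   : ∀ f g → F (f ⊕ g) ≗ (F f ⊕ F g)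
    scale : ∀ c f → F (c ⊙ f) ≗ (c ⊙ F f)

  zero-map : F 𝟘 ≗ 𝟘
  zero-map n = trans (scale (+ 0) 𝟘 n) (ℤₚ.*-zeroˡ (F 𝟘 n))

  sum-map : ∀ {k} (f : Fin k → Seq) →
    F (λ n → sumℤ (λ i → f i n)) ≗ (λ n → sumℤ (λ i → F (f i) n))
  sum-map {zero}  f = zero-map
  sum-map {suc k} f n = trans (add (f Fin.zero) _ n)
    (cong (F (f Fin.zero) n +ᶻ_) (sum-map (f ∘ Fin.suc) n))

open Linear

shift-linear : Linear shift
resp  shift-linear p zero    = refl
resp  shift-linear p (suc n) = p n
add   shift-linear f g zero    = refl
add   shift-linear f g (suc n) = refl
scale shift-linear c f zero    = sym (ℤₚ.*-zeroʳ c)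
scale shift-linear c f (suc n) = refl

interchange : ∀ (a b c d : ℤ) → a +ᶻ b +ᶻ (c +ᶻ d) ≡ a +ᶻ c +ᶻ (b +ᶻ d)
interchange = solve-∀

psum-linear : Linear psum
resp  psum-linear p zero    = p 0
resp  psum-linear p (suc n) = cong₂ _+ᶻ_ (resp psum-linear p n) (p (suc n))
add   psum-linear f g zero    = refl
add   psum-linear f g (suc n) = trans (cong (_+ᶻ (f (suc n) +ᶻ g (suc n))) (add psum-linear f g n))
  (interchange (psum f n) (psum g n) (f (suc n)) (g (suc n)))
scale psum-linear c f zero    = refl
scale psum-linear c f (suc n) = trans (cong (_+ᶻ c *ᶻ f (suc n)) (scale psum-linear c f n))
  (sym (ℤₚ.*-distribˡ-+ c (psum f n) (f (suc n))))

id-linear : Linear id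
resp  id-linear p = p
add   id-linear f g n = refl
scale id-linear c f n = refl

∘-linear : ∀ {F G} → Linear F → Linear G → Linear (F ∘ G)
resp  (∘-linear LF LG) p = resp LF (resp LG p)
add   (∘-linear {F} {G} LF LG) f g = ≗-trans (resp LF (add LG f g)) (add LF (G f) (G g))
scale (∘-linear {F} {G} LF LG) c f = ≗-trans (resp LF (scale LG c f)) (scale LF c (G f))

⊕-linear : ∀ {F G} → Linear F → Linear G → Linear (λ f → F f ⊕ G f)
resp  (⊕-linear LF LG) p = ⊕-cong (resp LF p) (resp LG p)
add   (⊕-linear {F} {G} LF LG) f g n =
  trans (cong₂ _+ᶻ_ (add LF f g n) (add LG f g n)) (interchange (F f n) (F g n) (G f n) (G g n))
scale (⊕-linear {F} {G} LF LG) c f n =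
  trans (cong₂ _+ᶻ_ (scale LF c f n) (scale LG c f n)) (sym (ℤₚ.*-distribˡ-+ c (F f n) (G f n)))

iter-linear : ∀ {F} → Linear F → ∀ n → Linear (iter F n)
iter-linear LF zero    = id-linear
iter-linear LF (suc n) = ∘-linear LF (iter-linear LF n)

J-linear : Linear J
J-linear = ∘-linear shift-linear psum-linear

psum-J : ∀ f → psum f ≗ (f ⊕ J f)
psum-J f zero    = sym (ℤₚ.+-identityʳ (f 0))
psum-J f (suc n) = ℤₚ.+-comm (psum f n) (f (suc n))

-- The equation (1-s)g = f has only one solution. This is what proves that `psum` commutes with
-- `shift` and with convolutions.
psum-unique : ∀ {f g} → g ≗ (f ⊕ shift g) → g ≗ psum f
psum-unique p zero    = trans (p 0) (ℤₚ.+-identityʳ _)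
psum-unique {f} {g} p (suc n) = trans (p (suc n))
  (trans (ℤₚ.+-comm (f (suc n)) (g n)) (cong (_+ᶻ f (suc n)) (psum-unique p n)))

psum-shift : ∀ f → psum (shift f) ≗ shift (psum f)
psum-shift f = ≗-sym (psum-unique
  (≗-trans (resp shift-linear (psum-J f)) (add shift-linear f (J f))))

psum-injective : ∀ {f g} → psum f ≗ psum g → f ≗ g
psum-injective p zero    = p 0
psum-injective {f} {g} p (suc n) = +ᶻ-cancelˡ (psum f n) _ _
  (trans (p (suc n)) (cong (_+ᶻ g (suc n)) (sym (p n))))

Commutes : (Seq → Seq) → (Seq → Seq) → Set
Commutes F G = ∀ f → F (G f) ≗ G (F f)

iter-commutes : ∀ {F G} → Linear G → Commutes F G → ∀ n → Commutes F (iter G n)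
iter-commutes LG c zero    f _ = refl
iter-commutes {F} {G} LG c (suc n) f =
  ≗-trans (c (iter G n f)) (resp LG (iter-commutes LG c n f))

commutes-iter : ∀ {F G} → Linear F → Commutes F G → ∀ n → Commutes (iter F n) G
commutes-iter LF c n f = ≗-sym (iter-commutes LF (λ g → ≗-sym (c g)) n f)

iter-psum-injective : ∀ n {f g} → iter psum n f ≗ iter psum n g → f ≗ g
iter-psum-injective zero    p = p
iter-psum-injective (suc n) p = iter-psum-injective n (psum-injective p)

iter-+ : ∀ (F : Seq → Seq) m n f → iter F (m + n) f ≡ iter F m (iter F n f)
iter-+ F zero    n f = refl
iter-+ F (suc m) n f = cong F (iter-+ F m n f)

-- Polynomials evaluated at a linear operator

ev : (Seq → Seq) → Poly → Seq → Seq
ev F []      f = 𝟘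
ev F (c ∷ p) f = c ⊙ f ⊕ F (ev F p f)

coeff-+ᴾ : ∀ p q k → coeff (p +ᴾ q) k ≡ coeff p k +ᶻ coeff q k
coeff-+ᴾ []      q       k       = sym (ℤₚ.+-identityˡ _)
coeff-+ᴾ (c ∷ p) []      k       = sym (ℤₚ.+-identityʳ _)
coeff-+ᴾ (c ∷ p) (d ∷ q) zero    = refl
coeff-+ᴾ (c ∷ p) (d ∷ q) (suc k) = coeff-+ᴾ p q k

module Evaluation {F : Seq → Seq} (LF : Linear F) where

  ev-linear : ∀ p → Linear (ev F p)
  resp  (ev-linear []) q n = refl
  resp  (ev-linear (c ∷ p)) q = ⊕-cong (⊙-cong c q) (resp LF (resp (ev-linear p) q))
  add   (ev-linear []) f g n = refl
  add   (ev-linear (c ∷ p)) f g n =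
    trans (cong₂ _+ᶻ_ (ℤₚ.*-distribˡ-+ c (f n) (g n))
                       (trans (resp LF (add (ev-linear p) f g) n) (add LF _ _ n)))
          (interchange (c *ᶻ f n) (c *ᶻ g n) (F (ev F p f) n) (F (ev F p g) n))
  scale (ev-linear []) d f n = sym (ℤₚ.*-zeroʳ d)
  scale (ev-linear (c ∷ p)) d f n =
    trans (cong (c *ᶻ (d *ᶻ f n) +ᶻ_)
             (trans (resp LF (scale (ev-linear p) d f) n) (scale LF d _ n)))
          (lemma c d (f n) (F (ev F p f) n))
    where
    lemma : ∀ c d x y → c *ᶻ (d *ᶻ x) +ᶻ d *ᶻ y ≡ d *ᶻ (c *ᶻ x +ᶻ y)
    lemma = solve-∀

  ev-zero : ∀ p → (∀ k → coeff p k ≡ + 0) → ∀ f → ev F p f ≗ 𝟘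
  ev-zero []      z f n = refl
  ev-zero (c ∷ p) z f n = cong₂ _+ᶻ_
    (trans (cong (_*ᶻ f n) (z 0)) (ℤₚ.*-zeroˡ (f n)))
    (trans (resp LF (ev-zero p (z ∘ suc) f) n) (zero-map LF n))

  ev-cong : ∀ p q → p ≈ᴾ q → ∀ f → ev F p f ≗ ev F q f
  ev-cong []      q       e f = ≗-sym (ev-zero q (λ k → sym (e k)) f)
  ev-cong (c ∷ p) []      e f = ev-zero (c ∷ p) e f
  ev-cong (c ∷ p) (d ∷ q) e f = ⊕-cong (λ n → cong (_*ᶻ f n) (e 0))
    (resp LF (ev-cong p q (e ∘ suc) f))

  ev-+ : ∀ p q f → ev F (p +ᴾ q) f ≗ (ev F p f ⊕ ev F q f)
  ev-+ []      q       f n = sym (ℤₚ.+-identityˡ _)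
  ev-+ (c ∷ p) []      f n = sym (ℤₚ.+-identityʳ _)
  ev-+ (c ∷ p) (d ∷ q) f n =
    trans (cong₂ _+ᶻ_ (ℤₚ.*-distribʳ-+ (f n) c d)
                       (trans (resp LF (ev-+ p q f) n) (add LF _ _ n)))
          (interchange (c *ᶻ f n) (d *ᶻ f n) (F (ev F p f) n) (F (ev F q f) n))

  ev-map-* : ∀ c q f → ev F (List.map (c *ᶻ_) q) f ≗ (c ⊙ ev F q f)
  ev-map-* c []      f n = sym (ℤₚ.*-zeroʳ c)
  ev-map-* c (d ∷ q) f n =
    trans (cong (c *ᶻ d *ᶻ f n +ᶻ_)
             (trans (resp LF (ev-map-* c q f) n) (scale LF c _ n)))
          (lemma c d (f n) (F (ev F q f) n))
    where
    lemma : ∀ c d x y → c *ᶻ d *ᶻ x +ᶻ c *ᶻ y ≡ c *ᶻ (d *ᶻ x +ᶻ y)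
    lemma = solve-∀

  ev-* : ∀ p q f → ev F (p *ᴾ q) f ≗ ev F p (ev F q f)
  ev-* []      q f n = refl
  ev-* (c ∷ p) q f = ≗-trans (ev-+ (List.map (c *ᶻ_) q) _ f)
    (⊕-cong (ev-map-* c q f)
      (λ n → trans (cong (_+ᶻ F (ev F (p *ᴾ q) f) n) (ℤₚ.*-zeroˡ (f n)))
             (trans (ℤₚ.+-identityˡ _) (resp LF (ev-* p q f) n))))

  ev-mono : ∀ c i f → ev F (mono c i) f ≗ (c ⊙ iter F i f)
  ev-mono c zero    f n = trans (cong (c *ᶻ f n +ᶻ_) (zero-map LF n)) (ℤₚ.+-identityʳ _)
  ev-mono c (suc i) f n =
    trans (cong (_+ᶻ F (ev F (mono c i) f) n) (ℤₚ.*-zeroˡ (f n)))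
    (trans (ℤₚ.+-identityˡ _)
    (trans (resp LF (ev-mono c i f) n) (scale LF c _ n)))

  ev-1+t : ∀ f → ev F onePlusT f ≗ (f ⊕ F f)
  ev-1+t f = ⊕-cong (λ n → ℤₚ.*-identityˡ (f n)) (resp LF λ n →
    trans (cong₂ _+ᶻ_ (ℤₚ.*-identityˡ (f n)) (zero-map LF n)) (ℤₚ.+-identityʳ _))

  ev-1+t^ : ∀ k f → ev F (onePlusT ^ᴾ k) f ≗ iter (λ g → g ⊕ F g) k f
  ev-1+t^ zero    f n = trans (cong₂ _+ᶻ_ (ℤₚ.*-identityˡ (f n)) (zero-map LF n)) (ℤₚ.+-identityʳ _)
  ev-1+t^ (suc k) f = ≗-trans (ev-* onePlusT (onePlusT ^ᴾ k) f)
    (≗-trans (resp (ev-linear onePlusT) (ev-1+t^ k f)) (ev-1+t (iter (λ g → g ⊕ F g) k f)))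

  ev-sumᴾ : ∀ {k} (p : Fin k → Poly) f → ev F (sumᴾ p) f ≗ (λ n → sumℤ (λ i → ev F (p i) f n))
  ev-sumᴾ {zero}  p f n = refl
  ev-sumᴾ {suc k} p f = ≗-trans (ev-+ (p Fin.zero) _ f)
    (λ n → cong (ev F (p Fin.zero) f n +ᶻ_) (ev-sumᴾ (p ∘ Fin.suc) f n))

  ev-mono-1+t^ : ∀ c i k f →
    ev F (mono c i *ᴾ (onePlusT ^ᴾ k)) f ≗ (c ⊙ iter F i (iter (λ g → g ⊕ F g) k f))
  ev-mono-1+t^ c i k f = ≗-trans (ev-* (mono c i) (onePlusT ^ᴾ k) f)
    (≗-trans (ev-mono c i _) (⊙-cong c (resp (iter-linear LF i) (ev-1+t^ k f))))

open Evaluation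

coeff-ev : ∀ p → coeff p ≗ ev shift p δ
coeff-ev []      n       = refl
coeff-ev (c ∷ p) zero    = sym (trans (ℤₚ.+-identityʳ _) (ℤₚ.*-identityʳ c))
coeff-ev (c ∷ p) (suc n) = trans (coeff-ev p n)
  (sym (trans (cong (_+ᶻ _) (ℤₚ.*-zeroʳ c)) (ℤₚ.+-identityˡ _)))

sumℤ-cong : ∀ {k} {f g : Fin k → ℤ} → (∀ i → f i ≡ g i) → sumℤ f ≡ sumℤ g
sumℤ-cong {zero}  p = refl
sumℤ-cong {suc k} p = cong₂ _+ᶻ_ (p Fin.zero) (sumℤ-cong (p ∘ Fin.suc))

coeff-polyOf : ∀ {k} (c : Fin k → ℤ) →
  coeff (polyOf c) ≗ (λ n → sumℤ (λ i → c i *ᶻ iter shift (Fin.toℕ i) δ n))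
coeff-polyOf c n = trans (coeff-ev (polyOf c) n)
  (trans (ev-sumᴾ shift-linear (λ i → mono (c i) (Fin.toℕ i)) δ n)
         (sumℤ-cong λ i → ev-mono shift-linear (c i) (Fin.toℕ i) δ n))

1+shift : Seq → Seq
1+shift f = f ⊕ shift f

1+shift-linear : Linear 1+shift
1+shift-linear = ⊕-linear id-linear shift-linear

coeff-γExpansion : ∀ d (γ : Fin (suc ⌊ d /2⌋) → ℤ) →
  coeff (γExpansion d γ) ≗ (λ n → sumℤ (λ i → γ i ℤ.*
    iter shift (Fin.toℕ i) (iter 1+shift (d ∸ (Fin.toℕ i + Fin.toℕ i)) δ) n))
coeff-γExpansion d γ n = trans (coeff-ev (γExpansion d γ) n)
  (trans (ev-sumᴾ shift-linear (λ i → mono (γ i) (Fin.toℕ i) *ᴾ (onePlusT ^ᴾ k i)) δ n)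
         (sumℤ-cong λ i → ev-mono-1+t^ shift-linear (γ i) (Fin.toℕ i) (k i) δ n))
  where
  k : Fin (suc ⌊ d /2⌋) → ℕ
  k i = d ∸ (Fin.toℕ i + Fin.toℕ i)

iter-resp : ∀ {F G} → Linear F → (∀ f → G f ≗ F f) → ∀ n f → iter G n f ≗ iter F n f
iter-resp LF p zero    f n = refl
iter-resp {F} {G} LF p (suc k) f = ≗-trans (p _) (resp LF (iter-resp LF p k f))

-- θ^i = s^i/(1-s)^i, because shifting and summation commute.
iter-J : ∀ i f → iter J i f ≗ iter psum i (iter shift i f)
iter-J zero    f n = refl
iter-J (suc i) f = ≗-trans (resp J-linear (iter-J i f))
  (≗-trans (≗-sym (psum-shift _)) (resp psum-linear
    (≗-sym (commutes-iter psum-linear psum-shift i (iter shift i f)))))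

-- Substituting t = s/(1-s) in the f-polynomial gives h(s)/(1-s)^d.
ev-hExpansion : ∀ d (h : Fin (suc d) → ℤ) →
  ev J (hExpansion d h) δ ≗ iter psum d (coeff (polyOf h))
ev-hExpansion d h =
  ≗-trans (ev-sumᴾ J-linear (λ i → mono (h i) (Fin.toℕ i) *ᴾ (onePlusT ^ᴾ (d ∸ Fin.toℕ i))) δ)
  (≗-trans (λ n → sumℤ-cong λ i → term i n)
  (≗-trans (≗-sym (sum-map (iter-linear psum-linear d) (λ i → h i ⊙ iter shift (Fin.toℕ i) δ)))
           (resp (iter-linear psum-linear d) (≗-sym (coeff-polyOf h)))))
  where
  -- 1 + θ = 1/(1-s), so θ^k (1+θ)^(d-k) = s^k/(1-s)^d; the denominator no longer depends on k.
  term : ∀ i → ev J (mono (h i) (Fin.toℕ i) *ᴾ (onePlusT ^ᴾ (d ∸ Fin.toℕ i))) δ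
             ≗ iter psum d (h i ⊙ iter shift (Fin.toℕ i) δ)
  term i = ≗-trans (ev-mono-1+t^ J-linear (h i) k (d ∸ k) δ)
    (≗-trans (⊙-cong (h i) (≗-trans (resp (iter-linear J-linear k)
                (iter-resp psum-linear (λ f → ≗-sym (psum-J f)) (d ∸ k) δ))
      (≗-trans (iter-J k _)
      (≗-trans (resp (iter-linear psum-linear k)
                 (≗-sym (commutes-iter psum-linear (iter-commutes shift-linear psum-shift k) (d ∸ k) δ)))
               (λ n → cong (λ F → F n) (trans (sym (iter-+ psum k (d ∸ k) _))
                  (cong (λ e → iter psum e (iter shift k δ))
                    (ℕₚ.m+[n∸m]≡n (ℕₚ.≤-pred (Finₚ.toℕ<n i))))))))))
      (≗-sym (scale (iter-linear psum-linear d) (h i) (iter shift k δ))))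
    where k = Fin.toℕ i

-- Bivariate families, their diagonals and the Cauchy product

diag : (ℕ → ℕ → ℤ) → Seq
diag F zero    = F 0 0
diag F (suc n) = F 0 (suc n) +ᶻ diag (λ u v → F (suc u) v) n

diag-cong : ∀ {F G} → (∀ u v → F u v ≡ G u v) → diag F ≗ diag G
diag-cong p zero    = p 0 0
diag-cong p (suc n) = cong₂ _+ᶻ_ (p 0 (suc n)) (diag-cong (p ∘ suc) n)

diag-+ : ∀ F G → diag (λ u v → F u v +ᶻ G u v) ≗ (diag F ⊕ diag G)
diag-+ F G zero    = refl
diag-+ F G (suc n) = trans
  (cong (F 0 (suc n) +ᶻ G 0 (suc n) +ᶻ_) (diag-+ (F ∘ suc) (G ∘ suc) n))
  (interchange (F 0 (suc n)) (G 0 (suc n)) (diag (F ∘ suc) n) (diag (G ∘ suc) n))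

diag-* : ∀ c F → diag (λ u v → c *ᶻ F u v) ≗ (c ⊙ diag F)
diag-* c F zero    = refl
diag-* c F (suc n) = trans (cong (c *ᶻ F 0 (suc n) +ᶻ_) (diag-* c (F ∘ suc) n))
  (sym (ℤₚ.*-distribˡ-+ c (F 0 (suc n)) (diag (F ∘ suc) n)))

diag-last : ∀ F n → diag F (suc n) ≡ diag (λ u v → F u (suc v)) n +ᶻ F (suc n) 0
diag-last F zero    = refl
diag-last F (suc n) = trans (cong (F 0 (suc (suc n)) +ᶻ_) (diag-last (F ∘ suc) n))
  (sym (ℤₚ.+-assoc (F 0 (suc (suc n))) (diag (λ u v → F (suc u) (suc v)) n) (F (suc (suc n)) 0)))

diag-flip : ∀ F → diag (λ u v → F v u) ≗ diag F
diag-flip F zero    = refl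
diag-flip F (suc n) = trans (cong (F (suc n) 0 +ᶻ_) (diag-flip (λ u v → F u (suc v)) n))
  (trans (ℤₚ.+-comm (F (suc n) 0) _) (sym (diag-last F n)))

conv : Seq → Seq → Seq
conv f g = diag (λ u v → f u *ᶻ g v)

conv-comm : ∀ f g → conv f g ≗ conv g f
conv-comm f g n = trans (diag-cong (λ u v → ℤₚ.*-comm (f u) (g v)) n)
  (diag-flip (λ u v → g u *ᶻ f v) n)

conv-cong : ∀ {f f′ g g′} → f ≗ f′ → g ≗ g′ → conv f g ≗ conv f′ g′
conv-cong p q = diag-cong (λ u v → cong₂ _*ᶻ_ (p u) (q v))

conv-linear : ∀ g → Linear (λ f → conv f g)
resp  (conv-linear g) p = conv-cong p (λ _ → refl)
add   (conv-linear g) f h n = trans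
  (diag-cong (λ u v → ℤₚ.*-distribʳ-+ (g v) (f u) (h u)) n)
  (diag-+ (λ u v → f u *ᶻ g v) (λ u v → h u *ᶻ g v) n)
scale (conv-linear g) c f n = trans
  (diag-cong (λ u v → ℤₚ.*-assoc c (f u) (g v)) n)
  (diag-* c (λ u v → f u *ᶻ g v) n)

conv-shift : ∀ g → Commutes (λ f → conv f g) shift
conv-shift g f zero    = ℤₚ.*-zeroˡ (g 0)
conv-shift g f (suc n) = trans (cong (_+ᶻ conv f g n) (ℤₚ.*-zeroˡ (g (suc n)))) (ℤₚ.+-identityˡ _)

conv-psum : ∀ g → Commutes (λ f → conv f g) psum
conv-psum g f = psum-unique (≗-trans (resp (conv-linear g) (psum-J f))
  (≗-trans (add (conv-linear g) f (J f))
    (⊕-cong {conv f g} (λ _ → refl) (conv-shift g (psum f)))))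

conv-J : ∀ g → Commutes (λ f → conv f g) J
conv-J g f = ≗-trans (conv-shift g (psum f)) (resp shift-linear (conv-psum g f))

commutesʳ : ∀ {F} → Linear F → (∀ g → Commutes (λ f → conv f g) F) →
  ∀ f → Commutes (conv f) F
commutesʳ {F} LF c f g = ≗-trans (conv-comm f (F g)) (≗-trans (c f g) (resp LF (conv-comm g f)))

conv-linearʳ : ∀ f → Linear (conv f)
resp  (conv-linearʳ f) p = conv-cong {f} (λ _ → refl) p
add   (conv-linearʳ f) g h = ≗-trans (conv-comm f (g ⊕ h)) (≗-trans (add (conv-linear f) g h)
  (⊕-cong (conv-comm g f) (conv-comm h f)))
scale (conv-linearʳ f) c g = ≗-trans (conv-comm f (c ⊙ g)) (≗-trans (scale (conv-linear f) c g)
  (⊙-cong c (conv-comm g f)))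

-- Ω C a g is the sum of C^(a - |w|) g(#₊ w, #₋ w) over the words w ∈ {0,+,-}^a.

Ωᶻ : ℕ → (ℕ → ℕ → ℤ) → ℤ
Ωᶻ zero    g = g 0 0
Ωᶻ (suc a) g = Ωᶻ a g +ᶻ Ωᶻ a (λ k l → g (suc k) l) +ᶻ Ωᶻ a (λ k l → g k (suc l))

Ω : (Seq → Seq) → ℕ → (ℕ → ℕ → Seq) → Seq
Ω C zero    g = g 0 0
Ω C (suc a) g = C (Ω C a g) ⊕ Ω C a (λ k l → g (suc k) l) ⊕ Ω C a (λ k l → g k (suc l))

Ωᶻ-cong : ∀ a {g h} → (∀ k l → g k l ≡ h k l) → Ωᶻ a g ≡ Ωᶻ a h
Ωᶻ-cong zero    p = p 0 0
Ωᶻ-cong (suc a) p = cong₂ _+ᶻ_ (cong₂ _+ᶻ_ (Ωᶻ-cong a p) (Ωᶻ-cong a (λ k l → p (suc k) l)))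
  (Ωᶻ-cong a (λ k l → p k (suc l)))

Ωᶻ-* : ∀ a c g → c *ᶻ Ωᶻ a g ≡ Ωᶻ a (λ k l → c *ᶻ g k l)
Ωᶻ-* zero    c g = refl
Ωᶻ-* (suc a) c g = trans (distrib c (Ωᶻ a g) (Ωᶻ a (λ k l → g (suc k) l)) (Ωᶻ a (λ k l → g k (suc l))))
  (cong₂ _+ᶻ_ (cong₂ _+ᶻ_ (Ωᶻ-* a c g) (Ωᶻ-* a c _)) (Ωᶻ-* a c _))
  where
  distrib : ∀ c x y z → c *ᶻ (x +ᶻ y +ᶻ z) ≡ c *ᶻ x +ᶻ c *ᶻ y +ᶻ c *ᶻ z
  distrib = solve-∀

Ωᶻ-*ʳ : ∀ a g c → Ωᶻ a g *ᶻ c ≡ Ωᶻ a (λ k l → g k l *ᶻ c)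
Ωᶻ-*ʳ a g c = trans (ℤₚ.*-comm (Ωᶻ a g) c)
  (trans (Ωᶻ-* a c g) (Ωᶻ-cong a (λ k l → ℤₚ.*-comm c (g k l))))

Ωᶻ-map : ∀ {F} → Linear F → ∀ a (g : ℕ → ℕ → Seq) →
  F (λ n → Ωᶻ a (λ k l → g k l n)) ≗ (λ n → Ωᶻ a (λ k l → F (g k l) n))
Ωᶻ-map LF zero    g n = refl
Ωᶻ-map {F} LF (suc a) g n = trans (add LF (w ⊕ w₁) w₂ n)
  (cong₂ _+ᶻ_ (trans (add LF w w₁ n)
    (cong₂ _+ᶻ_ (Ωᶻ-map LF a g n) (Ωᶻ-map LF a (λ k l → g (suc k) l) n)))
    (Ωᶻ-map LF a (λ k l → g k (suc l)) n))
  where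
  w w₁ w₂ : Seq
  w  n = Ωᶻ a (λ k l → g k l n)
  w₁ n = Ωᶻ a (λ k l → g (suc k) l n)
  w₂ n = Ωᶻ a (λ k l → g k (suc l) n)

diag-Ωᶻ : ∀ a (F : ℕ → ℕ → ℕ → ℕ → ℤ) →
  diag (λ u v → Ωᶻ a (F u v)) ≗ (λ n → Ωᶻ a (λ k l → diag (λ u v → F u v k l) n))
diag-Ωᶻ zero    F n = refl
diag-Ωᶻ (suc a) F n = trans
  (diag-+ (λ u v → Ωᶻ a (F u v) +ᶻ Ωᶻ a (λ k l → F u v (suc k) l)) (λ u v → Ωᶻ a (λ k l → F u v k (suc l))) n)
  (cong₂ _+ᶻ_ (trans (diag-+ (λ u v → Ωᶻ a (F u v)) (λ u v → Ωᶻ a (λ k l → F u v (suc k) l)) n)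
    (cong₂ _+ᶻ_ (diag-Ωᶻ a F n) (diag-Ωᶻ a (λ u v k l → F u v (suc k) l) n)))
    (diag-Ωᶻ a (λ u v k l → F u v k (suc l)) n))

Ω-id : ∀ a g n → Ω id a g n ≡ Ωᶻ a (λ k l → g k l n)
Ω-id zero    g n = refl
Ω-id (suc a) g n = cong₂ _+ᶻ_ (cong₂ _+ᶻ_ (Ω-id a g n) (Ω-id a _ n)) (Ω-id a _ n)

module _ {C : Seq → Seq} (LC : Linear C) where

  Ω-cong : ∀ a {g h} → (∀ k l → g k l ≗ h k l) → Ω C a g ≗ Ω C a h
  Ω-cong zero    p = p 0 0
  Ω-cong (suc a) p n = cong₂ _+ᶻ_ (cong₂ _+ᶻ_ (resp LC (Ω-cong a p) n)
    (Ω-cong a (λ k l → p (suc k) l) n)) (Ω-cong a (λ k l → p k (suc l)) n)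

  Ω-map : ∀ {F} → Linear F → Commutes F C → ∀ a g →
    F (Ω C a g) ≗ Ω C a (λ k l → F (g k l))
  Ω-map LF c zero    g n = refl
  Ω-map {F} LF c (suc a) g n = trans (add LF (C (Ω C a g) ⊕ w₁) w₂ n)
    (cong₂ _+ᶻ_ (trans (add LF (C (Ω C a g)) w₁ n)
      (cong₂ _+ᶻ_ (trans (c (Ω C a g) n) (resp LC (Ω-map LF c a g) n)) (Ω-map LF c a _ n)))
      (Ω-map LF c a _ n))
    where
    w₁ w₂ : Seq
    w₁ = Ω C a (λ k l → g (suc k) l)
    w₂ = Ω C a (λ k l → g k (suc l))

  Ω-⊕ : ∀ a g h → Ω C a (λ k l → g k l ⊕ h k l) ≗ (Ω C a g ⊕ Ω C a h)
  Ω-⊕ zero    g h n = refl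
  Ω-⊕ (suc a) g h n = trans
    (cong₂ _+ᶻ_ (cong₂ _+ᶻ_ (trans (resp LC (Ω-⊕ a g h) n) (add LC (Ω C a g) (Ω C a h) n))
      (Ω-⊕ a _ _ n)) (Ω-⊕ a _ _ n))
    (rearrange (C (Ω C a g) n) (C (Ω C a h) n) (Ω C a (λ k l → g (suc k) l) n) (Ω C a (λ k l → h (suc k) l) n)
       (Ω C a (λ k l → g k (suc l)) n) (Ω C a (λ k l → h k (suc l)) n))
    where
    rearrange : ∀ a b c d e f → a +ᶻ b +ᶻ (c +ᶻ d) +ᶻ (e +ᶻ f) ≡ a +ᶻ c +ᶻ e +ᶻ (b +ᶻ d +ᶻ f)
    rearrange = solve-∀

-- W a u v counts the x ∈ ℤ^a with |x⁺| ≤ u and |x⁻| ≤ v.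

W : ℕ → ℕ → ℕ → ℤ
W zero    u v = + 1
W (suc a) u v = W a u v +ᶻ J (λ u′ → W a u′ v) u +ᶻ J (λ v′ → W a u v′) v

-- binom k n = C(n , k)
binom : ℕ → Seq
binom zero    = psum δ
binom (suc k) = J (binom k)

psum-δ : ∀ n → psum δ n ≡ + 1
psum-δ zero    = refl
psum-δ (suc n) = trans (ℤₚ.+-identityʳ _) (psum-δ n)

-- The word is the sign pattern of x. Positive entries at k given places are k positive integers of
-- sum at most u, for which there are C(u , k) choices; likewise for the negative entries and v.
W-Ω : ∀ a u v → W a u v ≡ Ωᶻ a (λ k l → binom k u *ᶻ binom l v)
W-Ω zero    u v = sym (cong₂ _*ᶻ_ (psum-δ u) (psum-δ v))
W-Ω (suc a) u v = cong₂ _+ᶻ_ (cong₂ _+ᶻ_ (W-Ω a u v)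
  (trans (resp J-linear (λ u′ → W-Ω a u′ v) u)
  (trans (Ωᶻ-map J-linear a (λ k l u′ → binom k u′ *ᶻ binom l v) u)
         (Ωᶻ-cong a λ k l → trans (resp J-linear (λ u′ → ℤₚ.*-comm (binom k u′) (binom l v)) u)
            (trans (scale J-linear (binom l v) (binom k) u) (ℤₚ.*-comm (binom l v) (J (binom k) u)))))))
  (trans (resp J-linear (λ v′ → W-Ω a u v′) v)
  (trans (Ωᶻ-map J-linear a (λ k l v′ → binom k u *ᶻ binom l v′) v)
         (Ωᶻ-cong a λ k l → scale J-linear (binom k u) (binom l) v)))

-- The diagonal series `D` as a sum over pairs of sign words.

A : ℕ → ℕ → Seq
A k k′ n = binom k n *ᶻ binom k′ n

D : ℕ → ℕ → Seq
D a b = diag (λ u v → W a u v *ᶻ W b u v)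

Ω² : (Seq → Seq) → ℕ → ℕ → (ℕ → ℕ → ℕ → ℕ → Seq) → Seq
Ω² C a b t = Ω C a (λ i j → Ω C b (t i j))

-- For fixed words the binomials in u come from the two numbers of + and those in v from the two
-- numbers of -, so the sum over u + v = n is a Cauchy product.
D-Ω² : ∀ a b → D a b ≗ Ω² id a b (λ k l k′ l′ → conv (A k k′) (A l l′))
D-Ω² a b n =
  trans (diag-cong (λ u v → trans (cong₂ _*ᶻ_ (W-Ω a u v) (W-Ω b u v))
    (trans (Ωᶻ-*ʳ a (λ k l → binom k u *ᶻ binom l v) _)
           (Ωᶻ-cong a λ k l → trans (Ωᶻ-* b (binom k u *ᶻ binom l v) (λ k′ l′ → binom k′ u *ᶻ binom l′ v))
             (Ωᶻ-cong b λ k′ l′ → rearrange (binom k u) (binom l v) (binom k′ u) (binom l′ v))))) n)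
  (trans (diag-Ωᶻ a (λ u v k l → Ωᶻ b (λ k′ l′ → A k k′ u *ᶻ A l l′ v)) n)
  (trans (Ωᶻ-cong a λ k l → trans (diag-Ωᶻ b (λ u v k′ l′ → A k k′ u *ᶻ A l l′ v) n)
           (sym (Ω-id b (λ k′ l′ → conv (A k k′) (A l l′)) n)))
         (sym (Ω-id a (λ k l → Ω id b (λ k′ l′ → conv (A k k′) (A l l′))) n))))
  where
  rearrange : ∀ p q r s → p *ᶻ q *ᶻ (r *ᶻ s) ≡ p *ᶻ r *ᶻ (q *ᶻ s)
  rearrange = solve-∀

-- The family A expands orthogonally: with θ = s/(1-s), A k k′ is the pairing of
-- (θ + X)^k and (θ + X)^k′ for which the powers of X are orthogonal and X^i has
-- norm (s/(1-s)²)^i/(1-s).  U i i′ k k′ is the pairing of X^i(θ + X)^k with X^i′(θ + X)^k′.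

T : ℕ → ℕ → Seq
T zero    zero     = psum δ
T zero    (suc i′) = 𝟘
T (suc i) zero     = 𝟘
T (suc i) (suc i′) = J (psum (T i i′))

U : ℕ → ℕ → ℕ → ℕ → Seq
U i i′ zero    zero     = T i i′
U i i′ zero    (suc k′) = J (U i i′ zero k′) ⊕ U i (suc i′) zero k′
U i i′ (suc k) k′       = J (U i i′ k k′) ⊕ U (suc i) i′ k k′

-- `U` unfolds its left factors first, so expanding a right factor θ + X holds by definition only
-- for k = 0. In general it is bilinearity of the pairing.
U-sucʳ : ∀ k i i′ k′ → U i i′ k (suc k′) ≗ (J (U i i′ k k′) ⊕ U i (suc i′) k k′)
U-sucʳ zero    i i′ k′ n = refl
U-sucʳ (suc k) i i′ k′ n = trans
  (cong₂ _+ᶻ_ (trans (resp J-linear (U-sucʳ k i i′ k′) n) (add J-linear (J (U i i′ k k′)) (U i (suc i′) k k′) n))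
              (U-sucʳ k (suc i) i′ k′ n))
  (trans (interchange (J (J (U i i′ k k′)) n) (J (U i (suc i′) k k′) n) (J (U (suc i) i′ k k′) n)
      (U (suc i) (suc i′) k k′ n))
         (cong (_+ᶻ (J (U i (suc i′) k k′) n +ᶻ U (suc i) (suc i′) k k′ n))
           (sym (add J-linear (J (U i i′ k k′)) (U (suc i) i′ k k′) n))))

J-psum : Commutes J psum
J-psum f = ≗-sym (psum-shift (psum f))

J-Jpsum : Commutes J (J ∘ psum)
J-Jpsum f = resp J-linear (J-psum f)

-- Multiplying both arguments by X scales the pairing by s/(1-s)², the ratio of successive norms.
U-suc-suc : ∀ k k′ i i′ → U (suc i) (suc i′) k k′ ≗ J (psum (U i i′ k k′))
U-suc-suc zero    zero     i i′ n = refl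
U-suc-suc zero    (suc k′) i i′ n = trans
  (cong₂ _+ᶻ_ (trans (resp J-linear (U-suc-suc zero k′ i i′) n) (J-Jpsum (U i i′ zero k′) n))
              (U-suc-suc zero k′ i (suc i′) n))
  (sym (add (∘-linear J-linear psum-linear) (J (U i i′ zero k′)) (U i (suc i′) zero k′) n))
U-suc-suc (suc k) k′ i i′ n = trans
  (cong₂ _+ᶻ_ (trans (resp J-linear (U-suc-suc k k′ i i′) n) (J-Jpsum (U i i′ k k′) n))
              (U-suc-suc k k′ (suc i) i′ n))
  (sym (add (∘-linear J-linear psum-linear) (J (U i i′ k k′)) (U (suc i) i′ k k′) n))

-- A multiple of X has no constant term and is therefore orthogonal to 1.
U-zeroˡ : ∀ k i → U (suc i) 0 k 0 ≗ 𝟘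
U-zeroˡ zero    i n = refl
U-zeroˡ (suc k) i n = cong₂ _+ᶻ_ (trans (resp J-linear (U-zeroˡ k i) n) (zero-map J-linear n)) (U-zeroˡ k (suc i) n)

U-zeroʳ : ∀ k′ i′ → U 0 (suc i′) 0 k′ ≗ 𝟘
U-zeroʳ zero     i′ n = refl
U-zeroʳ (suc k′) i′ n = cong₂ _+ᶻ_ (trans (resp J-linear (U-zeroʳ k′ i′) n) (zero-map J-linear n))
    (U-zeroʳ k′ (suc i′) n)

binom-Uˡ : ∀ k → binom k ≗ U 0 0 k 0
binom-Uˡ zero    n = refl
binom-Uˡ (suc k) n = trans (resp J-linear (binom-Uˡ k) n)
  (sym (trans (cong (J (U 0 0 k 0) n +ᶻ_) (U-zeroˡ k 0 n)) (ℤₚ.+-identityʳ _)))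

binom-Uʳ : ∀ k → binom k ≗ U 0 0 0 k
binom-Uʳ zero    n = refl
binom-Uʳ (suc k) n = trans (resp J-linear (binom-Uʳ k) n)
  (sym (trans (cong (J (U 0 0 0 k) n +ᶻ_) (U-zeroʳ k 0 n)) (ℤₚ.+-identityʳ _)))

-- Discrete product rule: by Pascal's rule the increment of C(n , k+1) C(n , k′+1) in n is the sum
-- of these three products, and `J` adds up increments.
A-suc-suc : ∀ k k′ → A (suc k) (suc k′) ≗ J (A k (suc k′) ⊕ A (suc k) k′ ⊕ A k k′)
A-suc-suc k k′ zero          = refl
A-suc-suc k k′ (suc zero)    = ring (binom k 0) (binom k′ 0)
  where
  ring : ∀ x y → x *ᶻ y ≡ x *ᶻ (+ 0) +ᶻ (+ 0) *ᶻ y +ᶻ x *ᶻ y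
  ring = solve-∀
A-suc-suc k k′ (suc (suc n)) = trans
  (ring (psum (binom k) n) (binom k (suc n)) (psum (binom k′) n) (binom k′ (suc n)))
  (cong (_+ᶻ (A k (suc k′) ⊕ A (suc k) k′ ⊕ A k k′) (suc n)) (A-suc-suc k k′ (suc n)))
  where
  ring : ∀ p x q y → (p +ᶻ x) *ᶻ (q +ᶻ y) ≡ p *ᶻ q +ᶻ (x *ᶻ q +ᶻ p *ᶻ y +ᶻ x *ᶻ y)
  ring = solve-∀

-- The pairing satisfies the recurrence of `A-suc-suc` too: after expanding one factor θ + X on each
-- side, the term with X against X contributes s/(1-s)² = θ + θ².
A-U : ∀ k k′ → A k k′ ≗ U 0 0 k k′
A-U zero    k′       n = trans (cong (_*ᶻ binom k′ n) (psum-δ n)) (trans (ℤₚ.*-identityˡ _) (binom-Uʳ k′ n))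
A-U (suc k) zero     n = trans (cong (binom (suc k) n *ᶻ_) (psum-δ n)) (trans (ℤₚ.*-identityʳ _) (binom-Uˡ (suc k) n))
A-U (suc k) (suc k′) n = trans (A-suc-suc k k′ n)
  (trans (resp J-linear (λ m → cong₂ _+ᶻ_ (cong₂ _+ᶻ_ (A-U k (suc k′) m) (A-U (suc k) k′ m)) (A-U k k′ m)) n)
  (trans (add J-linear (U 0 0 k (suc k′) ⊕ (J u ⊕ u₁)) u n)
  (trans (cong (_+ᶻ J u n) (trans (add J-linear (U 0 0 k (suc k′)) (J u ⊕ u₁) n)
           (cong (J (U 0 0 k (suc k′)) n +ᶻ_) (add J-linear (J u) u₁ n))))
  (trans (ring (J (U 0 0 k (suc k′)) n) (J (J u) n) (J u₁ n) (J u n))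
         (cong (J (U 0 0 k (suc k′)) n +ᶻ_)
           (sym (trans (U-sucʳ k 1 0 k′ n) (cong (J u₁ n +ᶻ_)
             (trans (U-suc-suc k k′ 0 0 n) (trans (resp J-linear (psum-J u) n) (add J-linear u (J u) n))))))))))) 
  where
  u u₁ : Seq
  u  = U 0 0 k k′
  u₁ = U 1 0 k k′
  ring : ∀ p q r s → p +ᶻ (q +ᶻ r) +ᶻ s ≡ p +ᶻ (r +ᶻ (s +ᶻ q))
  ring = solve-∀

1+2J : Seq → Seq
1+2J f = f ⊕ J f ⊕ J f

1+2J-linear : Linear 1+2J
1+2J-linear = ⊕-linear (⊕-linear id-linear J-linear) J-linear

-- V i j k l stands for X₊^i X₋^j (θ + X₊)^k (θ + X₋)^l, of which the two hypotheses retain just the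
-- expansion of one more factor. The two copies of θ that the letters + and - produce are added to
-- the weight 1 of the letter 0.
Ω-recenter : ∀ a (V : ℕ → ℕ → ℕ → ℕ → Seq) →
  (∀ i j k l → V i j (suc k) l ≗ (J (V i j k l) ⊕ V (suc i) j k l)) →
  (∀ i j k l → V i j k (suc l) ≗ (J (V i j k l) ⊕ V i (suc j) k l)) →
  Ω id a (V 0 0) ≗ Ω 1+2J a (λ i j → V i j 0 0)
Ω-recenter zero    V p q n = refl
Ω-recenter (suc a) V p q n = trans
  (cong₂ _+ᶻ_ (cong (Ω id a (V 0 0) n +ᶻ_) (step (p 0 0) n)) (step (q 0 0) n))
  (trans (ring (Ω id a (V 0 0) n) (J (Ω id a (V 0 0)) n) (Ω id a (V 1 0) n) (Ω id a (V 0 1) n))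
    (cong₂ _+ᶻ_ (cong₂ _+ᶻ_ (resp 1+2J-linear (Ω-recenter a V p q) n)
      (Ω-recenter a (V ∘ suc) (p ∘ suc) (q ∘ suc) n))
      (Ω-recenter a (λ i j → V i (suc j)) (λ i j → p i (suc j)) (λ i j → q i (suc j)) n)))
  where
  step : ∀ {g h : ℕ → ℕ → Seq} → (∀ k l → g k l ≗ (J (V 0 0 k l) ⊕ h k l)) →
    Ω id a g ≗ (J (Ω id a (V 0 0)) ⊕ Ω id a h)
  step {g} {h} e n = trans (Ω-cong id-linear a e n)
    (trans (Ω-⊕ id-linear a (λ k l → J (V 0 0 k l)) h n)
           (cong (_+ᶻ Ω id a h n) (sym (Ω-map id-linear J-linear (λ _ _ → refl) a (V 0 0) n))))
  ring : ∀ x y z w → x +ᶻ (y +ᶻ z) +ᶻ (y +ᶻ w) ≡ x +ᶻ y +ᶻ y +ᶻ z +ᶻ w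
  ring = solve-∀

D-recentered : ∀ a b → D a b ≗ Ω² 1+2J a b (λ i j i′ j′ → conv (T i i′) (T j j′))
D-recentered a b = ≗-trans (D-Ω² a b)
  (≗-trans (Ω-cong id-linear a (λ k l → ≗-trans
     (Ω-cong id-linear b (λ k′ l′ → conv-cong (A-U k k′) (A-U l l′)))
     -- The word of length b is recentred first, while no power of X has yet arisen from the other
     -- word; the word of length a follows, when the right factors θ + X are used up.
     (Ω-recenter b (λ i′ j′ k′ l′ → conv (U 0 i′ k k′) (U 0 j′ l l′))
       (λ i′ j′ k′ l′ → convˡ (U 0 j′ l l′) (U-sucʳ k 0 i′ k′))
       (λ i′ j′ k′ l′ → convʳ (U 0 i′ k k′) (U-sucʳ l 0 j′ l′)))))
  (Ω-recenter a (λ i j k l → Ω 1+2J b (λ i′ j′ → conv (U i i′ k 0) (U j j′ l 0)))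
       (λ i j k l → ≗-trans (Ω-cong 1+2J-linear b (λ i′ j′ → convˡ (U j j′ l 0) (λ _ → refl))) (split _ _))
       (λ i j k l → ≗-trans (Ω-cong 1+2J-linear b (λ i′ j′ → convʳ (U i i′ k 0) (λ _ → refl))) (split _ _))))
  where
  convˡ : ∀ g {f f₁ f₂} → f ≗ (J f₁ ⊕ f₂) → conv f g ≗ (J (conv f₁ g) ⊕ conv f₂ g)
  convˡ g {f} {f₁} {f₂} e n = trans (resp (conv-linear g) e n)
    (trans (add (conv-linear g) (J f₁) f₂ n) (cong (_+ᶻ conv f₂ g n) (conv-J g f₁ n)))
  convʳ : ∀ f {g g₁ g₂} → g ≗ (J g₁ ⊕ g₂) → conv f g ≗ (J (conv f g₁) ⊕ conv f g₂)
  convʳ f {g} {g₁} {g₂} e n = trans (resp (conv-linearʳ f) e n)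
    (trans (add (conv-linearʳ f) (J g₁) g₂ n) (cong (_+ᶻ conv f g₂ n) (commutesʳ J-linear conv-J f g₁ n)))
  J-1+2J : Commutes J 1+2J
  J-1+2J f n = trans (add J-linear (f ⊕ J f) (J f) n) (cong (_+ᶻ J (J f) n) (add J-linear f (J f) n))
  split : ∀ g h → Ω 1+2J b (λ i j → J (g i j) ⊕ h i j) ≗ (J (Ω 1+2J b g) ⊕ Ω 1+2J b h)
  split g h n = trans (Ω-⊕ 1+2J-linear b (λ i j → J (g i j)) h n)
    (cong (_+ᶻ Ω 1+2J b h n) (sym (Ω-map 1+2J-linear J-linear J-1+2J b g n)))

-- Clearing the denominators: T i i′ = T̃ i i′/(1-s)^(i+i′+1) and 1 + 2θ = (1+s)/(1-s).

T̃ : ℕ → ℕ → Seq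
T̃ zero    zero     = δ
T̃ zero    (suc i′) = 𝟘
T̃ (suc i) zero     = 𝟘
T̃ (suc i) (suc i′) = shift (T̃ i i′)

psumⁿ-linear : ∀ n → Linear (iter psum n)
psumⁿ-linear = iter-linear psum-linear

T-T̃ : ∀ i i′ → T i i′ ≗ iter psum (i + (i′ + 1)) (T̃ i i′)
T-T̃ zero    zero     n = refl
T-T̃ zero    (suc i′) n = sym (zero-map (psumⁿ-linear (suc i′ + 1)) n)
T-T̃ (suc i) zero     n = sym (zero-map (psumⁿ-linear (suc i + 1)) n)
T-T̃ (suc i) (suc i′) n = trans (resp (∘-linear J-linear psum-linear) (T-T̃ i i′) n)
  (trans (sym (psum-shift (psum (iter psum r (T̃ i i′))) n))
  (trans (resp psum-linear (λ m → trans (sym (commutes-iter psum-linear psum-shift (suc r) (T̃ i i′) m))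
                                        (cong (λ k → iter psum k (shift (T̃ i i′)) m) (sym (ℕₚ.+-suc i (i′ + 1))))) n)
         refl))
  where r = i + (i′ + 1)

-- The total exponent (i + i′ + 1) + (j + j′ + 1) is regrouped by words: i + j and i′ + j′ are the
-- numbers of nonzero letters of the two words, which is the form that `Ω-clear` absorbs.
conv-T : ∀ i j i′ j′ → conv (T i i′) (T j j′) ≗
  iter psum (i + j) (iter psum (i′ + j′) (iter psum 2 (conv (T̃ i i′) (T̃ j j′))))
conv-T i j i′ j′ n = trans (conv-cong (T-T̃ i i′) (T-T̃ j j′) n)
  (trans (iter-commutes psum-linear (conv-psum (iter psum q (T̃ j j′))) p (T̃ i i′) n)
  (trans (resp (psumⁿ-linear p)
    (iter-commutes psum-linear (commutesʳ psum-linear conv-psum (T̃ i i′)) q (T̃ j j′)) n)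
  (cong (λ F → F n) (trans (sym (iter-+ psum p q X))
    (trans (cong (λ k → iter psum k X) (exponents i i′ j j′))
    (trans (iter-+ psum (i + j) (i′ + j′ + 2) X) (cong (iter psum (i + j)) (iter-+ psum (i′ + j′) 2 X))))))))
  where
  p = i + (i′ + 1)
  q = j + (j′ + 1)
  X = conv (T̃ i i′) (T̃ j j′)
  exponents : ∀ i i′ j j′ → i + (i′ + 1) + (j + (j′ + 1)) ≡ i + j + (i′ + j′ + 2)
  exponents = ℕSolver.solve-∀

1+2J-psum : ∀ f → 1+2J f ≗ psum (1+shift f)
1+2J-psum f n = trans (cong (_+ᶻ J f n) (sym (psum-J f n)))
  (trans (cong (psum f n +ᶻ_) (sym (psum-shift f n))) (sym (add psum-linear f (shift f) n)))

psum-1+2J : Commutes psum 1+2J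
psum-1+2J f n = trans (add psum-linear (f ⊕ J f) (J f) n)
  (cong₂ _+ᶻ_ (trans (add psum-linear f (J f) n) (cong (psum f n +ᶻ_) (sym (J-psum f n)))) (sym (J-psum f n)))

psum-1+shift : Commutes psum 1+shift
psum-1+shift f n = trans (add psum-linear f (shift f) n) (cong (psum f n +ᶻ_) (psum-shift f n))

-- A zero letter carries (1+s)/(1-s) and any other letter 1/(1-s), so every word releases exactly
-- one denominator per letter and only the 1+s of the zero letters stay behind.
Ω-clear : ∀ a (t : ℕ → ℕ → Seq) →
  Ω 1+2J a (λ i j → iter psum (i + j) (t i j)) ≗ iter psum a (Ω 1+shift a t)
Ω-clear zero    t n = refl
Ω-clear (suc a) t n = trans
  (cong₂ _+ᶻ_ (cong₂ _+ᶻ_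
    (trans (resp 1+2J-linear (Ω-clear a t) n)
    (trans (1+2J-psum (iter psum a (Ω 1+shift a t)) n)
           (resp psum-linear (λ m → sym (commutes-iter psum-linear psum-1+shift a (Ω 1+shift a t) m)) n)))
    (step (λ i j → t (suc i) j) n))
    (trans (Ω-cong 1+2J-linear a (λ i j m → cong (λ k → iter psum k (t i (suc j)) m) (ℕₚ.+-suc i j)) n)
           (step (λ i j → t i (suc j)) n)))
  (sym (trans (add L (1+shift w ⊕ w₁) w₂ n) (cong (_+ᶻ iter psum (suc a) w₂ n) (add L (1+shift w) w₁ n))))
  where
  L = psumⁿ-linear (suc a)
  w w₁ w₂ : Seq
  w  = Ω 1+shift a t
  w₁ = Ω 1+shift a (λ k l → t (suc k) l)
  w₂ = Ω 1+shift a (λ k l → t k (suc l))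
  step : ∀ t → Ω 1+2J a (λ i j → iter psum (suc (i + j)) (t i j)) ≗ iter psum (suc a) (Ω 1+shift a t)
  step t m = trans (sym (Ω-map 1+2J-linear psum-linear psum-1+2J a (λ i j → iter psum (i + j) (t i j)) m))
    (resp psum-linear (Ω-clear a t) m)

G : ℕ → ℕ → Seq
G a b = Ω² 1+shift a b (λ i j i′ j′ → conv (T̃ i i′) (T̃ j j′))

-- Of the denominators, a + b belong to the letters of the two words; the other 2 come from the two
-- pairings, since already 1 paired with 1 is 1/(1-s).
D-G : ∀ a b → D a b ≗ iter psum (a + b + 2) (G a b)
D-G a b n = trans (D-recentered a b n)
  (trans (Ω-cong 1+2J-linear a (λ i j → ≗-trans
     (Ω-cong 1+2J-linear b (λ i′ j′ → conv-T i j i′ j′))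
     (≗-trans (≗-sym (Ω-map 1+2J-linear (psumⁿ-linear (i + j)) (commutes-iter psum-linear psum-1+2J (i + j)) b
                 (λ i′ j′ → iter psum (i′ + j′) (iter psum 2 (conv (T̃ i i′) (T̃ j j′))))))
              (resp (psumⁿ-linear (i + j)) (≗-trans (Ω-clear b (λ i′ j′ → iter psum 2 (conv (T̃ i i′) (T̃ j j′))))
                (resp (psumⁿ-linear b) (≗-sym (Ω-map 1+shift-linear (psumⁿ-linear 2)
                    (commutes-iter psum-linear psum-1+shift 2) b
                   (λ i′ j′ → conv (T̃ i i′) (T̃ j j′))))))))) n)
  (trans (Ω-clear a (λ i j → iter psum b (iter psum 2 (Ω 1+shift b (λ i′ j′ → conv (T̃ i i′) (T̃ j j′))))) n)
  (trans (resp (psumⁿ-linear a) (λ m → sym (Ω-map 1+shift-linear (∘-linear (psumⁿ-linear b) (psumⁿ-linear 2))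
            (λ f → ≗-trans (resp (psumⁿ-linear b) (commutes-iter psum-linear psum-1+shift 2 f))
                (commutes-iter psum-linear psum-1+shift b (iter psum 2 f)))
            a (λ i j → Ω 1+shift b (λ i′ j′ → conv (T̃ i i′) (T̃ j j′))) m)) n)
  (cong (λ F → F n) (sym (trans (iter-+ psum (a + b) 2 (G a b)) (iter-+ psum a b (iter psum 2 (G a b)))))))))

-- (1-s²)·D = H turns the denominator (1-s)^(a+b+2) into (1-s)^(a+b+1)/(1+s).
H-G : ∀ a b (H : Seq) → (H ⊕ shift (shift (D a b))) ≗ D a b →
  H ≗ iter psum (suc (a + b)) (1+shift (G a b))
H-G a b H e n = +ᶻ-cancelʳ (shift (shift (D a b)) n) _ _ (trans (e n) (trans (D-E n)
  (trans (psum-J E n)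
  (trans (cong (E n +ᶻ_) (trans (resp shift-linear (psum-J E) n) (add shift-linear E (J E) n)))
  (trans (sym (ℤₚ.+-assoc (E n) (shift E n) (shift (shift (psum E)) n)))
  (cong₂ _+ᶻ_ (sym (commutes-iter psum-linear psum-1+shift (suc (a + b)) (G a b) n))
              (resp (∘-linear shift-linear shift-linear) (≗-sym D-E) n)))))))
  where
  E : Seq
  E = iter psum (suc (a + b)) (G a b)
  D-E : D a b ≗ psum E
  D-E m = trans (D-G a b m) (cong (λ k → iter psum k (G a b) m) (ℕₚ.+-comm (a + b) 2))

-- Sums over all subsets

∑ : ∀ {m} → (Subset m → ℕ) → ℕ
∑ {m} f = sum (List.map f (allSubsets m))

∑-suc : ∀ {m} (f : Subset (suc m) → ℕ) → ∑ f ≡ ∑ (f ∘ (true ∷_)) + ∑ (f ∘ (false ∷_))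
∑-suc {m} f = trans (cong sum (Listₚ.map-++ f (List.map (true ∷_) (allSubsets m)) _))
  (trans (Sumₚ.sum-++ (List.map f (List.map (true ∷_) (allSubsets m))) _)
  (cong₂ _+_ (cong sum (sym (Listₚ.map-∘ (allSubsets m)))) (cong sum (sym (Listₚ.map-∘ (allSubsets m))))))

∑-cong : ∀ {m} {f g : Subset m → ℕ} → (∀ S → f S ≡ g S) → ∑ f ≡ ∑ g
∑-cong {m} p = cong sum (Listₚ.map-cong p (allSubsets m))

∑-zero : ∀ {m} → ∑ {m} (λ _ → 0) ≡ 0
∑-zero {zero}  = refl
∑-zero {suc m} = trans (∑-suc {m} (λ _ → 0)) (cong₂ _+_ (∑-zero {m}) (∑-zero {m}))

≤-∑ : ∀ {m} (f : Subset m → ℕ) S → f S ≤ ∑ f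
≤-∑ f []          = ℕₚ.m≤m+n (f []) 0
≤-∑ f (true ∷ S)  = ℕₚ.≤-trans (≤-∑ (f ∘ (true ∷_)) S)
  (ℕₚ.≤-trans (ℕₚ.m≤m+n _ (∑ (f ∘ (false ∷_)))) (ℕₚ.≤-reflexive (sym (∑-suc f))))
≤-∑ f (false ∷ S) = ℕₚ.≤-trans (≤-∑ (f ∘ (false ∷_)) S)
  (ℕₚ.≤-trans (ℕₚ.m≤n+m _ (∑ (f ∘ (true ∷_)))) (ℕₚ.≤-reflexive (sym (∑-suc f))))

∑-positive : ∀ {m} (f : Subset m → ℕ) → ∑ f ≢ 0 → Σ (Subset m) λ S → f S ≢ 0
∑-positive {zero}  f p = [] , λ q → p (cong (_+ 0) q)
∑-positive {suc m} f p with ∑ (f ∘ (true ∷_)) ℕ.≟ 0 | ∑ (f ∘ (false ∷_)) ℕ.≟ 0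
... | no q  | _     = let S , r = ∑-positive (f ∘ (true ∷_)) q in true ∷ S , r
... | yes _ | no q  = let S , r = ∑-positive (f ∘ (false ∷_)) q in false ∷ S , r
... | yes q | yes r = ⊥-elim (p (trans (∑-suc f) (cong₂ _+_ q r)))

-- Coefficients of f-polynomials

coeff-map : ∀ (g : ℕ → ℤ) (f : ℕ → ℕ) n k → (n ≤ k → g (f k) ≡ + 0) →
  coeff (List.map g (List.applyUpTo f n)) k ≡ g (f k)
coeff-map g f zero    k       z = sym (z z≤n)
coeff-map g f (suc n) zero    z = refl
coeff-map g f (suc n) (suc k) z = coeff-map g (f ∘ suc) n k (z ∘ s≤s)

indicator : ℕ → ℕ → ℕ
indicator k n = if n ≡ᵇ k then 1 else 0

if-∧ : ∀ b c (x y : ℕ) → (if b ∧ c then x else y) ≡ (if b then (if c then x else y) else y)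
if-∧ true  c x y = refl
if-∧ false c x y = refl

faceSum : ∀ {m} → Complex m → (ℕ → ℕ) → ℕ
faceSum Δ φ = ∑ (λ S → if isFace Δ S then φ ∣ S ∣ else 0)

faceCount-faceSum : ∀ {m} (Δ : Complex m) k → faceCount Δ k ≡ faceSum Δ (indicator k)
faceCount-faceSum Δ k = ∑-cong λ S → if-∧ (isFace Δ S) _ 1 0

≡ᵇ-false : ∀ m n → m ≢ n → (m ≡ᵇ n) ≡ false
≡ᵇ-false m n p = dec-false (m ℕ.≟ n) p

≡ᵇ-true : ∀ m → (m ≡ᵇ m) ≡ true
≡ᵇ-true m = dec-true (m ℕ.≟ m) refl

faceCount-large : ∀ {m} (Δ : Complex m) k → m < k → faceCount Δ k ≡ 0
faceCount-large {m} Δ k m<k = trans (∑-cong zeros) (∑-zero {m})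
  where
  zeros : ∀ S → (if isFace Δ S ∧ does (∣ S ∣ ℕ.≟ k) then 1 else 0) ≡ 0
  zeros S = trans (cong (λ b → if isFace Δ S ∧ b then 1 else 0)
      (≡ᵇ-false ∣ S ∣ k (ℕₚ.<⇒≢ (ℕₚ.≤-<-trans (Subsetₚ.∣p∣≤n S) m<k))))
    (cong (if_then 1 else 0) (Boolₚ.∧-zeroʳ (isFace Δ S)))

coeff-fPoly : ∀ {m} (Δ : Complex m) k → coeff (fPoly Δ) k ≡ + faceCount Δ k
coeff-fPoly {m} Δ k = coeff-map (λ k → + faceCount Δ k) id (suc m) k
  (λ m<k → cong +_ (faceCount-large Δ k m<k))


sumℤ-zero : ∀ {k} (f : Fin k → ℤ) → (∀ i → f i ≡ + 0) → sumℤ f ≡ + 0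
sumℤ-zero {zero}  f p = refl
sumℤ-zero {suc k} f p = cong₂ _+ᶻ_ (p Fin.zero) (sumℤ-zero (f ∘ Fin.suc) (p ∘ Fin.suc))

-- `iter shift i δ` is the monomial s^i, so only i = n survives; the proviso handles an n beyond the
-- range of summation.
sift-shift : ∀ K (g : ℕ → ℤ) n → (K ≤ n → g n ≡ + 0) →
  sumℤ {K} (λ i → g (Fin.toℕ i) *ᶻ iter shift (Fin.toℕ i) δ n) ≡ g n
sift-shift zero    g n       z = sym (z z≤n)
sift-shift (suc K) g zero    z = trans
  (cong (g 0 *ᶻ (+ 1) +ᶻ_) (sumℤ-zero {K} _ (λ i → ℤₚ.*-zeroʳ (g (suc (Fin.toℕ i))))))
  (trans (ℤₚ.+-identityʳ _) (ℤₚ.*-identityʳ (g 0)))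
sift-shift (suc K) g (suc n) z = trans
  (cong₂ _+ᶻ_ (ℤₚ.*-zeroʳ (g 0)) (sift-shift K (g ∘ suc) n (z ∘ s≤s)))
  (ℤₚ.+-identityˡ _)

sift-indicator : ∀ K (t : ℕ) (Φ : ℕ → ℤ) m → (K ≤ m → t ≡ 0) →
  sumℤ {K} (λ k → + (t * indicator (Fin.toℕ k) m) *ᶻ Φ (Fin.toℕ k)) ≡ + t *ᶻ Φ m
sift-indicator zero    t Φ m       z = cong (λ t → + t *ᶻ Φ m) (sym (z z≤n))
sift-indicator (suc K) t Φ zero    z = trans
  (cong₂ _+ᶻ_ (cong (λ t → + t *ᶻ Φ 0) (ℕₚ.*-identityʳ t))
    (sumℤ-zero {K} _ (λ k → cong (λ t → + t *ᶻ Φ (suc (Fin.toℕ k))) (ℕₚ.*-zeroʳ t))))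
  (ℤₚ.+-identityʳ _)
sift-indicator (suc K) t Φ (suc m) z = trans
  (cong₂ _+ᶻ_ (cong (λ t → + t *ᶻ Φ 0) (ℕₚ.*-zeroʳ t)) (sift-indicator K t (Φ ∘ suc) m (z ∘ s≤s)))
  (ℤₚ.+-identityˡ _)

-- Clique complexes

module Clique {V : Set} (r : V → V → Bool) where

  -- `r` is always read from an earlier to a later entry of the list, so an asymmetric relation can
  -- describe the graph.
  inNbr : V → (vs : List V) → Subset (length vs) → Bool
  inNbr v []       []          = true
  inNbr v (w ∷ vs) (true ∷ S)  = r v w ∧ inNbr v vs S
  inNbr v (w ∷ vs) (false ∷ S) = inNbr v vs S

  isClique : (vs : List V) → Subset (length vs) → Bool
  isClique []       []          = true
  isClique (v ∷ vs) (true ∷ S)  = inNbr v vs S ∧ isClique vs S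
  isClique (v ∷ vs) (false ∷ S) = isClique vs S

  ∧-trueˡ : ∀ {b c} → b ∧ c ≡ true → b ≡ true
  ∧-trueˡ {true} p = refl

  ∧-trueʳ : ∀ {b c} → b ∧ c ≡ true → c ≡ true
  ∧-trueʳ {true} p = p

  isClique-∅ : ∀ vs → isClique vs ∅ ≡ true
  isClique-∅ []       = refl
  isClique-∅ (v ∷ vs) = isClique-∅ vs

  inNbr-⊆ : ∀ v vs S T → T ⊆ S → inNbr v vs S ≡ true → inNbr v vs T ≡ true
  inNbr-⊆ v []       []          []          T⊆S p = refl
  inNbr-⊆ v (w ∷ vs) (true ∷ S)  (true ∷ T)  T⊆S p =
    cong₂ _∧_ (∧-trueˡ {r v w} p) (inNbr-⊆ v vs S T (Subsetₚ.drop-∷-⊆ T⊆S) (∧-trueʳ {r v w} p))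
  inNbr-⊆ v (w ∷ vs) (true ∷ S)  (false ∷ T) T⊆S p = inNbr-⊆ v vs S T (Subsetₚ.drop-∷-⊆ T⊆S) (∧-trueʳ {r v w} p)
  inNbr-⊆ v (w ∷ vs) (false ∷ S) (true ∷ T)  T⊆S p with () ← T⊆S here
  inNbr-⊆ v (w ∷ vs) (false ∷ S) (false ∷ T) T⊆S p = inNbr-⊆ v vs S T (Subsetₚ.drop-∷-⊆ T⊆S) p

  isClique-⊆ : ∀ vs S T → T ⊆ S → isClique vs S ≡ true → isClique vs T ≡ true
  isClique-⊆ []       []          []          T⊆S p = refl
  isClique-⊆ (v ∷ vs) (true ∷ S)  (true ∷ T)  T⊆S p =
    cong₂ _∧_ (inNbr-⊆ v vs S T (Subsetₚ.drop-∷-⊆ T⊆S) (∧-trueˡ {inNbr v vs S} p))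
              (isClique-⊆ vs S T (Subsetₚ.drop-∷-⊆ T⊆S) (∧-trueʳ {inNbr v vs S} p))
  isClique-⊆ (v ∷ vs) (true ∷ S)  (false ∷ T) T⊆S p = isClique-⊆ vs S T (Subsetₚ.drop-∷-⊆ T⊆S)
      (∧-trueʳ {inNbr v vs S} p)
  isClique-⊆ (v ∷ vs) (false ∷ S) (true ∷ T)  T⊆S p with () ← T⊆S here
  isClique-⊆ (v ∷ vs) (false ∷ S) (false ∷ T) T⊆S p = isClique-⊆ vs S T (Subsetₚ.drop-∷-⊆ T⊆S) p

  cliqueComplex : (vs : List V) → Complex (length vs)
  cliqueComplex vs = record
    { isFace = isClique vs ; emptyFace = isClique-∅ vs ; downward = isClique-⊆ vs }

  nonNbr : ∀ v vs S → inNbr v vs S ≡ false →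
    Σ (Subset (length vs)) λ T → T ⊆ S × ∣ T ∣ ≡ 1 × inNbr v vs T ≡ false
  nonNbr v []       []          ()
  nonNbr v (w ∷ vs) (false ∷ S) p = let T , q , c , f = nonNbr v vs S p in false ∷ T , Subsetₚ.s⊆s q , c , f
  nonNbr v (w ∷ vs) (true ∷ S)  p with r v w in eq
  ... | false = true ∷ ∅ , Subsetₚ.s⊆s (Subsetₚ.⊥⊆) , cong suc (Subsetₚ.∣⊥∣≡0 (length vs)) , cong (_∧ inNbr v vs ∅) eq
  ... | true  = let T , q , c , f = nonNbr v vs S p in false ∷ T , Subsetₚ.out⊆ q , c , f

  nonClique : ∀ vs S → isClique vs S ≡ false →
    Σ (Subset (length vs)) λ T → T ⊆ S × ∣ T ∣ ≡ 2 × isClique vs T ≡ false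
  nonClique []       []          ()
  nonClique (v ∷ vs) (false ∷ S) p = let T , q , c , f = nonClique vs S p in false ∷ T , Subsetₚ.s⊆s q , c , f
  nonClique (v ∷ vs) (true ∷ S)  p with inNbr v vs S in eq
  ... | true  = let T , q , c , f = nonClique vs S p in false ∷ T , Subsetₚ.out⊆ q , c , f
  ... | false = let T , q , c , f = nonNbr v vs S eq in
                true ∷ T , Subsetₚ.s⊆s q , cong suc c , cong (_∧ isClique vs T) f

  ⊆⇒≡⊎⊂ : ∀ {n} {T S : Subset n} → T ⊆ S → T ≡ S ⊎ T ⊂ S
  ⊆⇒≡⊎⊂ {T = []}        {[]}        p = inj₁ refl
  ⊆⇒≡⊎⊂ {T = true ∷ T}  {false ∷ S} p with () ← p here
  ⊆⇒≡⊎⊂ {T = false ∷ T} {true ∷ S}  p = inj₂ (Subsetₚ.out⊂in (Subsetₚ.drop-∷-⊆ p))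
  ⊆⇒≡⊎⊂ {T = true ∷ T}  {true ∷ S}  p with ⊆⇒≡⊎⊂ (Subsetₚ.drop-∷-⊆ p)
  ... | inj₁ q = inj₁ (cong (true ∷_) q)
  ... | inj₂ q = inj₂ (Subsetₚ.s⊂s q)
  ⊆⇒≡⊎⊂ {T = false ∷ T} {false ∷ S} p with ⊆⇒≡⊎⊂ (Subsetₚ.drop-∷-⊆ p)
  ... | inj₁ q = inj₁ (cong (false ∷_) q)
  ... | inj₂ q = inj₂ (Subsetₚ.s⊂s q)

  -- Every non-clique contains a non-adjacent pair, and minimality leaves no room for anything else.
  clique-flag : ∀ vs → IsFlag (cliqueComplex vs)
  clique-flag vs S p minimal with nonClique vs S p
  ... | T , T⊆S , c , f with ⊆⇒≡⊎⊂ T⊆S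
  ...   | inj₁ refl = c
  ...   | inj₂ T⊂S with () ← trans (sym f) (minimal T T⊂S)

  inNbr-∈ : ∀ v vs S → inNbr v vs S ≡ true → ∀ j → j ∈ S → r v (List.lookup vs j) ≡ true
  inNbr-∈ v (w ∷ vs) (true ∷ S)  p Fin.zero    here        = ∧-trueˡ {r v w} p
  inNbr-∈ v (w ∷ vs) (true ∷ S)  p (Fin.suc j) (there j∈S) = inNbr-∈ v vs S (∧-trueʳ {r v w} p) j j∈S
  inNbr-∈ v (w ∷ vs) (false ∷ S) p (Fin.suc j) (there j∈S) = inNbr-∈ v vs S p j j∈S

  clique-adjacent : ∀ vs S → isClique vs S ≡ true → ∀ i j → i ∈ S → j ∈ S →
    i ≡ j ⊎ r (List.lookup vs i) (List.lookup vs j) ≡ true ⊎ r (List.lookup vs j) (List.lookup vs i) ≡ true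
  clique-adjacent (v ∷ vs) (true ∷ S)  p Fin.zero    Fin.zero    _ _ = inj₁ refl
  clique-adjacent (v ∷ vs) (true ∷ S)  p Fin.zero    (Fin.suc j) _ (there j∈S) =
    inj₂ (inj₁ (inNbr-∈ v vs S (∧-trueˡ {inNbr v vs S} p) j j∈S))
  clique-adjacent (v ∷ vs) (true ∷ S)  p (Fin.suc i) Fin.zero    (there i∈S) _ =
    inj₂ (inj₂ (inNbr-∈ v vs S (∧-trueˡ {inNbr v vs S} p) i i∈S))
  clique-adjacent (v ∷ vs) (s ∷ S)     p (Fin.suc i) (Fin.suc j) (there i∈S) (there j∈S)
    with clique-adjacent vs S (tail s p) i j i∈S j∈S
    where
    tail : ∀ s → isClique (v ∷ vs) (s ∷ S) ≡ true → isClique vs S ≡ true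
    tail true  p = ∧-trueʳ {inNbr v vs S} p
    tail false p = p
  ... | inj₁ q = inj₁ (cong Fin.suc q)
  ... | inj₂ q = inj₂ q

  -- Σ φ(|S|) over the cliques S ⊆ vs all of whose vertices satisfy P
  cliqueSum : List V → (V → Bool) → (ℕ → ℕ) → ℕ
  cliqueSum []       P φ = φ 0
  cliqueSum (v ∷ vs) P φ =
    (if P v then cliqueSum vs (λ w → r v w ∧ P w) (φ ∘ suc) else 0) + cliqueSum vs P φ

  allIn : (V → Bool) → (vs : List V) → Subset (length vs) → Bool
  allIn P []       []          = true
  allIn P (w ∷ vs) (true ∷ S)  = P w ∧ allIn P vs S
  allIn P (w ∷ vs) (false ∷ S) = allIn P vs S

  allIn-inNbr : ∀ v P vs S → inNbr v vs S ∧ allIn P vs S ≡ allIn (λ w → r v w ∧ P w) vs S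
  allIn-inNbr v P []       []          = refl
  allIn-inNbr v P (w ∷ vs) (false ∷ S) = allIn-inNbr v P vs S
  allIn-inNbr v P (w ∷ vs) (true ∷ S)  = trans (swap (r v w) (inNbr v vs S) (P w) (allIn P vs S))
    (cong ((r v w ∧ P w) ∧_) (allIn-inNbr v P vs S))
    where
    swap : ∀ a b c d → (a ∧ b) ∧ (c ∧ d) ≡ (a ∧ c) ∧ (b ∧ d)
    swap true  true  c     d = refl
    swap true  false true  d = refl
    swap true  false false d = refl
    swap false b     c     d = refl

  -- The adjacency conditions imposed by the vertices chosen so far are accumulated in `P`;
  -- `allIn-inNbr` merges in those of the next one.
  cliqueSum-∑ : ∀ vs P φ →
    ∑ (λ S → if allIn P vs S ∧ isClique vs S then φ ∣ S ∣ else 0) ≡ cliqueSum vs P φ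
  cliqueSum-∑ []       P φ = ℕₚ.+-identityʳ (φ 0)
  cliqueSum-∑ (v ∷ vs) P φ = trans (∑-suc {length vs} _) (cong₂ _+_ chosen (cliqueSum-∑ vs P φ))
    where
    chosen : ∑ (λ S → if (P v ∧ allIn P vs S) ∧ (inNbr v vs S ∧ isClique vs S) then φ (suc ∣ S ∣) else 0)
      ≡ (if P v then cliqueSum vs (λ w → r v w ∧ P w) (φ ∘ suc) else 0)
    chosen with P v
    ... | false = ∑-zero {length vs}
    ... | true  = trans (∑-cong λ S → cong (if_then φ (suc ∣ S ∣) else 0)
                    (trans (sym (Boolₚ.∧-assoc (allIn P vs S) (inNbr v vs S) (isClique vs S)))
                      (cong (_∧ isClique vs S) (trans (Boolₚ.∧-comm (allIn P vs S) (inNbr v vs S))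
                          (allIn-inNbr v P vs S)))))
                  (cliqueSum-∑ vs (λ w → r v w ∧ P w) (φ ∘ suc))

  allIn-true : ∀ vs S → allIn (λ _ → true) vs S ≡ true
  allIn-true []       []          = refl
  allIn-true (v ∷ vs) (true ∷ S)  = allIn-true vs S
  allIn-true (v ∷ vs) (false ∷ S) = allIn-true vs S

  faceSum-cliqueSum : ∀ vs φ → faceSum (cliqueComplex vs) φ ≡ cliqueSum vs (λ _ → true) φ
  faceSum-cliqueSum vs φ = trans
    (∑-cong λ S → cong (λ b → if b ∧ isClique vs S then φ ∣ S ∣ else 0) (sym (allIn-true vs S)))
    (cliqueSum-∑ vs (λ _ → true) φ)

  cliqueSum-cong : ∀ vs {P Q} → (∀ v → P v ≡ Q v) → ∀ φ → cliqueSum vs P φ ≡ cliqueSum vs Q φ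
  cliqueSum-cong []       p φ = refl
  cliqueSum-cong (v ∷ vs) {P} {Q} p φ = cong₂ _+_
    (cong₂ (if_then_else 0) (p v) (cliqueSum-cong vs (λ w → cong (r v w ∧_) (p w)) (φ ∘ suc)))
    (cliqueSum-cong vs p φ)

  cliqueSum-none : ∀ {X : Set} (f : X → V) xs vs P → (∀ x → P (f x) ≡ false) → ∀ φ →
    cliqueSum (List.map f xs ++ vs) P φ ≡ cliqueSum vs P φ
  cliqueSum-none f []       vs P p φ = refl
  cliqueSum-none f (x ∷ xs) vs P p φ rewrite p x = cliqueSum-none f xs vs P p φ

  -- A clique meets a row of pairwise nonadjacent vertices at most once, so the cliques split
  -- according to the vertex taken from the row, if any.
  cliqueSum-row : ∀ {X : Set} (f : X → V) → (∀ x y → r (f x) (f y) ≡ false) → ∀ xs vs P φ →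
    cliqueSum (List.map f xs ++ vs) P φ ≡
    sum (List.map (λ x → if P (f x) then cliqueSum vs (λ w → r (f x) w ∧ P w) (φ ∘ suc) else 0) xs)
      + cliqueSum vs P φ
  cliqueSum-row f q []       vs P φ = refl
  cliqueSum-row f q (x ∷ xs) vs P φ = trans
    (cong₂ _+_ (cong (if P (f x) then_else 0)
        (cliqueSum-none f xs vs (λ w → r (f x) w ∧ P w) (λ y → cong (_∧ P (f y)) (q x y)) (φ ∘ suc)))
      (cliqueSum-row f q xs vs P φ))
    (sym (ℕₚ.+-assoc (if P (f x) then cliqueSum vs (λ w → r (f x) w ∧ P w) (φ ∘ suc) else 0) _ _))

  cliqueSum-map : ∀ (f : V → V) → (∀ v w → r (f v) (f w) ≡ r v w) → ∀ vs P φ →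
    cliqueSum (List.map f vs) P φ ≡ cliqueSum vs (P ∘ f) φ
  cliqueSum-map f q []       P φ = refl
  cliqueSum-map f q (v ∷ vs) P φ = cong₂ _+_
    (cong (if P (f v) then_else 0) (trans (cliqueSum-map f q vs (λ w → r (f v) w ∧ P w) (φ ∘ suc))
      (cliqueSum-cong vs (λ w → cong (_∧ P (f w)) (q v w)) (φ ∘ suc))))
    (cliqueSum-map f q vs P φ)

-- Sign words and the removal of a first letter + or -.

up : ∀ {A : Set} → ℕ → A → (ℕ → A) → A
up zero    x f = x
up (suc i) x f = f i

-- tri a i j counts the words in {0,+,-}^a with i letters + and j letters -.
tri : ℕ → ℕ → ℕ → ℕ
tri zero    zero    zero    = 1
tri zero    zero    (suc _) = 0
tri zero    (suc _) _       = 0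
tri (suc a) i       j       = tri a i j + up i 0 (λ i′ → tri a i′ j) + up j 0 (λ j′ → tri a i j′)

tri-large : ∀ a i j → a < i + j → tri a i j ≡ 0
tri-large zero    zero    (suc j) p = refl
tri-large zero    (suc i) j       p = refl
tri-large (suc a) i       j       p = cong₂ _+_ (cong₂ _+_ (tri-large a i j (ℕₚ.<-trans (ℕₚ.n<1+n a) p))
    (plus i p)) (minus j p)
  where
  plus : ∀ i → suc a < i + j → up i 0 (λ i′ → tri a i′ j) ≡ 0
  plus zero    p = refl
  plus (suc i) p = tri-large a i j (ℕₚ.≤-pred p)
  minus : ∀ j → suc a < i + j → up j 0 (λ j′ → tri a i j′) ≡ 0
  minus zero    p = refl
  minus (suc j) p = tri-large a i j (ℕₚ.≤-pred (subst (suc a <_) (ℕₚ.+-suc i j) p))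

tri-positive : ∀ a i → i ≤ a → tri a i 0 ≢ 0
tri-positive zero    zero    p ()
tri-positive (suc a) zero    p q = tri-positive a 0 z≤n (ℕₚ.m+n≡0⇒m≡0 _ (ℕₚ.m+n≡0⇒m≡0 _ q))
tri-positive (suc a) (suc i) p q =
  tri-positive a i (ℕₚ.≤-pred p) (ℕₚ.m+n≡0⇒n≡0 (tri a (suc i) 0) (ℕₚ.m+n≡0⇒m≡0 _ q))

-- wordSum n Y ψ sums ψ(#₊ w, #₋ w) over the words w ∈ {0,+,-}^n whose nonzero
-- letters s = w_q satisfy Y q s; the sign + is encoded by true.
wordSum : ∀ n → (Fin n → Bool → Bool) → (ℕ → ℕ → ℕ) → ℕ
wordSum zero    Y ψ = ψ 0 0
wordSum (suc n) Y ψ = wordSum n (Y ∘ Fin.suc) ψ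
  + (if Y Fin.zero true  then wordSum n (Y ∘ Fin.suc) (λ i j → ψ (suc i) j) else 0)
  + (if Y Fin.zero false then wordSum n (Y ∘ Fin.suc) (λ i j → ψ i (suc j)) else 0)

wordSum-cong : ∀ n {Y Y′ ψ ψ′} → (∀ q s → Y q s ≡ Y′ q s) → (∀ i j → ψ i j ≡ ψ′ i j) →
  wordSum n Y ψ ≡ wordSum n Y′ ψ′
wordSum-cong zero    p q = q 0 0
wordSum-cong (suc n) p q = cong₂ _+_ (cong₂ _+_
  (wordSum-cong n (p ∘ Fin.suc) q)
  (cong₂ (if_then_else 0) (p Fin.zero true) (wordSum-cong n (p ∘ Fin.suc) (λ i j → q (suc i) j))))
  (cong₂ (if_then_else 0) (p Fin.zero false) (wordSum-cong n (p ∘ Fin.suc) (λ i j → q i (suc j))))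

when-+ : ∀ b (x y : ℕ) → (if b then x + y else 0) ≡ (if b then x else 0) + (if b then y else 0)
when-+ true  x y = refl
when-+ false x y = refl

when-swap : ∀ b c (x : ℕ) → (if b then (if c then x else 0) else 0) ≡ (if c then (if b then x else 0) else 0)
when-swap true  c     x = refl
when-swap false true  x = refl
when-swap false false x = refl

swap₄ : ∀ a b c d → a + b + (c + d) ≡ a + c + (b + d)
swap₄ = ℕSolver.solve-∀

wordSum-+ : ∀ n Y ψ χ → wordSum n Y (λ i j → ψ i j + χ i j) ≡ wordSum n Y ψ + wordSum n Y χ
wordSum-+ zero    Y ψ χ = refl
wordSum-+ (suc n) Y ψ χ = trans
  (cong₂ _+_ (cong₂ _+_ (wordSum-+ n (Y ∘ Fin.suc) ψ χ)
    (trans (cong (if Y Fin.zero true then_else 0) (wordSum-+ n (Y ∘ Fin.suc) _ _)) (when-+ (Y Fin.zero true) _ _)))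
    (trans (cong (if Y Fin.zero false then_else 0) (wordSum-+ n (Y ∘ Fin.suc) _ _)) (when-+ (Y Fin.zero false) _ _)))
  (rearrange (wordSum n (Y ∘ Fin.suc) ψ) (wordSum n (Y ∘ Fin.suc) χ) _ _ _ _)
  where
  rearrange : ∀ a b c d e f → a + b + (c + d) + (e + f) ≡ a + c + e + (b + d + f)
  rearrange = ℕSolver.solve-∀

wordSum-zero : ∀ n Y → wordSum n Y (λ _ _ → 0) ≡ 0
wordSum-zero zero    Y = refl
wordSum-zero (suc n) Y rewrite wordSum-zero n (Y ∘ Fin.suc) with Y Fin.zero true | Y Fin.zero false
... | true  | true  = refl
... | true  | false = refl
... | false | true  = refl
... | false | false = refl

-- From one row to a later one, columns of the same sign must increase, whereas columns of opposite
-- signs must only differ.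
compatible : ℕ → Bool → ℕ → Bool → Bool
compatible q s q′ s′ = (q <ᵇ q′) ∨ ((s xor s′) ∧ (q′ <ᵇ q))

restrict : ∀ {n} → Fin n → Bool → (Fin n → Bool → Bool) → Fin n → Bool → Bool
restrict q s Y q′ s′ = compatible (Fin.toℕ q) s (Fin.toℕ q′) s′ ∧ Y q′ s′

sumℕ-cong : ∀ {k} {f g : Fin k → ℕ} → (∀ i → f i ≡ g i) → sumℕ f ≡ sumℕ g
sumℕ-cong {zero}  p = refl
sumℕ-cong {suc k} p = cong₂ _+_ (p Fin.zero) (sumℕ-cong (p ∘ Fin.suc))

sumℕ-+ : ∀ {k} (f g : Fin k → ℕ) → sumℕ (λ i → f i + g i) ≡ sumℕ f + sumℕ g
sumℕ-+ {zero}  f g = refl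
sumℕ-+ {suc k} f g = trans (cong (_+_ (f Fin.zero + g Fin.zero)) (sumℕ-+ (f ∘ Fin.suc) (g ∘ Fin.suc)))
  (swap₄ (f Fin.zero) (g Fin.zero) _ _)

sumℕ-when : ∀ {k} b (f : Fin k → ℕ) → sumℕ (λ i → if b then f i else 0) ≡ (if b then sumℕ f else 0)
sumℕ-when         true  f = refl
sumℕ-when {zero}  false f = refl
sumℕ-when {suc k} false f = sumℕ-when false (f ∘ Fin.suc)

-- q is the column of a newly matched cell of sign s, and the word describes columns that later
-- cells may still occupy.
restrictedSum : ∀ n → Bool → (Fin n → Bool → Bool) → (ℕ → ℕ → ℕ) → ℕ
restrictedSum n s Y ψ = sumℕ (λ q → if Y q s then wordSum n (restrict q s Y) ψ else 0)

-- The letter + at q is the first + of the word.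
firstPlus : ∀ n Y ψ → restrictedSum n true Y ψ ≡ wordSum n Y (λ i j → up i 0 (λ i′ → ψ i′ j))
firstPlus zero    Y ψ = refl
firstPlus (suc n) Y ψ = trans
  (cong₂ _+_ (cong (if Y Fin.zero true then_else 0) (trans (ℕₚ.+-identityʳ _) (ℕₚ.+-identityʳ _)))
    (trans (sumℕ-cong λ q → trans (when-+ (Y (Fin.suc q) true) _ _)
        (cong₂ _+_ (cong (if Y (Fin.suc q) true then_else 0) (ℕₚ.+-identityʳ _))
            (when-swap (Y (Fin.suc q) true) (Y Fin.zero false) _)))
    (trans (sumℕ-+ (λ q → if Y (Fin.suc q) true then wordSum n (restrict q true (Y ∘ Fin.suc)) ψ else 0) _)
      (cong₂ _+_ (firstPlus n (Y ∘ Fin.suc) ψ)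
        (trans (sumℕ-when (Y Fin.zero false) (λ q → if Y (Fin.suc q) true then wordSum n
            (restrict q true (Y ∘ Fin.suc)) (λ i j → ψ i (suc j)) else 0))
          (cong (if Y Fin.zero false then_else 0) (firstPlus n (Y ∘ Fin.suc) (λ i j → ψ i (suc j)))))))))
  (rearrange (if Y Fin.zero true then wordSum n (Y ∘ Fin.suc) ψ else 0)
    (wordSum n (Y ∘ Fin.suc) (λ i j → up i 0 (λ i′ → ψ i′ j)))
    (if Y Fin.zero false then wordSum n (Y ∘ Fin.suc) (λ i j → up i 0 (λ i′ → ψ i′ (suc j))) else 0))
  where
  rearrange : ∀ a b c → a + (b + c) ≡ b + a + c
  rearrange = ℕSolver.solve-∀

-- Mirror image of `firstPlus`: adding the letter - at q makes it the first - of the word, since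
-- further - stand only to its right while + may stand on both sides.
firstMinus : ∀ n Y ψ → restrictedSum n false Y ψ ≡ wordSum n Y (λ i j → up j 0 (λ j′ → ψ i j′))
firstMinus zero    Y ψ = refl
firstMinus (suc n) Y ψ = trans
  (cong₂ _+_ (cong (if Y Fin.zero false then_else 0) (trans (ℕₚ.+-identityʳ _) (ℕₚ.+-identityʳ _)))
    (trans (sumℕ-cong λ q → trans (cong (if Y (Fin.suc q) false then_else 0) (ℕₚ.+-identityʳ _))
        (trans (when-+ (Y (Fin.suc q) false) _ _)
        (cong₂ _+_ refl (when-swap (Y (Fin.suc q) false) (Y Fin.zero true) _))))
    (trans (sumℕ-+ (λ q → if Y (Fin.suc q) false then wordSum n (restrict q false (Y ∘ Fin.suc)) ψ else 0) _)
      (cong₂ _+_ (firstMinus n (Y ∘ Fin.suc) ψ)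
        (trans (sumℕ-when (Y Fin.zero true) (λ q → if Y (Fin.suc q) false then wordSum n
            (restrict q false (Y ∘ Fin.suc)) (λ i j → ψ (suc i) j) else 0))
          (cong (if Y Fin.zero true then_else 0) (firstMinus n (Y ∘ Fin.suc) (λ i j → ψ (suc i) j))))))))
  (ℕₚ.+-comm (if Y Fin.zero false then wordSum n (Y ∘ Fin.suc) ψ else 0) _)

-- The faces of Γ are the signed partial matchings between b rows and a columns whose
-- + part and - part are both increasing; C(2k , k) C(a , k) C(b , k) of them have size k.

module Matchings (a : ℕ) where

  Vertex : Set
  Vertex = ℕ × (Fin a × Bool)

  adjacent : Vertex → Vertex → Bool
  adjacent (p , q , s) (p′ , q′ , s′) = (p <ᵇ p′) ∧ compatible (Fin.toℕ q) s (Fin.toℕ q′) s′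

  open Clique adjacent

  columns : List (Fin a × Bool)
  columns = List.map (_, true) (allFin a) ++ List.map (_, false) (allFin a)

  lower : Vertex → Vertex
  lower (p , c) = suc p , c

  grid : ℕ → List Vertex
  grid zero    = []
  grid (suc b) = List.map (0 ,_) columns ++ List.map lower (grid b)

  grid-bounded : ∀ b → All (λ v → proj₁ v < b) (grid b)
  grid-bounded zero    = All.[]
  grid-bounded (suc b) = Allₚ.++⁺ (Allₚ.map⁺ (All.universal (λ _ → s≤s z≤n) columns))
    (Allₚ.map⁺ (All.map s≤s (grid-bounded b)))

  sum-tabulate : ∀ {k} {X : Set} (h : X → ℕ) (f : Fin k → X) → sum (List.map h (List.tabulate f)) ≡ sumℕ (h ∘ f)
  sum-tabulate {zero}  h f = refl
  sum-tabulate {suc k} h f = cong (_+_ (h (f Fin.zero))) (sum-tabulate h (f ∘ Fin.suc))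

  sum-columns : ∀ (h : Fin a × Bool → ℕ) →
    sum (List.map h columns) ≡ sumℕ (λ q → h (q , true)) + sumℕ (λ q → h (q , false))
  sum-columns h = trans (cong sum (Listₚ.map-++ h (List.map (_, true) (allFin a)) _))
    (trans (Sumₚ.sum-++ (List.map h (List.map (_, true) (allFin a))) _)
    (cong₂ _+_ (part true) (part false)))
    where
    part : ∀ s → sum (List.map h (List.map (_, s) (allFin a))) ≡ sumℕ (λ q → h (q , s))
    part s = trans (cong sum (sym (Listₚ.map-∘ (allFin a)))) (sum-tabulate (λ q → h (q , s)) id)

  -- `tri b` counts the row words and `wordSum a` runs over the column words. If the top row holds a
  -- cell of sign s, this cell is matched with the first letter s of the column word, because the
  -- part of sign s is increasing; `firstPlus` and `firstMinus` remove that letter. The three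
  -- options for the top row are the three summands of `tri`.
  cliqueSum-grid : ∀ b Y φ →
    cliqueSum (grid b) (λ { (_ , q , s) → Y q s }) φ ≡ wordSum a Y (λ i j → tri b i j * φ (i + j))
  -- Without rows only the empty clique exists, and on the other side `tri 0` kills every column
  -- word with a nonzero letter.
  cliqueSum-grid zero Y φ = sym (trans (empty a Y (λ i j → tri 0 i j * φ (i + j))
      (λ { zero j → refl ; (suc i) j → refl }) (λ _ _ → refl))
                                  (ℕₚ.+-identityʳ (φ 0)))
    where
    none : ∀ n Y ψ → (∀ i j → ψ i j ≡ 0) → wordSum n Y ψ ≡ 0
    none n Y ψ p = trans (wordSum-cong n (λ _ _ → refl) p) (wordSum-zero n Y)
    when-zero : ∀ b {x} → x ≡ 0 → (if b then x else 0) ≡ 0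
    when-zero true  p = p
    when-zero false p = refl
    empty : ∀ n Y ψ → (∀ i j → ψ i (suc j) ≡ 0) → (∀ i j → ψ (suc i) j ≡ 0) → wordSum n Y ψ ≡ ψ 0 0
    empty zero    Y ψ p q = refl
    empty (suc n) Y ψ p q = trans (cong₂ _+_ (cong₂ _+_ (empty n (Y ∘ Fin.suc) ψ p q)
      (when-zero (Y Fin.zero true) (none n _ _ q))) (when-zero (Y Fin.zero false) (none n _ _ p)))
      (trans (ℕₚ.+-identityʳ _) (ℕₚ.+-identityʳ _))
  cliqueSum-grid (suc b) Y φ = trans (cliqueSum-row (0 ,_) (λ _ _ → refl) columns (List.map lower (grid b)) P φ)
    (trans (cong₂ _+_
      (trans (sum-columns _) (cong₂ _+_ (trans (pick true) (firstPlus a Y ψ)) (trans (pick false) (firstMinus a Y ψ))))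
      (trans (cliqueSum-map lower (λ _ _ → refl) (grid b) P φ) (cliqueSum-grid b Y φ)))
    (trans (ℕₚ.+-comm _ (wordSum a Y (λ i j → tri b i j * φ (i + j))))
    (trans (sym (trans (wordSum-+ a Y (λ i j → tri b i j * φ (i + j)) _)
      (cong (_+_ (wordSum a Y (λ i j → tri b i j * φ (i + j)))) (wordSum-+ a Y _ _))))
    (wordSum-cong a {Y} (λ _ _ → refl) pascal))))
    where
    P : Vertex → Bool
    P (_ , q , s) = Y q s
    ψ : ℕ → ℕ → ℕ
    ψ i j = tri b i j * φ (suc (i + j))
    pick : ∀ s → sumℕ (λ q → if Y q s then cliqueSum (List.map lower (grid b))
        (λ w → adjacent (0 , q , s) w ∧ P w) (φ ∘ suc) else 0)
             ≡ restrictedSum a s Y ψ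
    pick s = sumℕ-cong λ q → cong (if Y q s then_else 0)
      (trans (cliqueSum-map lower (λ _ _ → refl) (grid b) _ (φ ∘ suc)) (cliqueSum-grid b (restrict q s Y) (φ ∘ suc)))
    pascal : ∀ i j → tri b i j * φ (i + j) + (up i 0 (λ i′ → ψ i′ j) + up j 0 (λ j′ → ψ i j′)) ≡ tri
        (suc b) i j * φ (i + j)
    pascal i j = trans (cong (_+_ (tri b i j * φ (i + j))) (cong₂ _+_ (plus i) (minus j)))
      (distrib (tri b i j) (up i 0 (λ i′ → tri b i′ j)) (up j 0 (λ j′ → tri b i j′)) (φ (i + j)))
      where
      plus : ∀ i → up i 0 (λ i′ → ψ i′ j) ≡ up i 0 (λ i′ → tri b i′ j) * φ (i + j)
      plus zero    = refl
      plus (suc i) = refl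
      minus : ∀ j → up j 0 (λ j′ → ψ i j′) ≡ up j 0 (λ j′ → tri b i j′) * φ (i + j)
      minus zero    = refl
      minus (suc j) = cong (λ m → tri b i j * φ m) (sym (ℕₚ.+-suc i j))
      distrib : ∀ x y z w → x * w + (y * w + z * w) ≡ (x + y + z) * w
      distrib = ℕSolver.solve-∀

  Γ : ∀ b → Complex (length (grid b))
  Γ b = cliqueComplex (grid b)

  Γ-flag : ∀ b → IsFlag (Γ b)
  Γ-flag b = clique-flag (grid b)

  Γ-count : ∀ b k → faceCount (Γ b) k ≡ wordSum a (λ _ _ → true) (λ i j → tri b i j * indicator k (i + j))
  Γ-count b k = trans (faceCount-faceSum (Γ b) k)
    (trans (faceSum-cliqueSum (grid b) (indicator k)) (cliqueSum-grid b (λ _ _ → true) (indicator k)))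

  wordSum-bounded : ∀ n {ψ χ} → (∀ i j → i + j ≤ n → ψ i j ≡ χ i j) →
    wordSum n (λ _ _ → true) ψ ≡ wordSum n (λ _ _ → true) χ
  wordSum-bounded zero    p = p 0 0 z≤n
  wordSum-bounded (suc n) p = cong₂ _+_ (cong₂ _+_
    (wordSum-bounded n (λ i j l → p i j (ℕₚ.m≤n⇒m≤1+n l)))
    (wordSum-bounded n (λ i j l → p (suc i) j (s≤s l))))
    (wordSum-bounded n (λ i j l → p i (suc j) (subst (_≤ suc n) (sym (ℕₚ.+-suc i j)) (s≤s l))))

  Γ-count-large : ∀ b k → a < k ⊎ b < k → faceCount (Γ b) k ≡ 0
  Γ-count-large b k large = trans (Γ-count b k)
    (trans (wordSum-bounded a (λ i j l → vanish i j l large)) (wordSum-zero a _))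
    where
    vanish : ∀ i j → i + j ≤ a → a < k ⊎ b < k → tri b i j * indicator k (i + j) ≡ 0
    vanish i j l large with i + j ℕ.≟ k
    ... | no ≢k = trans (cong (λ t → tri b i j * (if t then 1 else 0)) (≡ᵇ-false (i + j) k ≢k)) (ℕₚ.*-zeroʳ (tri b i j))
    vanish i j l (inj₁ a<k) | yes ≡k = ⊥-elim (ℕₚ.<⇒≱ a<k (subst (_≤ a) ≡k l))
    vanish i j l (inj₂ b<k) | yes ≡k = cong (_* indicator k (i + j)) (tri-large b i j (subst (b <_) (sym ≡k) b<k))

  -- Words with k letters + and no - exist for the rows and for the columns; they describe
  -- increasing matchings with k positive cells.
  Γ-count-positive : ∀ b k → k ≤ a → k ≤ b → faceCount (Γ b) k ≢ 0
  Γ-count-positive b k k≤a k≤b q = leading a k k≤a (λ i j → tri b i j * indicator k (i + j))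
      (λ r → tri-positive b k k≤b (trans (sym (ℕₚ.*-identityʳ _))
        (trans (cong (λ t → tri b k 0 * (if t then 1 else 0))
            (sym (trans (cong (_≡ᵇ k) (ℕₚ.+-identityʳ k)) (≡ᵇ-true k)))) r)))
      (trans (sym (Γ-count b k)) q)
    where
    leading : ∀ n k → k ≤ n → ∀ ψ → ψ k 0 ≢ 0 → wordSum n (λ _ _ → true) ψ ≢ 0
    leading zero    zero    l ψ p q = p q
    leading (suc n) zero    l ψ p q = leading n 0 z≤n ψ p (ℕₚ.m+n≡0⇒m≡0 _ (ℕₚ.m+n≡0⇒m≡0 _ q))
    leading (suc n) (suc k) l ψ p q = leading n k (ℕₚ.≤-pred l) (λ i j → ψ (suc i) j) p
      (ℕₚ.m+n≡0⇒n≡0 (wordSum n (λ _ _ → true) ψ) (ℕₚ.m+n≡0⇒m≡0 _ q))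

  faceCount-∈ : ∀ {m} (Δ : Complex m) S → Face Δ S → faceCount Δ ∣ S ∣ ≢ 0
  faceCount-∈ Δ S p q = ℕₚ.<⇒≢ (ℕₚ.≤-trans (ℕₚ.≤-reflexive (sym one)) (≤-∑ term S)) (sym q)
    where
    term : Subset _ → ℕ
    term T = if isFace Δ T ∧ does (∣ T ∣ ℕ.≟ ∣ S ∣) then 1 else 0
    one : term S ≡ 1
    one = cong₂ (λ b c → if b ∧ c then 1 else 0) p (≡ᵇ-true ∣ S ∣)

  faceCount-∃ : ∀ {m} (Δ : Complex m) k → faceCount Δ k ≢ 0 → Σ (Subset m) λ S → Face Δ S × ∣ S ∣ ≡ k
  faceCount-∃ Δ k p with ∑-positive (λ S → if isFace Δ S ∧ does (∣ S ∣ ℕ.≟ k) then 1 else 0) p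
  ... | S , q with isFace Δ S in isF | ∣ S ∣ ℕ.≟ k
  ...   | true  | yes r = S , isF , r
  ...   | true  | no r  = ⊥-elim (q (cong (if_then 1 else 0) (≡ᵇ-false ∣ S ∣ k r)))
  ...   | false | _     = ⊥-elim (q refl)

  -- Read off from the face numbers: a face of size k makes the count at k nonzero, which fails as
  -- soon as k exceeds a or b.
  face-size : ∀ b S → Face (Γ b) S → ∣ S ∣ ≤ a × ∣ S ∣ ≤ b
  face-size b S p with ∣ S ∣ ℕ.≤? a | ∣ S ∣ ℕ.≤? b
  ... | yes l | yes l′ = l , l′
  ... | no l  | _      = ⊥-elim (faceCount-∈ (Γ b) S p (Γ-count-large b ∣ S ∣ (inj₁ (ℕₚ.≰⇒> l))))
  ... | yes _ | no l   = ⊥-elim (faceCount-∈ (Γ b) S p (Γ-count-large b ∣ S ∣ (inj₂ (ℕₚ.≰⇒> l))))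

  <ᵇ-irrefl : ∀ n → (n <ᵇ n) ≡ false
  <ᵇ-irrefl zero    = refl
  <ᵇ-irrefl (suc n) = <ᵇ-irrefl n

  compatible-irrefl : ∀ q s s′ → compatible q s q s′ ≡ false
  compatible-irrefl q s s′ = trans (cong (λ b → b ∨ ((s xor s′) ∧ b)) (<ᵇ-irrefl q)) (Boolₚ.∧-zeroʳ (s xor s′))

  adjacent-row : ∀ v w → proj₁ v ≡ proj₁ w → adjacent v w ≡ false
  adjacent-row (p , q , s) (.p , q′ , s′) refl = cong (_∧ compatible (Fin.toℕ q) s (Fin.toℕ q′) s′) (<ᵇ-irrefl p)

  adjacent-column : ∀ v w → proj₁ (proj₂ v) ≡ proj₁ (proj₂ w) → adjacent v w ≡ false
  adjacent-column (p , q , s) (p′ , .q , s′) refl =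
    trans (cong ((p <ᵇ p′) ∧_) (compatible-irrefl (Fin.toℕ q) s s′)) (Boolₚ.∧-zeroʳ (p <ᵇ p′))

  colouring : ∀ b {C : Set} (κ : Fin (length (grid b)) → C) →
    (∀ i j → κ i ≡ κ j → adjacent (List.lookup (grid b) i) (List.lookup (grid b) j) ≡ false) →
    ∀ S → Face (Γ b) S → ∀ i j → i ∈ S → j ∈ S → κ i ≡ κ j → i ≡ j
  colouring b κ proper S p i j i∈S j∈S eq with clique-adjacent (grid b) S p i j i∈S j∈S
  ... | inj₁ i≡j = i≡j
  ... | inj₂ (inj₁ r) with () ← trans (sym r) (proper i j eq)
  ... | inj₂ (inj₂ r) with () ← trans (sym r) (proper j i (sym eq))

  -- There must be exactly as many colours as the largest face has vertices. That size is min(a ,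
  -- b), which forces the choice between rows and columns.
  Γ-balanced : ∀ b → IsBalanced (Γ b)
  Γ-balanced b with a ℕ.≤? b
  ... | yes a≤b = a , faceCount-∃ (Γ b) a (Γ-count-positive b a ℕₚ.≤-refl a≤b)
                , (λ S p → proj₁ (face-size b S p))
                , column , colouring b column (λ i j → adjacent-column (List.lookup (grid b) i)
                    (List.lookup (grid b) j))
    where
    column : Fin (length (grid b)) → Fin a
    column i = proj₁ (proj₂ (List.lookup (grid b) i))
  ... | no a≰b = b , faceCount-∃ (Γ b) b (Γ-count-positive b b (ℕₚ.<⇒≤ (ℕₚ.≰⇒> a≰b)) ℕₚ.≤-refl)
                , (λ S p → proj₂ (face-size b S p))
                , row , colouring b row (λ i j eq → adjacent-row (List.lookup (grid b) i) (List.lookup (grid b) j)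
                    (trans (sym (Finₚ.toℕ-fromℕ< (bound i))) (trans (cong Fin.toℕ eq) (Finₚ.toℕ-fromℕ< (bound j)))))
    where
    bound : ∀ i → proj₁ (List.lookup (grid b) i) < b
    bound i = All.lookup (grid-bounded b) (∈-lookup i)
    row : Fin (length (grid b)) → Fin b
    row i = Fin.fromℕ< (bound i)

-- The numerator series and the face numbers of `Γ`.

sumℤ-+ : ∀ {k} (f g : Fin k → ℤ) → sumℤ (λ i → f i +ᶻ g i) ≡ sumℤ f +ᶻ sumℤ g
sumℤ-+ {zero}  f g = refl
sumℤ-+ {suc k} f g = trans (cong (f Fin.zero +ᶻ g Fin.zero +ᶻ_) (sumℤ-+ (f ∘ Fin.suc) (g ∘ Fin.suc)))
  (interchange (f Fin.zero) (g Fin.zero) _ _)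

sumℤ-Ωᶻ : ∀ {k} a (g : Fin k → ℕ → ℕ → ℤ) → sumℤ (λ k → Ωᶻ a (g k)) ≡ Ωᶻ a (λ i j → sumℤ (λ k → g k i j))
sumℤ-Ωᶻ zero    g = refl
sumℤ-Ωᶻ (suc a) g = trans (sumℤ-+ (λ k → Ωᶻ a (g k) +ᶻ Ωᶻ a (λ i j → g k (suc i) j)) _)
  (cong₂ _+ᶻ_ (trans (sumℤ-+ (λ k → Ωᶻ a (g k)) _) (cong₂ _+ᶻ_ (sumℤ-Ωᶻ a g) (sumℤ-Ωᶻ a (λ k i j → g k (suc i) j))))
    (sumℤ-Ωᶻ a (λ k i j → g k i (suc j))))

Ωᶻ-bounded : ∀ a {g h} → (∀ i j → i + j ≤ a → g i j ≡ h i j) → Ωᶻ a g ≡ Ωᶻ a h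
Ωᶻ-bounded zero    p = p 0 0 z≤n
Ωᶻ-bounded (suc a) p = cong₂ _+ᶻ_ (cong₂ _+ᶻ_
  (Ωᶻ-bounded a (λ i j l → p i j (ℕₚ.m≤n⇒m≤1+n l)))
  (Ωᶻ-bounded a (λ i j l → p (suc i) j (s≤s l))))
  (Ωᶻ-bounded a (λ i j l → p i (suc j) (subst (_≤ suc a) (sym (ℕₚ.+-suc i j)) (s≤s l))))

Ωᶻ-zero : ∀ a → Ωᶻ a (λ _ _ → + 0) ≡ + 0
Ωᶻ-zero zero = refl
Ωᶻ-zero (suc a) rewrite Ωᶻ-zero a = refl

Ωᶻ-wordSum : ∀ a ψ → Ωᶻ a (λ i j → + ψ i j) ≡ + wordSum a (λ _ _ → true) ψ
Ωᶻ-wordSum zero    ψ = refl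
Ωᶻ-wordSum (suc a) ψ = cong₂ _+ᶻ_ (cong₂ _+ᶻ_ (Ωᶻ-wordSum a ψ) (Ωᶻ-wordSum a _)) (Ωᶻ-wordSum a _)

Ω-Ωᶻ : ∀ a g n → Ω 1+shift a g n ≡ Ωᶻ a (λ i j → iter 1+shift (a ∸ (i + j)) (g i j) n)
Ω-Ωᶻ zero    g n = refl
Ω-Ωᶻ (suc a) g n = cong₂ _+ᶻ_ (cong₂ _+ᶻ_
  (trans (resp 1+shift-linear (Ω-Ωᶻ a g) n)
  (trans (Ωᶻ-map 1+shift-linear a (λ i j → iter 1+shift (a ∸ (i + j)) (g i j)) n)
         (Ωᶻ-bounded a (λ i j l → cong (λ k → iter 1+shift k (g i j) n) (sym (ℕₚ.+-∸-assoc 1 l))))))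
  (Ω-Ωᶻ a (λ i j → g (suc i) j) n))
  (trans (Ω-Ωᶻ a (λ i j → g i (suc j)) n)
         (Ωᶻ-cong a λ i j → cong (λ k → iter 1+shift (suc a ∸ k) (g i (suc j)) n) (sym (ℕₚ.+-suc i j))))

kronecker : ℕ → ℕ → ℤ
kronecker zero    zero     = + 1
kronecker zero    (suc i′) = + 0
kronecker (suc i) zero     = + 0
kronecker (suc i) (suc i′) = kronecker i i′

-- The exponent may be taken to be i′ alone, since the factor vanishes unless i = i′.
T̃-kronecker : ∀ i i′ → T̃ i i′ ≗ (kronecker i i′ ⊙ iter shift i′ δ)
T̃-kronecker zero    zero     n = sym (ℤₚ.*-identityˡ (δ n))
T̃-kronecker zero    (suc i′) n = sym (ℤₚ.*-zeroˡ (iter shift (suc i′) δ n))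
T̃-kronecker (suc i) zero     n = sym (ℤₚ.*-zeroˡ (δ n))
T̃-kronecker (suc i) (suc i′) n = trans (resp shift-linear (T̃-kronecker i i′) n)
  (scale shift-linear (kronecker i i′) (iter shift i′ δ) n)

diag-zero : ∀ {F} → (∀ u v → F u v ≡ + 0) → diag F ≗ 𝟘
diag-zero p zero    = p 0 0
diag-zero p (suc n) = cong₂ _+ᶻ_ (p 0 (suc n)) (diag-zero (p ∘ suc) n)

conv-δ : conv δ δ ≗ δ
conv-δ zero    = refl
conv-δ (suc n) = trans (ℤₚ.+-identityˡ _) (diag-zero (λ u v → ℤₚ.*-zeroˡ (δ v)) n)

conv-T̃ : ∀ i j i′ j′ → conv (T̃ i i′) (T̃ j j′) ≗
  ((kronecker i i′ *ᶻ kronecker j j′) ⊙ iter shift (i′ + j′) δ)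
conv-T̃ i j i′ j′ n = trans (conv-cong (T̃-kronecker i i′) (T̃-kronecker j j′) n)
  (trans (scale (conv-linear (kronecker j j′ ⊙ x′)) (kronecker i i′) x n)
  (trans (cong (kronecker i i′ *ᶻ_) (trans (scale (conv-linearʳ x) (kronecker j j′) x′ n)
     (cong (kronecker j j′ *ᶻ_) (trans (iter-commutes shift-linear (conv-shift x′) i′ δ n)
       (trans (resp (iter-linear shift-linear i′) (iter-commutes shift-linear
           (commutesʳ shift-linear conv-shift δ) j′ δ) n)
       (trans (resp (∘-linear (iter-linear shift-linear i′) (iter-linear shift-linear j′)) conv-δ n)
         (cong (λ F → F n) (sym (iter-+ shift i′ j′ δ)))))))))
  (sym (ℤₚ.*-assoc (kronecker i i′) (kronecker j j′) _))))
  where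
  x x′ : Seq
  x  = iter shift i′ δ
  x′ = iter shift j′ δ

-- The Kronecker factors select the words with i letters + and j letters -, and `tri` is the number
-- of these.
Ωᶻ-kronecker : ∀ b i j (f : ℕ → ℕ → ℤ) →
  Ωᶻ b (λ i′ j′ → kronecker i i′ *ᶻ kronecker j j′ *ᶻ f i′ j′) ≡ + tri b i j *ᶻ f i j
Ωᶻ-kronecker zero    zero    zero    f = refl
Ωᶻ-kronecker zero    zero    (suc j) f = trans (ℤₚ.*-zeroˡ (f 0 0)) (sym (ℤₚ.*-zeroˡ (f 0 (suc j))))
Ωᶻ-kronecker zero    (suc i) j       f = trans (cong (_*ᶻ f 0 0) (ℤₚ.*-zeroˡ (kronecker j 0)))
  (trans (ℤₚ.*-zeroˡ (f 0 0)) (sym (ℤₚ.*-zeroˡ (f (suc i) j))))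
Ωᶻ-kronecker (suc b) i       j       f = trans
  (cong₂ _+ᶻ_ (cong₂ _+ᶻ_ (Ωᶻ-kronecker b i j f) (plus i)) (minus j))
  (distrib (+ tri b i j) (+ up i 0 (λ i′ → tri b i′ j)) (+ up j 0 (λ j′ → tri b i j′)) (f i j))
  where
  vanish : ∀ (g f : ℕ → ℕ → ℤ) → (∀ k l → g k l ≡ + 0) → Ωᶻ b (λ k l → g k l *ᶻ f k l) ≡ + 0
  vanish g f p = trans (Ωᶻ-cong b (λ k l → trans (cong (_*ᶻ f k l) (p k l)) (ℤₚ.*-zeroˡ (f k l)))) (Ωᶻ-zero b)
  plus : ∀ i → Ωᶻ b (λ i′ j′ → kronecker i (suc i′) *ᶻ kronecker j j′ *ᶻ f (suc i′) j′)
    ≡ + up i 0 (λ i′ → tri b i′ j) *ᶻ f i j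
  plus zero    = trans (vanish _ (λ i′ j′ → f (suc i′) j′) (λ k l → ℤₚ.*-zeroˡ (kronecker j l)))
      (sym (ℤₚ.*-zeroˡ (f 0 j)))
  plus (suc i) = Ωᶻ-kronecker b i j (f ∘ suc)
  minus : ∀ j → Ωᶻ b (λ i′ j′ → kronecker i i′ *ᶻ kronecker j (suc j′) *ᶻ f i′ (suc j′))
    ≡ + up j 0 (λ j′ → tri b i j′) *ᶻ f i j
  minus zero    = trans (vanish _ (λ i′ j′ → f i′ (suc j′)) (λ k l → ℤₚ.*-zeroʳ (kronecker i k)))
      (sym (ℤₚ.*-zeroˡ (f i 0)))
  minus (suc j) = Ωᶻ-kronecker b i j (λ i′ j′ → f i′ (suc j′))
  distrib : ∀ x y z w → x *ᶻ w +ᶻ y *ᶻ w +ᶻ z *ᶻ w ≡ (x +ᶻ y +ᶻ z) *ᶻ w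
  distrib = solve-∀

shift-1+shift : Commutes shift 1+shift
shift-1+shift f n = add shift-linear f (shift f) n

module _ (a b : ℕ) where

  open Matchings a using (Γ; Γ-count)

  d : ℕ
  d = suc (a + b)

  γ-of : Fin (suc ⌊ d /2⌋) → ℤ
  γ-of k = + faceCount (Γ b) (Fin.toℕ k)

  Φ : ℕ → Seq
  Φ k = iter shift k (iter 1+shift (d ∸ (k + k)) δ)

  -- By orthogonality the inner sum is a multiple of s^m (1+s)^(b-m) with m = i + j; the zero
  -- letters of the outer word supply a - m more factors 1+s, and one stands in front.
  G-tri : ∀ n → 1+shift (G a b) n ≡ Ωᶻ a (λ i j → + tri b i j *ᶻ Φ (i + j) n)
  G-tri n = trans (Ω-map 1+shift-linear 1+shift-linear (λ _ _ → refl) a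
      (λ i j → Ω 1+shift b (λ i′ j′ → conv (T̃ i i′) (T̃ j j′))) n)
    (trans (Ω-cong 1+shift-linear a (λ i j → resp 1+shift-linear (inner i j)) n)
    (trans (Ω-Ωᶻ a (λ i j → 1+shift (+ tri b i j ⊙ Ψ (i + j))) n)
    (Ωᶻ-bounded a combine)))
    where
    Ψ : ℕ → Seq
    Ψ m = iter 1+shift (b ∸ m) (iter shift m δ)
    inner : ∀ i j → Ω 1+shift b (λ i′ j′ → conv (T̃ i i′) (T̃ j j′)) ≗ (+ tri b i j ⊙ Ψ (i + j))
    inner i j n = trans (Ω-Ωᶻ b (λ i′ j′ → conv (T̃ i i′) (T̃ j j′)) n)
      (trans (Ωᶻ-cong b (λ i′ j′ → trans
          (resp (iter-linear 1+shift-linear (b ∸ (i′ + j′))) (conv-T̃ i j i′ j′) n)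
          (scale (iter-linear 1+shift-linear (b ∸ (i′ + j′))) (kronecker i i′ *ᶻ kronecker j j′)
              (iter shift (i′ + j′) δ) n)))
        (Ωᶻ-kronecker b i j (λ i′ j′ → Ψ (i′ + j′) n)))
    -- With truncated subtraction the exponents add up only for m ≤ a and m ≤ b. The outer word
    -- ensures the first bound, and where the second fails the coefficient `tri b i j` is zero.
    exponents : ∀ m → m ≤ a → m ≤ b → a ∸ m + suc (b ∸ m) ≡ d ∸ (m + m)
    exponents m m≤a m≤b = trans (ℕₚ.+-suc (a ∸ m) (b ∸ m))
      (sym (trans (cong₂ (λ x y → suc (x + y) ∸ (m + m)) (sym (ℕₚ.m∸n+n≡m m≤a)) (sym (ℕₚ.m∸n+n≡m m≤b)))
      (trans (cong (_∸ (m + m)) (regroup (a ∸ m) (b ∸ m) m)) (ℕₚ.m+n∸n≡m (suc (a ∸ m + (b ∸ m))) (m + m)))))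
      where
      regroup : ∀ x y m → suc (x + m + (y + m)) ≡ suc (x + y) + (m + m)
      regroup = ℕSolver.solve-∀
    combine : ∀ i j → i + j ≤ a → iter 1+shift (a ∸ (i + j)) (1+shift (+ tri b i j ⊙ Ψ (i + j))) n
        ≡ + tri b i j *ᶻ Φ (i + j) n
    combine i j m≤a = trans (scale (∘-linear (iter-linear 1+shift-linear (a ∸ m)) 1+shift-linear) (+ tri b i j)
        (Ψ m) n) (cases (m ℕ.≤? b))
      where
      m = i + j
      cases : Dec (m ≤ b) → + tri b i j *ᶻ iter 1+shift (a ∸ m) (1+shift (Ψ m)) n ≡ + tri b i j *ᶻ Φ m n
      cases (no m≰b) = trans (cong (_*ᶻ iter 1+shift (a ∸ m) (1+shift (Ψ m)) n) t≡0)
          (trans (ℤₚ.*-zeroˡ (iter 1+shift (a ∸ m) (1+shift (Ψ m)) n))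
              (sym (trans (cong (_*ᶻ Φ m n) t≡0) (ℤₚ.*-zeroˡ (Φ m n)))))
        where
        t≡0 : + tri b i j ≡ + 0
        t≡0 = cong +_ (tri-large b i j (ℕₚ.≰⇒> m≰b))
      cases (yes m≤b) = cong (+ tri b i j *ᶻ_) (trans
        (cong (λ F → F n) (trans (sym (iter-+ 1+shift (a ∸ m) (suc (b ∸ m)) (iter shift m δ)))
          (cong (λ k → iter 1+shift k (iter shift m δ)) (exponents m m≤a m≤b))))
        (sym (iter-commutes {iter shift m} 1+shift-linear (commutes-iter shift-linear shift-1+shift m)
            (d ∸ (m + m)) δ n)))

  γ-count : ∀ k → + faceCount (Γ b) k ≡ Ωᶻ a (λ i j → + (tri b i j * indicator k (i + j)))
  γ-count k = trans (cong +_ (Γ-count b k)) (sym (Ωᶻ-wordSum a (λ i j → tri b i j * indicator k (i + j))))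

  -- The words are collected by m = i + j. The index range of γ suffices, since a nonzero term has m
  -- ≤ a and m ≤ b, hence 2m ≤ a + b < d.
  G-γ : 1+shift (G a b) ≗ coeff (γExpansion d γ-of)
  G-γ n = trans (G-tri n) (sym
    (trans (coeff-γExpansion d γ-of n)
    (trans (sumℤ-cong {suc ⌊ d /2⌋} (λ k → trans (cong (_*ᶻ Φ (Fin.toℕ k) n) (γ-count (Fin.toℕ k)))
              (Ωᶻ-*ʳ a (λ i j → + (tri b i j * indicator (Fin.toℕ k) (i + j))) (Φ (Fin.toℕ k) n))))
    (trans (sumℤ-Ωᶻ a (λ (k : Fin (suc ⌊ d /2⌋)) i j → + (tri b i j * indicator (Fin.toℕ k) (i + j)) *ᶻ Φ
        (Fin.toℕ k) n))
    (Ωᶻ-bounded a (λ i j l → sift-indicator (suc ⌊ d /2⌋) (tri b i j) (λ k → Φ k n) (i + j)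
      (λ d<m → tri-large b i j (ℕₚ.≰⇒> (λ l′ → half i j l l′ d<m)))))))))
    where
    half : ∀ i j → i + j ≤ a → i + j ≤ b → ¬ ⌊ d /2⌋ < i + j
    half i j l l′ p = ℕₚ.<⇒≱ p (ℕₚ.≤-trans (ℕₚ.≤-reflexive (ℕₚ.n≡⌊n+n/2⌋ (i + j)))
      (ℕₚ.⌊n/2⌋-mono (ℕₚ.≤-trans (ℕₚ.+-mono-≤ l l′) (ℕₚ.n≤1+n _))))

  Γ-polynomial : fPoly (Γ b) ≈ᴾ polyOf γ-of
  Γ-polynomial k = trans (coeff-fPoly (Γ b) k) (sym (trans (coeff-polyOf γ-of k)
    (sift-shift (suc ⌊ d /2⌋) (λ k → + faceCount (Γ b) k) k (λ p → cong +_ (large p)))))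
    where
    large : ⌊ d /2⌋ < k → faceCount (Γ b) k ≡ 0
    large p with k ℕ.≤? a | k ℕ.≤? b
    ... | no q  | _     = Matchings.Γ-count-large a b k (inj₁ (ℕₚ.≰⇒> q))
    ... | yes _ | no q  = Matchings.Γ-count-large a b k (inj₂ (ℕₚ.≰⇒> q))
    ... | yes q | yes r = ⊥-elim (ℕₚ.<⇒≱ p (ℕₚ.≤-trans (ℕₚ.≤-reflexive (ℕₚ.n≡⌊n+n/2⌋ k))
      (ℕₚ.⌊n/2⌋-mono (ℕₚ.≤-trans (ℕₚ.+-mono-≤ q r) (ℕₚ.n≤1+n _)))))

-- Counting in duplicate-free lists

module _ {A B : Set} where

  -- The partner of the head is deleted from `ys`; injectivity of `R` prevents it from being the
  -- partner of a later entry as well.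
  injection-length : (xs : List A) (ys : List B) (R : A → B → Set) → Unique xs →
    (∀ x → x ∈ˡ xs → Σ B λ y → y ∈ˡ ys × R x y) →
    (∀ {x x′ y} → R x y → R x′ y → x ≡ x′) → length xs ≤ length ys
  injection-length []       ys R u f inj = z≤n
  injection-length (x ∷ xs) ys R (x∉xs ∷ u) f inj
    with f x (Any.here refl)
  ... | y , y∈ys , Rxy with ∈-∃++ y∈ys
  ...   | ls , rs , refl = subst (suc (length xs) ≤_) (sym (Listₚ.length-++-sucʳ ls y rs))
    (s≤s (injection-length xs (ls ++ rs) R u others inj))
    where
    others : ∀ z → z ∈ˡ xs → Σ B λ w → w ∈ˡ (ls ++ rs) × R z w
    others z z∈xs with f z (Any.there z∈xs)
    ... | w , w∈ , Rzw with ∈-++⁻ ls w∈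
    ...   | inj₁ p = w , ∈-++⁺ˡ p , Rzw
    ...   | inj₂ (Any.there p) = w , ∈-++⁺ʳ ls p , Rzw
    ...   | inj₂ (Any.here refl) = ⊥-elim (All.lookup x∉xs z∈xs (inj Rxy Rzw))

bijection-length : {A B : Set} (xs : List A) (ys : List B) (R : A → B → Set) → Unique xs → Unique ys →
  (∀ x → x ∈ˡ xs → Σ B λ y → y ∈ˡ ys × R x y) → (∀ y → y ∈ˡ ys → Σ A λ x → x ∈ˡ xs × R x y) →
  (∀ {x x′ y} → R x y → R x′ y → x ≡ x′) → (∀ {x y y′} → R x y → R x y′ → y ≡ y′) →
  length xs ≡ length ys
bijection-length xs ys R u v f g inj inj′ = ℕₚ.≤-antisym
  (injection-length xs ys R u f inj) (injection-length ys xs (λ y x → R x y) v g inj′)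

length-empty : {A : Set} (xs : List A) → (∀ {x} → x ∈ˡ xs → ⊥) → length xs ≡ 0
length-empty []       f = refl
length-empty (x ∷ xs) f = ⊥-elim (f (Any.here refl))

filter-complement : {A : Set} {P : Pred A 0ℓ} (P? : Decidable P) (xs : List A) →
  length (List.filter (¬? ∘ P?) xs) + length (List.filter P? xs) ≡ length xs
filter-complement P? []       = refl
filter-complement P? (x ∷ xs) with P? x
... | yes _ = trans (ℕₚ.+-suc _ _) (cong suc (filter-complement P? xs))
... | no  _ = cong suc (filter-complement P? xs)

count : {A : Set} → (A → Bool) → List A → ℕ
count p xs = length (List.filter (λ x → p x Boolₚ.≟ true) xs)

count-++ : {A : Set} (p : A → Bool) (xs ys : List A) → count p (xs ++ ys) ≡ count p xs + count p ys
count-++ p xs ys = trans (cong length (Listₚ.filter-++ (λ x → p x Boolₚ.≟ true) xs ys))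
    (Listₚ.length-++ (List.filter (λ x → p x Boolₚ.≟ true) xs))

count-map : {A B : Set} (p : B → Bool) (f : A → B) (xs : List A) → count p (List.map f xs) ≡ count (p ∘ f) xs
count-map p f []       = refl
count-map p f (x ∷ xs) with p (f x)
... | true  = cong suc (count-map p f xs)
... | false = count-map p f xs

count-true : {A : Set} (xs : List A) → count (λ _ → true) xs ≡ length xs
count-true []       = refl
count-true (x ∷ xs) = cong suc (count-true xs)

-- Dependent products of lists

sig : {I A : Set} → List I → (I → List A) → List (I × A)
sig []       L = []
sig (i ∷ is) L = List.map (i ,_) (L i) ++ sig is L

∈-sig⁺ : ∀ {I A : Set} {is : List I} {L : I → List A} {i x} → i ∈ˡ is → x ∈ˡ L i → (i , x) ∈ˡ sig is L
∈-sig⁺ (Any.here refl) q = ∈-++⁺ˡ (∈-map⁺ (_ ,_) q)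
∈-sig⁺ {is = j ∷ is} {L} (Any.there p) q = ∈-++⁺ʳ (List.map (j ,_) (L j)) (∈-sig⁺ p q)

∈-sig⁻ : ∀ {I A : Set} (is : List I) {L : I → List A} {i x} → (i , x) ∈ˡ sig is L → i ∈ˡ is × x ∈ˡ L i
∈-sig⁻ (j ∷ is) {L} p with ∈-++⁻ (List.map (j ,_) (L j)) p
... | inj₂ q = let r , s = ∈-sig⁻ is q in Any.there r , s
... | inj₁ q with ∈-map⁻ (j ,_) q
...   | _ , r , refl = Any.here refl , r

sig-unique : ∀ {I A : Set} {is : List I} {L : I → List A} → Unique is → (∀ i → Unique (L i)) → Unique (sig is L)
sig-unique {is = []}     u v = []
sig-unique {is = i ∷ is} {L} (i∉is ∷ u) v = Uniqueₚ.++⁺ (Uniqueₚ.map⁺ (cong proj₂) (v i)) (sig-unique u v) disjoint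
  where
  disjoint : ∀ {x} → x ∈ˡ List.map (i ,_) (L i) × x ∈ˡ sig is L → ⊥
  disjoint (p , q) with ∈-map⁻ (i ,_) p
  ... | _ , _ , refl = All.lookup i∉is (proj₁ (∈-sig⁻ is q)) refl

count-sig : ∀ {I A : Set} (p : I × A → Bool) (is : List I) (L : I → List A) →
  count p (sig is L) ≡ sum (List.map (λ i → count (λ x → p (i , x)) (L i)) is)
count-sig p []       L = refl
count-sig p (i ∷ is) L = trans (count-++ p (List.map (i ,_) (L i)) (sig is L))
  (cong₂ _+_ (count-map p (i ,_) (L i)) (count-sig p is L))

anti : ℕ → List (ℕ × ℕ)
anti zero    = (0 , 0) ∷ []
anti (suc n) = (0 , suc n) ∷ List.map (λ { (u , v) → suc u , v }) (anti n)

∈-anti⁺ : ∀ u v → (u , v) ∈ˡ anti (u + v)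
∈-anti⁺ zero    zero    = Any.here refl
∈-anti⁺ zero    (suc v) = Any.here refl
∈-anti⁺ (suc u) v       = Any.there (∈-map⁺ _ (∈-anti⁺ u v))

∈-anti⁻ : ∀ n {u v} → (u , v) ∈ˡ anti n → u + v ≡ n
∈-anti⁻ zero    (Any.here refl) = refl
∈-anti⁻ (suc n) (Any.here refl) = refl
∈-anti⁻ (suc n) (Any.there p) with ∈-map⁻ _ p
... | _ , q , refl = cong suc (∈-anti⁻ n q)

anti-unique : ∀ n → Unique (anti n)
anti-unique zero    = All.[] ∷ []
anti-unique (suc n) = All.tabulate (λ p eq → absurd p eq) ∷ Uniqueₚ.map⁺ (λ { {_ , _} {_ , _} refl → refl })
    (anti-unique n)
  where
  absurd : ∀ {x} → x ∈ˡ List.map (λ { (u , v) → suc u , v }) (anti n) → (0 , suc n) ≢ x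
  absurd p refl with ∈-map⁻ _ p
  ... | _ , _ , ()

sum-anti : ∀ (f : ℕ → ℕ → ℕ) n → + sum (List.map (λ { (u , v) → f u v }) (anti n)) ≡ diag (λ u v → + f u v) n
sum-anti f zero    = cong +_ (ℕₚ.+-identityʳ (f 0 0))
sum-anti f (suc n) = cong (+ f 0 (suc n) +ᶻ_) (trans (cong (λ l → + sum l) (sym (Listₚ.map-∘ (anti n))))
    (sum-anti (f ∘ suc) n))

diag-psum : ∀ g → diag (λ u v → g v) ≗ psum g
diag-psum g zero    = refl
diag-psum g (suc n) = trans (cong (g (suc n) +ᶻ_) (diag-psum g n)) (ℤₚ.+-comm (g (suc n)) (psum g n))

-- below L n lists the ((k , r) , x) with x ∈ L r and k + r + 1 = n.
below : {A : Set} → (ℕ → List A) → ℕ → List ((ℕ × ℕ) × A)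
below L zero    = []
below L (suc n) = sig (anti n) (L ∘ proj₂)

∈-below⁺ : ∀ {A : Set} (L : ℕ → List A) k r {x} → x ∈ˡ L r → ((k , r) , x) ∈ˡ below L (suc (k + r))
∈-below⁺ L k r p = ∈-sig⁺ (∈-anti⁺ k r) p

∈-below⁻ : ∀ {A : Set} (L : ℕ → List A) n {k r x} → ((k , r) , x) ∈ˡ below L n → suc (k + r) ≡ n × x ∈ˡ L r
∈-below⁻ L (suc n) p = let q , s = ∈-sig⁻ (anti n) p in cong suc (∈-anti⁻ n q) , s

below-unique : ∀ {A : Set} (L : ℕ → List A) n → (∀ r → Unique (L r)) → Unique (below L n)
below-unique L zero    u = []
below-unique L (suc n) u = sig-unique (anti-unique n) (u ∘ proj₂)

-- Each r < n occurs with exactly one k, which turns the count into the sum of all earlier terms.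
count-below : ∀ {A : Set} (p : A → Bool) (L : ℕ → List A) n →
  + count (p ∘ proj₂) (below L n) ≡ J (λ r → + count p (L r)) n
count-below p L zero    = refl
count-below p L (suc n) = trans (cong +_ (count-sig (p ∘ proj₂) (anti n) (L ∘ proj₂)))
  (trans (sum-anti (λ _ r → count p (L r)) n) (diag-psum (λ r → + count p (L r)) n))

below-injective : ∀ {A : Set} (L : ℕ → List A) n {k r k′ r′ x} → ((k , r) , x) ∈ˡ below L n →
    ((k′ , r′) , x) ∈ˡ below L n →
  k ≡ k′ → r ≡ r′
below-injective L n {k} p q refl = ℕₚ.+-cancelˡ-≡ k _ _ (ℕₚ.suc-injective
  (trans (proj₁ (∈-below⁻ L n p)) (sym (proj₁ (∈-below⁻ L n q)))))

-- Injectivity is asked for on members only: the maps used here forget r, which k and the total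
-- determine for members of `below`.
unique-map-∈ : ∀ {A B : Set} (f : A → B) {xs} → (∀ {x y} → x ∈ˡ xs → y ∈ˡ xs → f x ≡ f y → x ≡ y) →
  Unique xs → Unique (List.map f xs)
unique-map-∈ f {[]}     inj u = []
unique-map-∈ f {x ∷ xs} inj (x∉xs ∷ u) =
  Allₚ.map⁺ (All.tabulate (λ q eq → All.lookup x∉xs q (inj (Any.here refl) (Any.there q) eq)))
  ∷ unique-map-∈ f (λ p q → inj (Any.there p) (Any.there q)) u

-- Vectors of naturals of given sum

comps : ∀ m → ℕ → List (Vec ℕ m)
comps zero    zero    = [] ∷ []
comps zero    (suc N) = []
comps (suc m) N       = List.map (0 ∷_) (comps m N) ++ List.map (λ { ((k , r) , c) → suc k ∷ c }) (below (comps m) N)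

∈-comps⁺ : ∀ {m} (c : Vec ℕ m) → c ∈ˡ comps m (Vec.sum c)
∈-comps⁺ []          = Any.here refl
∈-comps⁺ (zero ∷ c)  = ∈-++⁺ˡ (∈-map⁺ (0 ∷_) (∈-comps⁺ c))
∈-comps⁺ {suc m} (suc k ∷ c) = ∈-++⁺ʳ (List.map (0 ∷_) (comps m (Vec.sum (suc k ∷ c))))
  (∈-map⁺ _ (∈-below⁺ (comps m) k (Vec.sum c) (∈-comps⁺ c)))

∈-comps⁻ : ∀ m N {c} → c ∈ˡ comps m N → Vec.sum c ≡ N
∈-comps⁻ zero    zero    (Any.here refl) = refl
∈-comps⁻ (suc m) N p with ∈-++⁻ (List.map (0 ∷_) (comps m N)) p
... | inj₁ q with ∈-map⁻ (0 ∷_) q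
...   | _ , r , refl = ∈-comps⁻ m N r
∈-comps⁻ (suc m) N p | inj₂ q with ∈-map⁻ _ q
... | ((k , r) , _) , s , refl with ∈-below⁻ (comps m) N s
...   | t , w = trans (cong (_+_ (suc k)) (∈-comps⁻ m r w)) t

comps-unique : ∀ m N → Unique (comps m N)
comps-unique zero    zero    = All.[] ∷ []
comps-unique zero    (suc N) = []
comps-unique (suc m) N = Uniqueₚ.++⁺
  (Uniqueₚ.map⁺ (λ { refl → refl }) (comps-unique m N))
  (unique-map-∈ _ (λ { {(k , r) , c} p q refl → cong (λ r → (k , r) , c) (below-injective (comps m) N p q refl) })
    (below-unique (comps m) N (comps-unique m)))
  disjoint
  where
  disjoint : ∀ {x} → x ∈ˡ List.map (0 ∷_) (comps m N) × x ∈ˡ List.map _ (below (comps m) N) → ⊥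
  disjoint (p , q) with ∈-map⁻ (0 ∷_) p | ∈-map⁻ _ q
  ... | _ , _ , refl | _ , _ , ()

isPositive : ℕ → Bool
isPositive zero    = false
isPositive (suc _) = true

supp : ∀ {m} → Vec ℕ m → Subset m
supp = Vec.map isPositive

-- Σ_S t^|S| over the subsets S accepted by g
subsetPoly : ∀ m → (Subset m → Bool) → Poly
subsetPoly zero    g = (+ (if g [] then 1 else 0)) ∷ []
subsetPoly (suc m) g = subsetPoly m (g ∘ (false ∷_)) +ᴾ ((+ 0) ∷ subsetPoly m (g ∘ (true ∷_)))

coeff-subsetPoly : ∀ m g k → coeff (subsetPoly m g) k ≡ + ∑ (λ S → if g S ∧ does (∣ S ∣ ℕ.≟ k) then 1 else 0)
coeff-subsetPoly zero    g zero with g []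
... | true  = refl
... | false = refl
coeff-subsetPoly zero    g (suc k) with g []
... | true  = refl
... | false = refl
coeff-subsetPoly (suc m) g k = trans (coeff-+ᴾ (subsetPoly m (g ∘ (false ∷_))) _ k)
  (trans (cong₂ _+ᶻ_ (coeff-subsetPoly m (g ∘ (false ∷_)) k) (chosen k))
  (cong +_ (trans (ℕₚ.+-comm (∑ (λ S → if g (false ∷ S) ∧ does (∣ S ∣ ℕ.≟ k) then 1 else 0)) _)
      (sym (∑-suc (λ S → if g S ∧ does (∣ S ∣ ℕ.≟ k) then 1 else 0))))))
  where
  chosen : ∀ k → coeff ((+ 0) ∷ subsetPoly m (g ∘ (true ∷_))) k ≡ + ∑
      (λ S → if g (true ∷ S) ∧ does (suc ∣ S ∣ ℕ.≟ k) then 1 else 0)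
  chosen zero    = cong +_ (sym (trans (∑-cong (λ S → cong (if_then 1 else 0) (Boolₚ.∧-zeroʳ (g (true ∷ S)))))
      (∑-zero {m})))
  chosen (suc k) = coeff-subsetPoly m (g ∘ (true ∷_)) k

-- Substituting θ = s + s² + ... for t gives every chosen element an arbitrary positive
-- multiplicity, so a subset S turns into the vectors with support S, graded by their sum.
ev-subsetPoly : ∀ m (g : Subset m → Bool) → ev J (subsetPoly m g) δ ≗ (λ N → + count (g ∘ supp) (comps m N))
ev-subsetPoly zero g zero with g []
... | true  = refl
... | false = refl
ev-subsetPoly zero g (suc N) = trans (cong₂ _+ᶻ_ (ℤₚ.*-zeroʳ (+ (if g [] then 1 else 0)))
    (zero-map J-linear (suc N))) refl
ev-subsetPoly (suc m) g N = trans (Evaluation.ev-+ J-linear (subsetPoly m (g ∘ (false ∷_))) _ δ N)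
  (trans (cong₂ _+ᶻ_ (ev-subsetPoly m (g ∘ (false ∷_)) N)
    (trans (cong (_+ᶻ J (ev J (subsetPoly m (g ∘ (true ∷_))) δ) N) (ℤₚ.*-zeroˡ (δ N)))
    (trans (ℤₚ.+-identityˡ _)
    (trans (resp J-linear (ev-subsetPoly m (g ∘ (true ∷_))) N)
    (trans (sym (count-below (g ∘ (true ∷_) ∘ supp) (comps m) N))
      (cong +_ (sym (count-map (g ∘ supp) (λ { ((k , r) , c) → suc k ∷ c }) (below (comps m) N)))))))))
  (cong +_ (trans (cong (_+ count (g ∘ supp) (List.map _ (below (comps m) N)))
      (sym (count-map (g ∘ supp) (0 ∷_) (comps m N))))
    (sym (count-++ (g ∘ supp) (List.map (0 ∷_) (comps m N)) _)))))

-- The Hilbert function of the Stanley–Reisner ring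
ev-fPoly : ∀ {m} (Δ : Complex m) → ev J (fPoly Δ) δ ≗ (λ N → + count (isFace Δ ∘ supp) (comps m N))
ev-fPoly {m} Δ = ≗-trans
  (Evaluation.ev-cong J-linear (fPoly Δ) (subsetPoly m (isFace Δ))
    (λ k → trans (coeff-fPoly Δ k) (sym (coeff-subsetPoly m (isFace Δ) k))) δ)
  (ev-subsetPoly m (isFace Δ))

-- Integer vectors with bounded positive and negative part

pos neg : ℤ → ℕ
pos (+ n)    = n
pos -[1+ n ] = 0
neg (+ n)    = 0
neg -[1+ n ] = suc n

posSum negSum : ∀ {a} → Vec ℤ a → ℕ
posSum = Vec.sum ∘ Vec.map pos
negSum = Vec.sum ∘ Vec.map neg

signed : ∀ a → ℕ → ℕ → List (Vec ℤ a)
signed zero    u v = [] ∷ []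
signed (suc a) u v = List.map (+ 0 ∷_) (signed a u v)
  ++ List.map (λ { ((k , r) , x) → + suc k ∷ x }) (below (λ u′ → signed a u′ v) u)
  ++ List.map (λ { ((k , r) , x) → -[1+ k ] ∷ x }) (below (signed a u) v)

length-signed : ∀ a u v → + length (signed a u v) ≡ W a u v
length-signed zero    u v = refl
length-signed (suc a) u v = trans (cong +_ (trans (Listₚ.length-++ (List.map (+ 0 ∷_) (signed a u v)))
    (cong₂ _+_ (Listₚ.length-map _ (signed a u v))
      (trans (Listₚ.length-++ (List.map _ (below (λ u′ → signed a u′ v) u)))
        (cong₂ _+_ (Listₚ.length-map _ (below (λ u′ → signed a u′ v) u))
            (Listₚ.length-map _ (below (signed a u) v)))))))
  (trans (sym (ℤₚ.+-assoc (+ length (signed a u v)) (+ length (below (λ u′ → signed a u′ v) u))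
      (+ length (below (signed a u) v))))
  (cong₂ _+ᶻ_ (cong₂ _+ᶻ_ (length-signed a u v)
    (trans (length-below (λ u′ → signed a u′ v) u) (resp J-linear (λ u′ → length-signed a u′ v) u)))
    (trans (length-below (signed a u) v) (resp J-linear (λ v′ → length-signed a u v′) v))))
  where
  length-below : ∀ {A : Set} (L : ℕ → List A) n → + length (below L n) ≡ J (λ r → + length (L r)) n
  length-below L n = trans (cong +_ (sym (count-true (below L n))))
    (trans (count-below (λ _ → true) L n) (resp J-linear (λ r → cong +_ (count-true (L r))) n))

split-≤ : ∀ k s u → suc k + s ≤ u → Σ ℕ λ r → suc (k + r) ≡ u × s ≤ r
split-≤ k s u p = u ∸ suc k , ℕₚ.m+[n∸m]≡n (ℕₚ.≤-trans (ℕₚ.m≤m+n (suc k) s) p)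
  , ℕₚ.≤-trans (ℕₚ.≤-reflexive (sym (ℕₚ.m+n∸m≡n (suc k) s))) (ℕₚ.∸-monoˡ-≤ (suc k) p)

∈-signed⁺ : ∀ {a} (x : Vec ℤ a) u v → posSum x ≤ u → negSum x ≤ v → x ∈ˡ signed a u v
∈-signed⁺ []                u v p q = Any.here refl
∈-signed⁺ (+ zero ∷ x)      u v p q = ∈-++⁺ˡ (∈-map⁺ (+ 0 ∷_) (∈-signed⁺ x u v p q))
∈-signed⁺ {suc a} (+ suc k ∷ x) u v p q with split-≤ k (posSum x) u p
... | r , refl , l = ∈-++⁺ʳ (List.map (+ 0 ∷_) (signed a u v))
  (∈-++⁺ˡ (∈-map⁺ _ (∈-below⁺ (λ u′ → signed a u′ v) k r (∈-signed⁺ x r v l q))))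
∈-signed⁺ {suc a} (-[1+ k ] ∷ x) u v p q with split-≤ k (negSum x) v q
... | r , refl , l = ∈-++⁺ʳ (List.map (+ 0 ∷_) (signed a u v))
  (∈-++⁺ʳ (List.map _ (below (λ u′ → signed a u′ v) u))
    (∈-map⁺ _ (∈-below⁺ (signed a u) k r (∈-signed⁺ x u r p l))))

∈-signed⁻ : ∀ a u v {x} → x ∈ˡ signed a u v → posSum x ≤ u × negSum x ≤ v
∈-signed⁻ zero    u v (Any.here refl) = z≤n , z≤n
∈-signed⁻ (suc a) u v p with ∈-++⁻ (List.map (+ 0 ∷_) (signed a u v)) p
... | inj₁ q with ∈-map⁻ (+ 0 ∷_) q
...   | _ , r , refl = ∈-signed⁻ a u v r
∈-signed⁻ (suc a) u v p | inj₂ q with ∈-++⁻ (List.map _ (below (λ u′ → signed a u′ v) u)) q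
... | inj₁ s with ∈-map⁻ _ s
...   | ((k , r) , x) , t , refl with ∈-below⁻ (λ u′ → signed a u′ v) u t
...     | refl , w = let l , l′ = ∈-signed⁻ a r v w in ℕₚ.+-monoʳ-≤ (suc k) l , l′
∈-signed⁻ (suc a) u v p | inj₂ q | inj₂ s with ∈-map⁻ _ s
... | ((k , r) , x) , t , refl with ∈-below⁻ (signed a u) v t
...   | refl , w = let l , l′ = ∈-signed⁻ a u r w in l , ℕₚ.+-monoʳ-≤ (suc k) l′

signed-unique : ∀ a u v → Unique (signed a u v)
signed-unique zero    u v = All.[] ∷ []
signed-unique (suc a) u v = Uniqueₚ.++⁺
  (Uniqueₚ.map⁺ (λ { refl → refl }) (signed-unique a u v))
  (Uniqueₚ.++⁺
    (unique-map-∈ _ (λ { {(k , r) , x} p q refl → cong (λ r → (k , r) , x)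
        (below-injective (λ u′ → signed a u′ v) u p q refl) })
      (below-unique (λ u′ → signed a u′ v) u (λ r → signed-unique a r v)))
    (unique-map-∈ _ (λ { {(k , r) , x} p q refl → cong (λ r → (k , r) , x) (below-injective (signed a u) v p q refl) })
      (below-unique (signed a u) v (signed-unique a u)))
    disjoint′)
  disjoint
  where
  disjoint′ : ∀ {x} → x ∈ˡ List.map (λ { ((k , r) , x) → + suc k ∷ x }) (below (λ u′ → signed a u′ v) u)
    × x ∈ˡ List.map (λ { ((k , r) , x) → -[1+ k ] ∷ x }) (below (signed a u) v) → ⊥
  disjoint′ (p , q) with ∈-map⁻ _ p | ∈-map⁻ _ q
  ... | _ , _ , refl | _ , _ , ()
  disjoint : ∀ {x} → x ∈ˡ List.map (+ 0 ∷_) (signed a u v)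
    × x ∈ˡ (List.map (λ { ((k , r) , x) → + suc k ∷ x }) (below (λ u′ → signed a u′ v) u)
      ++ List.map (λ { ((k , r) , x) → -[1+ k ] ∷ x }) (below (signed a u) v)) → ⊥
  disjoint (p , q) with ∈-map⁻ (+ 0 ∷_) p | ∈-++⁻ (List.map _ (below (λ u′ → signed a u′ v) u)) q
  ... | _ , _ , refl | inj₁ r with ∈-map⁻ _ r
  ...   | _ , _ , ()
  disjoint (p , q) | _ , _ , refl | inj₂ r with ∈-map⁻ _ r
  ...   | _ , _ , ()

-- A point ((u , v) , x , y) with u + v = N encodes a lattice point (x̂ , -ŷ) of N·P: the missing
-- coordinates x̂₀ and ŷ₀ make both entry sums equal to u - v.  It has norm exactly N, and thus
-- lies on the boundary of N·P, unless all four bounds of Valid are strict.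

module _ (a b : ℕ) where

  Point : Set
  Point = (ℕ × ℕ) × (Vec ℤ a × Vec ℤ b)

  points : ℕ → List Point
  points N = sig (anti N) (λ { (u , v) → sig (signed a u v) (λ _ → signed b u v) })

  points-unique : ∀ N → Unique (points N)
  points-unique N = sig-unique (anti-unique N) (λ { (u , v) → sig-unique (signed-unique a u v)
      (λ _ → signed-unique b u v) })

  record Valid (p : Point) : Set where
    constructor valid
    field
      pos-x : posSum (proj₁ (proj₂ p)) ≤ proj₁ (proj₁ p)
      neg-x : negSum (proj₁ (proj₂ p)) ≤ proj₂ (proj₁ p)
      pos-y : posSum (proj₂ (proj₂ p)) ≤ proj₁ (proj₁ p)
      neg-y : negSum (proj₂ (proj₂ p)) ≤ proj₂ (proj₁ p)

  ∈-points⁺ : ∀ {u v x y} → Valid ((u , v) , x , y) → ((u , v) , x , y) ∈ˡ points (u + v)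
  ∈-points⁺ {u} {v} {x} {y} (valid p q r s) = ∈-sig⁺ (∈-anti⁺ u v) (∈-sig⁺ (∈-signed⁺ x u v p q) (∈-signed⁺ y u v r s))

  ∈-points⁻ : ∀ N {u v x y} → ((u , v) , x , y) ∈ˡ points N → u + v ≡ N × Valid ((u , v) , x , y)
  ∈-points⁻ N {u} {v} p with ∈-sig⁻ (anti N) p
  ... | q , r with ∈-sig⁻ (signed a u v) r
  ...   | s , t = ∈-anti⁻ N q , valid (proj₁ (∈-signed⁻ a u v s)) (proj₂ (∈-signed⁻ a u v s))
                                      (proj₁ (∈-signed⁻ b u v t)) (proj₂ (∈-signed⁻ b u v t))

  length-sig : ∀ {I A : Set} (is : List I) (L : I → List A) → length (sig is L) ≡ sum (List.map (length ∘ L) is)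
  length-sig []       L = refl
  length-sig (i ∷ is) L = trans (Listₚ.length-++ (List.map (i ,_) (L i)))
      (cong₂ _+_ (Listₚ.length-map _ (L i)) (length-sig is L))

  length-product : ∀ {A B : Set} (xs : List A) (ys : List B) → length (sig xs (λ _ → ys)) ≡ length xs * length ys
  length-product []       ys = refl
  length-product (x ∷ xs) ys = trans (Listₚ.length-++ (List.map (x ,_) ys))
      (cong₂ _+_ (Listₚ.length-map _ ys) (length-product xs ys))

  length-points : ∀ N → + length (points N) ≡ D a b N
  length-points N = trans (cong +_ (trans (length-sig (anti N) _)
      (cong sum (Listₚ.map-cong (λ { (u , v) → length-product (signed a u v) (signed b u v) }) (anti N)))))
    (trans (sum-anti (λ u v → length (signed a u v) * length (signed b u v)) N)
    (diag-cong (λ u v → trans (ℤₚ.pos-* (length (signed a u v)) _)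
        (cong₂ _*ᶻ_ (length-signed a u v) (length-signed b u v))) N))

  Interior : Point → Set
  Interior ((u , v) , x , y) = (posSum x < u × negSum x < v) × (posSum y < u × negSum y < v)

  interior? : Decidable Interior
  interior? ((u , v) , x , y) = ((posSum x ℕ.<? u) ×-dec (negSum x ℕ.<? v)) ×-dec
      ((posSum y ℕ.<? u) ×-dec (negSum y ℕ.<? v))

  exactPoints : ℕ → List Point
  exactPoints N = List.filter (¬? ∘ interior?) (points N)

  -- Strictness of all four bounds is exactly what allows u and v to be lowered by one with x and y
  -- kept. This matches interior points of level N with all points of level N-2; below level 2 there
  -- are none, since u and v must both be positive.
  interior-length : ∀ N → + length (List.filter interior? (points N)) ≡ shift (shift (D a b)) N
  interior-length zero    = cong +_ (length-empty (List.filter interior? (points 0))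
      (λ p → none (∈-filter⁻ interior? {xs = points 0} p)))
    where
    none : ∀ {p} → p ∈ˡ points 0 × Interior p → ⊥
    none {(zero , v) , x , y} (q , (() , _) , _)
    none {(suc u , v) , x , y} (q , _) with () ← proj₁ (∈-points⁻ 0 q)
  interior-length (suc zero) = cong +_ (length-empty (List.filter interior? (points 1))
      (λ p → none (∈-filter⁻ interior? {xs = points 1} p)))
    where
    none : ∀ {p} → p ∈ˡ points 1 × Interior p → ⊥
    none {(zero , v) , x , y} (q , (() , _) , _)
    none {(suc u , zero) , x , y} (q , (_ , ()) , _)
    none {(suc u , suc v) , x , y} (q , _) with proj₁ (∈-points⁻ 1 q)
    ... | r with () ← trans (sym (ℕₚ.+-suc u v)) (ℕₚ.suc-injective r)
  interior-length (suc (suc N)) = trans (cong +_ (bijection-length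
      (List.filter interior? (points (suc (suc N)))) (points N) Lowered
      (Uniqueₚ.filter⁺ interior? (points-unique (suc (suc N)))) (points-unique N)
      lower raise (λ { {(suc u , suc v) , x , y} {(suc u′ , suc v′) , x′ , y′} refl refl → refl })
      (λ { {(suc u , suc v) , x , y} refl refl → refl })))
    (length-points N)
    where
    Lowered : Point → Point → Set
    Lowered ((suc u , suc v) , x , y) q = ((u , v) , x , y) ≡ q
    Lowered _                         q = ⊥
    lower : ∀ p → p ∈ˡ List.filter interior? (points (suc (suc N))) → Σ Point λ q → q ∈ˡ points N × Lowered p q
    lower p p∈ with ∈-filter⁻ interior? {xs = points (suc (suc N))} p∈
    lower ((suc u , suc v) , x , y) p∈ | q , (s≤s k , s≤s l) , (s≤s m , s≤s n) =
      ((u , v) , x , y) , subst (λ N → ((u , v) , x , y) ∈ˡ points N)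
        (ℕₚ.suc-injective (ℕₚ.suc-injective (trans (cong suc (sym (ℕₚ.+-suc u v)))
            (proj₁ (∈-points⁻ (suc (suc N)) q)))))
        (∈-points⁺ (valid k l m n)) , refl
    raise : ∀ q → q ∈ˡ points N → Σ Point λ p → p ∈ˡ List.filter interior? (points (suc (suc N))) × Lowered p q
    raise ((u , v) , x , y) q∈ with ∈-points⁻ N q∈
    ... | e , valid k l m n = ((suc u , suc v) , x , y)
      , ∈-filter⁺ interior? (subst (λ N → ((suc u , suc v) , x , y) ∈ˡ points N)
          (cong suc (trans (ℕₚ.+-suc u v) (cong suc e)))
          (∈-points⁺ (valid (ℕₚ.m≤n⇒m≤1+n k) (ℕₚ.m≤n⇒m≤1+n l) (ℕₚ.m≤n⇒m≤1+n m) (ℕₚ.m≤n⇒m≤1+n n))))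
          ((s≤s k , s≤s l) , (s≤s m , s≤s n)) , refl

  exactPoints-length : ∀ N → + length (exactPoints N) +ᶻ shift (shift (D a b)) N ≡ D a b N
  exactPoints-length N = trans (cong (+ length (exactPoints N) +ᶻ_) (sym (interior-length N)))
    (trans (cong +_ (filter-complement interior? (points N))) (length-points N))

  D-zero : D a b 0 ≡ + 1
  D-zero = cong₂ _*ᶻ_ (W-zero a) (W-zero b)
    where
    W-zero : ∀ a → W a 0 0 ≡ + 1
    W-zero zero    = refl
    W-zero (suc a) = trans (ℤₚ.+-identityʳ _) (trans (ℤₚ.+-identityʳ _) (W-zero a))

-- Integers as rationals

-- `toℚ` reduces fractions and does not compute on variables, so its laws are proved for
-- unnormalised fractions with denominator 1 and transported back.
toℚᵘ-toℚ : ∀ z → ℚ.toℚᵘ (toℚ z) ℚᵘ.≃ ℚᵘ.mkℚᵘ z 0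
toℚᵘ-toℚ z = ℚₚ.toℚᵘ-fromℚᵘ (ℚᵘ.mkℚᵘ z 0)

toℚ-+ : ∀ x y → toℚ (x +ᶻ y) ≡ toℚ x +ℚ toℚ y
toℚ-+ x y = ℚₚ.toℚᵘ-injective (ℚᵘₚ.≃-trans (toℚᵘ-toℚ (x +ᶻ y))
  (ℚᵘₚ.≃-trans (ℚᵘ.*≡* (cong (_*ᶻ (+ 1)) (sym (cong₂ _+ᶻ_ (ℤₚ.*-identityʳ x) (ℤₚ.*-identityʳ y)))))
  (ℚᵘₚ.≃-sym (ℚᵘₚ.≃-trans (ℚₚ.toℚᵘ-homo-+ (toℚ x) (toℚ y)) (ℚᵘₚ.+-cong (toℚᵘ-toℚ x) (toℚᵘ-toℚ y))))))

toℚ-* : ∀ x y → toℚ (x *ᶻ y) ≡ toℚ x *ℚ toℚ y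
toℚ-* x y = ℚₚ.toℚᵘ-injective (ℚᵘₚ.≃-trans (toℚᵘ-toℚ (x *ᶻ y))
  (ℚᵘₚ.≃-sym (ℚᵘₚ.≃-trans (ℚₚ.toℚᵘ-homo-* (toℚ x) (toℚ y)) (ℚᵘₚ.*-cong (toℚᵘ-toℚ x) (toℚᵘ-toℚ y)))))

toℚ-neg : ∀ x → toℚ (ℤ.- x) ≡ -ℚ toℚ x
toℚ-neg x = ℚₚ.toℚᵘ-injective (ℚᵘₚ.≃-trans (toℚᵘ-toℚ (ℤ.- x))
  (ℚᵘₚ.≃-sym (ℚᵘₚ.≃-trans (ℚₚ.toℚᵘ-homo‿- (toℚ x)) (ℚᵘₚ.-‿cong (toℚᵘ-toℚ x)))))

toℚ-minus : ∀ x y → toℚ (x ℤ.- y) ≡ toℚ x -ℚ toℚ y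
toℚ-minus x y = trans (toℚ-+ x (ℤ.- y)) (cong (toℚ x +ℚ_) (toℚ-neg y))

toℚ-mono-≤ : ∀ {x y} → x ℤ.≤ y → toℚ x ℚ.≤ toℚ y
toℚ-mono-≤ {x} {y} p = ℚₚ.toℚᵘ-cancel-≤ (ℚᵘₚ.≤-trans (ℚᵘₚ.≤-reflexive (toℚᵘ-toℚ x))
  (ℚᵘₚ.≤-trans (ℚᵘ.*≤* (subst₂ ℤ._≤_ (sym (ℤₚ.*-identityʳ x)) (sym (ℤₚ.*-identityʳ y)) p))
    (ℚᵘₚ.≤-reflexive (ℚᵘₚ.≃-sym (toℚᵘ-toℚ y)))))

toℚ-cancel-≤ : ∀ {x y} → toℚ x ℚ.≤ toℚ y → x ℤ.≤ y
toℚ-cancel-≤ {x} {y} p with ℚᵘₚ.≤-trans (ℚᵘₚ.≤-reflexive (ℚᵘₚ.≃-sym (toℚᵘ-toℚ x)))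
    (ℚᵘₚ.≤-trans (ℚₚ.toℚᵘ-mono-≤ p) (ℚᵘₚ.≤-reflexive (toℚᵘ-toℚ y)))
... | ℚᵘ.*≤* q = subst₂ ℤ._≤_ (ℤₚ.*-identityʳ x) (ℤₚ.*-identityʳ y) q

toℚ-injective : ∀ {x y} → toℚ x ≡ toℚ y → x ≡ y
toℚ-injective p = ℤₚ.≤-antisym (toℚ-cancel-≤ (ℚₚ.≤-reflexive p)) (toℚ-cancel-≤ (ℚₚ.≤-reflexive (sym p)))

-- Finite sums of rationals

sumℚ-cong : ∀ {k} {f g : Fin k → ℚ} → (∀ i → f i ≡ g i) → sumℚ f ≡ sumℚ g
sumℚ-cong {zero}  p = refl
sumℚ-cong {suc k} p = cong₂ _+ℚ_ (p Fin.zero) (sumℚ-cong (p ∘ Fin.suc))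

sumℚ-zero : ∀ {k} (f : Fin k → ℚ) → (∀ i → f i ≡ 0ℚ) → sumℚ f ≡ 0ℚ
sumℚ-zero {zero}  f p = refl
sumℚ-zero {suc k} f p = cong₂ _+ℚ_ (p Fin.zero) (sumℚ-zero (f ∘ Fin.suc) (p ∘ Fin.suc))

interchangeℚ : ∀ a b c d → a +ℚ b +ℚ (c +ℚ d) ≡ a +ℚ c +ℚ (b +ℚ d)
interchangeℚ = solveℚ 4 (λ a b c d → a :+ b :+ (c :+ d) := a :+ c :+ (b :+ d)) refl

sumℚ-+ : ∀ {k} (f g : Fin k → ℚ) → sumℚ (λ i → f i +ℚ g i) ≡ sumℚ f +ℚ sumℚ g
sumℚ-+ {zero}  f g = refl
sumℚ-+ {suc k} f g = trans (cong (f Fin.zero +ℚ g Fin.zero +ℚ_) (sumℚ-+ (f ∘ Fin.suc) (g ∘ Fin.suc)))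
  (interchangeℚ (f Fin.zero) (g Fin.zero) _ _)

sumℚ-* : ∀ {k} c (f : Fin k → ℚ) → sumℚ (λ i → c *ℚ f i) ≡ c *ℚ sumℚ f
sumℚ-* {zero}  c f = sym (ℚₚ.*-zeroʳ c)
sumℚ-* {suc k} c f = trans (cong (c *ℚ f Fin.zero +ℚ_) (sumℚ-* c (f ∘ Fin.suc)))
  (sym (ℚₚ.*-distribˡ-+ c (f Fin.zero) _))

sumℚ-*ʳ : ∀ {k} (f : Fin k → ℚ) c → sumℚ (λ i → f i *ℚ c) ≡ sumℚ f *ℚ c
sumℚ-*ʳ f c = trans (sumℚ-cong (λ i → ℚₚ.*-comm (f i) c)) (trans (sumℚ-* c f) (ℚₚ.*-comm c (sumℚ f)))

sumℚ-neg : ∀ {k} (f : Fin k → ℚ) → sumℚ (λ i → -ℚ f i) ≡ -ℚ sumℚ f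
sumℚ-neg {zero}  f = refl
sumℚ-neg {suc k} f = trans (cong (-ℚ f Fin.zero +ℚ_) (sumℚ-neg (f ∘ Fin.suc)))
  (sym (ℚₚ.neg-distrib-+ (f Fin.zero) _))

sumℚ-minus : ∀ {k} (f g : Fin k → ℚ) → sumℚ (λ i → f i -ℚ g i) ≡ sumℚ f -ℚ sumℚ g
sumℚ-minus f g = trans (sumℚ-+ f (λ i → -ℚ g i)) (cong (sumℚ f +ℚ_) (sumℚ-neg g))

sumℚ-swap : ∀ {k l} (f : Fin k → Fin l → ℚ) →
  sumℚ (λ i → sumℚ (f i)) ≡ sumℚ (λ j → sumℚ (λ i → f i j))
sumℚ-swap {zero}  {l} f = sym (sumℚ-zero {l} _ (λ _ → refl))
sumℚ-swap {suc k} f = trans (cong (sumℚ (f Fin.zero) +ℚ_) (sumℚ-swap (f ∘ Fin.suc)))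
  (sym (sumℚ-+ (f Fin.zero) _))

sumℚ-≤ : ∀ {k} {f g : Fin k → ℚ} → (∀ i → f i ℚ.≤ g i) → sumℚ f ℚ.≤ sumℚ g
sumℚ-≤ {zero}  p = ℚₚ.≤-refl
sumℚ-≤ {suc k} p = ℚₚ.+-mono-≤ (p Fin.zero) (sumℚ-≤ (p ∘ Fin.suc))

sumℚ-toℚ : ∀ {k} (f : Fin k → ℤ) → sumℚ (toℚ ∘ f) ≡ toℚ (sumℤ f)
sumℚ-toℚ {zero}  f = refl
sumℚ-toℚ {suc k} f = trans (cong (toℚ (f Fin.zero) +ℚ_) (sumℚ-toℚ (f ∘ Fin.suc))) (sym (toℚ-+ (f Fin.zero) _))

sumℚ-split : ∀ p {q} (f : Fin (p + q) → ℚ) → sumℚ f ≡ sumℚ (λ i → f (i ↑ˡ q)) +ℚ sumℚ (λ j → f (p ↑ʳ j))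
sumℚ-split zero    f = sym (ℚₚ.+-identityˡ _)
sumℚ-split (suc p) f = trans (cong (f Fin.zero +ℚ_) (sumℚ-split p (f ∘ Fin.suc)))
  (sym (ℚₚ.+-assoc (f Fin.zero) _ _))

e-≢ : ∀ {k} (j i : Fin k) → j ≢ i → e j i ≡ 0ℚ
e-≢ j i j≢i = cong (if_then 1ℚ else 0ℚ) (dec-false (j Fin.≟ i) j≢i)

eᶻ : ∀ {k} → Fin k → Fin k → ℤ
eᶻ j i = if does (j Fin.≟ i) then + 1 else + 0

toℚ-eᶻ : ∀ {k} (j i : Fin k) → toℚ (eᶻ j i) ≡ e j i
toℚ-eᶻ j i with does (j Fin.≟ i)
... | true  = refl
... | false = refl

sumℚ-e : ∀ {k} (j : Fin k) (f : Fin k → ℚ) → sumℚ (λ i → e j i *ℚ f i) ≡ f j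
sumℚ-e Fin.zero f = trans (cong₂ _+ℚ_ (ℚₚ.*-identityˡ (f Fin.zero))
    (sumℚ-zero _ (λ i → ℚₚ.*-zeroˡ (f (Fin.suc i))))) (ℚₚ.+-identityʳ (f Fin.zero))
sumℚ-e (Fin.suc j) f = trans (cong₂ _+ℚ_ (ℚₚ.*-zeroˡ (f Fin.zero)) (sumℚ-e j (f ∘ Fin.suc))) (ℚₚ.+-identityˡ _)

sumℚ-e₁ : ∀ {k} (j : Fin k) → sumℚ (e j) ≡ 1ℚ
sumℚ-e₁ j = trans (sumℚ-cong (λ i → sym (ℚₚ.*-identityʳ (e j i)))) (sumℚ-e j (λ _ → 1ℚ))

e-nonNeg : ∀ {k} (j i : Fin k) → 0ℚ ℚ.≤ e j i
e-nonNeg j i with does (j Fin.≟ i)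
... | true  = ℚₚ.nonNegative⁻¹ 1ℚ
... | false = ℚₚ.≤-refl

+ℚ-nonNeg : ∀ {x y} → 0ℚ ℚ.≤ x → 0ℚ ℚ.≤ y → 0ℚ ℚ.≤ x +ℚ y
+ℚ-nonNeg p q = ℚₚ.+-mono-≤ p q

*ℚ-monoˡ : ∀ {c x y} → 0ℚ ℚ.≤ c → x ℚ.≤ y → c *ℚ x ℚ.≤ c *ℚ y
*ℚ-monoˡ {c} p q = ℚₚ.*-monoˡ-≤-nonNeg c {{ℚ.nonNegative p}} q

*ℚ-nonNeg : ∀ {x y} → 0ℚ ℚ.≤ x → 0ℚ ℚ.≤ y → 0ℚ ℚ.≤ x *ℚ y
*ℚ-nonNeg {x} {y} p q = subst (ℚ._≤ x *ℚ y) (ℚₚ.*-zeroʳ x) (*ℚ-monoˡ p q)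

-- Nonnegative combinations of total weight M

negᵖ : ∀ {n} → Pt n → Pt n
negᵖ x i = -ℚ x i

-- For M = 1ℚ this unfolds to `InConvHull p`, so members of the polytope serve as combinations of
-- weight 1 without conversion.
Cone : ∀ {m n} → (Fin m → Pt n) → ℚ → Pt n → Set
Cone {m} p M x = Σ (Fin m → ℚ) λ λs → (∀ j → 0ℚ ℚ.≤ λs j) × sumℚ λs ≡ M × lincomb λs p ≐ x

module Cones {m n : ℕ} (p : Fin m → Pt n) where

  cone-resp : ∀ {M M′ x x′} → M ≡ M′ → x ≐ x′ → Cone p M x → Cone p M′ x′
  cone-resp q r (λs , nn , s , l) = λs , nn , trans s q , (λ i → trans (l i) (r i))

  cone-zero : Cone p 0ℚ (λ _ → 0ℚ)
  cone-zero = (λ _ → 0ℚ) , (λ _ → ℚₚ.≤-refl) , sumℚ-zero {m} _ (λ _ → refl) ,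
      (λ i → sumℚ-zero _ (λ j → ℚₚ.*-zeroˡ (p j i)))

  cone-+ : ∀ {M M′ x x′} → Cone p M x → Cone p M′ x′ → Cone p (M +ℚ M′) (λ i → x i +ℚ x′ i)
  cone-+ (λs , nn , s , l) (λs′ , nn′ , s′ , l′) =
    (λ j → λs j +ℚ λs′ j) , (λ j → +ℚ-nonNeg (nn j) (nn′ j)) , trans (sumℚ-+ λs λs′) (cong₂ _+ℚ_ s s′)
    , (λ i → trans (sumℚ-cong (λ j → ℚₚ.*-distribʳ-+ (p j i) (λs j) (λs′ j)))
        (trans (sumℚ-+ (λ j → λs j *ℚ p j i) (λ j → λs′ j *ℚ p j i)) (cong₂ _+ℚ_ (l i) (l′ i))))

  cone-* : ∀ {M x} c → 0ℚ ℚ.≤ c → Cone p M x → Cone p (c *ℚ M) (λ i → c *ℚ x i)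
  cone-* c c≥0 (λs , nn , s , l) =
    (λ j → c *ℚ λs j) , (λ j → *ℚ-nonNeg c≥0 (nn j)) , trans (sumℚ-* c λs) (cong (c *ℚ_) s)
    , (λ i → trans (sumℚ-cong (λ j → ℚₚ.*-assoc c (λs j) (p j i)))
        (trans (sumℚ-* c (λ j → λs j *ℚ p j i)) (cong (c *ℚ_) (l i))))

  cone-gen : ∀ j → Cone p 1ℚ (p j)
  cone-gen j = e j , e-nonNeg j , sumℚ-e₁ j , (λ i → sumℚ-e j (λ k → p k i))

  cone-lincomb : ∀ {k} (μ : Fin k → ℚ) (q : Fin k → Pt n) → (∀ i → 0ℚ ℚ.≤ μ i) → (∀ i → Cone p 1ℚ (q i)) →
    Cone p (sumℚ μ) (lincomb μ q)
  cone-lincomb {zero}  μ q nn c = cone-zero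
  cone-lincomb {suc k} μ q nn c = cone-+
    (cone-resp (ℚₚ.*-identityʳ (μ Fin.zero)) (λ _ → refl) (cone-* (μ Fin.zero) (nn Fin.zero) (c Fin.zero)))
    (cone-lincomb (μ ∘ Fin.suc) (q ∘ Fin.suc) (nn ∘ Fin.suc) (c ∘ Fin.suc))

  cone-neg : (∀ j → Cone p 1ℚ (negᵖ (p j))) → ∀ {M x} → Cone p M x → Cone p M (negᵖ x)
  cone-neg c {M} {x} (λs , nn , s , l) = cone-resp s
    (λ i → trans (sumℚ-cong (λ j → sym (ℚₚ.neg-distribʳ-* (λs j) (p j i))))
        (trans (sumℚ-neg (λ j → λs j *ℚ p j i)) (cong -ℚ_ (l i))))
    (cone-lincomb λs (λ j → negᵖ (p j)) nn c)

  -- Weak duality: the value at x is a nonnegative combination, of total weight M, of the values at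
  -- the generators.
  cone-bound : (s : Fin n → ℚ) (c : ℚ) → (∀ j → sumℚ (λ i → s i *ℚ p j i) ℚ.≤ c) →
    ∀ {M x} → Cone p M x → sumℚ (λ i → s i *ℚ x i) ℚ.≤ M *ℚ c
  cone-bound s c b {M} {x} (λs , nn , sum≡ , l) = subst₂ ℚ._≤_ eq (trans (sumℚ-*ʳ λs c) (cong (_*ℚ c) sum≡))
    (sumℚ-≤ (λ j → *ℚ-monoˡ (nn j) (b j)))
    where
    eq : sumℚ (λ j → λs j *ℚ sumℚ (λ i → s i *ℚ p j i)) ≡ sumℚ (λ i → s i *ℚ x i)
    eq = trans (sumℚ-cong (λ j → sym (sumℚ-* (λs j) (λ i → s i *ℚ p j i))))
      (trans (sumℚ-swap (λ j i → λs j *ℚ (s i *ℚ p j i)))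
      (sumℚ-cong (λ i → trans (sumℚ-cong (λ j → left-comm (λs j) (s i) (p j i)))
        (trans (sumℚ-* (s i) (λ j → λs j *ℚ p j i)) (cong (s i *ℚ_) (l i))))))
      where
      left-comm : ∀ a b c → a *ℚ (b *ℚ c) ≡ b *ℚ (a *ℚ c)
      left-comm = solveℚ 3 (λ a b c → a :* (b :* c) := b :* (a :* c)) refl

-- Functions on Fin (p + q)

Fin-elim : ∀ p {q} {Q : Fin (p + q) → Set} → (∀ i → Q (i ↑ˡ q)) → (∀ j → Q (p ↑ʳ j)) → ∀ k → Q k
Fin-elim zero    f g k           = g k
Fin-elim (suc p) f g Fin.zero    = f Fin.zero
Fin-elim (suc p) f g (Fin.suc k) = Fin-elim p (f ∘ Fin.suc) g k

glue : ∀ {A : Set} {p q} → (Fin p → A) → (Fin q → A) → Fin (p + q) → A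
glue {p = p} f g k = [ f , g ]′ (Fin.splitAt p k)

glue-ˡ : ∀ {A : Set} {p q} (f : Fin p → A) (g : Fin q → A) i → glue f g (i ↑ˡ q) ≡ f i
glue-ˡ {p = p} {q} f g i = cong [ f , g ]′ (Finₚ.splitAt-↑ˡ p i q)

glue-ʳ : ∀ {A : Set} {p q} (f : Fin p → A) (g : Fin q → A) j → glue f g (p ↑ʳ j) ≡ g j
glue-ʳ {p = p} {q} f g j = cong [ f , g ]′ (Finₚ.splitAt-↑ʳ p q j)

e-ˡˡ : ∀ {p} q (i i′ : Fin p) → e (i ↑ˡ q) (i′ ↑ˡ q) ≡ e i i′
e-ˡˡ q Fin.zero    Fin.zero     = refl
e-ˡˡ q Fin.zero    (Fin.suc i′) = refl
e-ˡˡ q (Fin.suc i) Fin.zero     = refl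
e-ˡˡ q (Fin.suc i) (Fin.suc i′) = e-ˡˡ q i i′

e-ˡʳ : ∀ p q (i : Fin p) (j : Fin q) → e (i ↑ˡ q) (p ↑ʳ j) ≡ 0ℚ
e-ˡʳ (suc p) q Fin.zero    j = refl
e-ˡʳ (suc p) q (Fin.suc i) j = e-ˡʳ p q i j

e-ʳˡ : ∀ p q (i : Fin p) (j : Fin q) → e (p ↑ʳ j) (i ↑ˡ q) ≡ 0ℚ
e-ʳˡ (suc p) q Fin.zero    j = refl
e-ʳˡ (suc p) q (Fin.suc i) j = e-ʳˡ p q i j

e-ʳʳ : ∀ p {q} (j j′ : Fin q) → e (p ↑ʳ j) (p ↑ʳ j′) ≡ e j j′
e-ʳʳ zero    j j′ = refl
e-ʳʳ (suc p) j j′ = e-ʳʳ p j j′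

take-one : ∀ {p} (α : Fin p → ℕ) {u} → sumℕ α ≡ suc u →
  Σ (Fin p) λ i → Σ (Fin p → ℕ) λ α′ → sumℕ α′ ≡ u × (∀ k → toℚ (+ α k) ≡ e i k +ℚ toℚ (+ α′ k))
take-one {suc p} α {u} s = cases (α Fin.zero) refl
  where
  cases : ∀ a → α Fin.zero ≡ a →
    Σ (Fin (suc p)) λ i → Σ (Fin (suc p) → ℕ) λ α′ → sumℕ α′ ≡ u × (∀ k → toℚ (+ α k) ≡ e i k +ℚ toℚ (+ α′ k))
  cases zero eq with take-one (α ∘ Fin.suc) {u} (trans (cong (_+ sumℕ (α ∘ Fin.suc)) (sym eq)) s)
  ... | i , α′ , s′ , r = Fin.suc i , (λ { Fin.zero → 0 ; (Fin.suc k) → α′ k }) , s′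
    , (λ { Fin.zero → cong (toℚ ∘ +_) eq ; (Fin.suc k) → r k })
  cases (suc a) eq = Fin.zero , (λ { Fin.zero → a ; (Fin.suc k) → α (Fin.suc k) })
    , ℕₚ.suc-injective (trans (cong (_+ sumℕ (α ∘ Fin.suc)) (sym eq)) s)
    , (λ { Fin.zero → trans (cong (toℚ ∘ +_) eq) (toℚ-+ (+ 1) (+ a)) ; (Fin.suc k) → sym (ℚₚ.+-identityˡ _) })

sumℕ≡0 : ∀ {p} (α : Fin p → ℕ) → sumℕ α ≡ 0 → ∀ k → α k ≡ 0
sumℕ≡0 α s Fin.zero    = ℕₚ.m+n≡0⇒m≡0 (α Fin.zero) s
sumℕ≡0 α s (Fin.suc k) = sumℕ≡0 (α ∘ Fin.suc) (ℕₚ.m+n≡0⇒n≡0 (α Fin.zero) s) k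

-- Generators of symmetric edge polytopes

sepGens-∈ : ∀ {n} (E : List (Fin n × Fin n)) v w → (v , w) ∈ˡ E →
  (e v -ᵖ e w) ∈ˡ sepGens E × (e w -ᵖ e v) ∈ˡ sepGens E
sepGens-∈ (_ ∷ E) v w (Any.here refl) = Any.here refl , Any.there (Any.here refl)
sepGens-∈ (_ ∷ E) v w (Any.there p)   =
  let q , r = sepGens-∈ E v w p in Any.there (Any.there q) , Any.there (Any.there r)

sepGens-cases : ∀ {n} (E : List (Fin n × Fin n)) {x} → x ∈ˡ sepGens E →
  Σ (Fin n) λ v → Σ (Fin n) λ w → (v , w) ∈ˡ E × (x ≡ (e v -ᵖ e w) ⊎ x ≡ (e w -ᵖ e v))
sepGens-cases ((v , w) ∷ E) (Any.here p)             = v , w , Any.here refl , inj₁ p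
sepGens-cases ((v , w) ∷ E) (Any.there (Any.here p)) = v , w , Any.here refl , inj₂ p
sepGens-cases ((v , w) ∷ E) (Any.there (Any.there p)) =
  let v′ , w′ , q , r = sepGens-cases E p in v′ , w′ , Any.there q , r

module Bipartite (a b : ℕ) where

  dim : ℕ
  dim = suc a + suc b

  left : Fin (suc a) → Fin dim
  left i = i ↑ˡ suc b

  right : Fin (suc b) → Fin dim
  right j = suc a ↑ʳ j

  pair : Fin (suc a) → Fin (suc b) → Fin dim × Fin dim
  pair i j = left i , right j

  record IsComplete (E : List (Fin dim × Fin dim)) : Set where
    field
      edge       : ∀ i j → pair i j ∈ˡ E
      edge-cases : ∀ {vw} → vw ∈ˡ E → Σ (Fin (suc a)) λ i → Σ (Fin (suc b)) λ j → vw ≡ pair i j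

  Kbip-complete : IsComplete (Kbip a b)
  Kbip-complete = record { edge = edge ; edge-cases = edge-cases }
    where
    edgesAt : Fin (suc a) → List (Fin dim × Fin dim)
    edgesAt i = List.map (pair i) (allFin (suc b))
    edge : ∀ i j → pair i j ∈ˡ List.concatMap edgesAt (allFin (suc a))
    edge i j = ∈-concatMap⁺ edgesAt {xs = allFin (suc a)}
      (Any.map (λ { refl → ∈-map⁺ (pair i) (∈-allFin j) }) (∈-allFin i))
    edge-cases : ∀ {vw} → vw ∈ˡ List.concatMap edgesAt (allFin (suc a)) →
      Σ (Fin (suc a)) λ i → Σ (Fin (suc b)) λ j → vw ≡ pair i j
    edge-cases p with Any.satisfied (∈-concatMap⁻ edgesAt {xs = allFin (suc a)} p)
    ... | i , q with ∈-map⁻ (pair i) q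
    ...   | j , _ , r = i , j , r

-- P depends only on the set of edges, so E is any enumeration of the edges of K_{a+1,b+1}.

module Polytope (a b : ℕ) (E : List (Fin (suc a + suc b) × Fin (suc a + suc b)))
  (complete : Bipartite.IsComplete a b E) where

  open Bipartite a b public using (dim; left; right; pair)
  open Bipartite.IsComplete complete

  gens : List (Pt dim)
  gens = sepGens (E)

  vertex : Fin (length gens) → Pt dim
  vertex = List.lookup gens

  open Cones vertex

  P : Pt dim → Set
  P = InSEP (E)

  gen⁺ gen⁻ : Fin (suc a) → Fin (suc b) → Pt dim
  gen⁺ i j = e (left i) -ᵖ e (right j)
  gen⁻ i j = e (right j) -ᵖ e (left i)

  cone-∈ : ∀ {x} → x ∈ˡ gens → Cone vertex 1ℚ x
  cone-∈ p = cone-resp refl (λ i → cong (λ x → x i) (sym (Anyₚ.lookup-index p))) (cone-gen (Any.index p))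

  cone-gen⁺ : ∀ i j → Cone vertex 1ℚ (gen⁺ i j)
  cone-gen⁺ i j = cone-∈ (proj₁ (sepGens-∈ E (left i) (right j) (edge i j)))

  cone-gen⁻ : ∀ i j → Cone vertex 1ℚ (gen⁻ i j)
  cone-gen⁻ i j = cone-∈ (proj₂ (sepGens-∈ E (left i) (right j) (edge i j)))

  vertex-cases : ∀ k → Σ (Fin (suc a)) λ i → Σ (Fin (suc b)) λ j → vertex k ≡ gen⁺ i j ⊎ vertex k ≡ gen⁻ i j
  vertex-cases k with sepGens-cases E (∈-lookup {xs = gens} k)
  ... | v , w , p , c with edge-cases p
  ...   | i , j , refl = i , j , c

  negᵖ-minus : ∀ (x y : Pt dim) k → (y -ᵖ x) k ≡ negᵖ (x -ᵖ y) k
  negᵖ-minus x y k = solveℚ 2 (λ x y → y :- x := :- (x :- y)) refl (x k) (y k)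

  symmetric : ∀ {M x} → Cone vertex M x → Cone vertex M (negᵖ x)
  symmetric = cone-neg opposite
    where
    opposite : ∀ k → Cone vertex 1ℚ (negᵖ (vertex k))
    opposite k with vertex-cases k
    ... | i , j , inj₁ q = cone-resp refl
      (λ l → trans (negᵖ-minus (e (left i)) (e (right j)) l) (cong (λ x → -ℚ x l) (sym q))) (cone-gen⁻ i j)
    ... | i , j , inj₂ q = cone-resp refl
      (λ l → trans (negᵖ-minus (e (right j)) (e (left i)) l) (cong (λ x → -ℚ x l) (sym q))) (cone-gen⁺ i j)

  -- The functional takes the value s v - s w at e v - e w, so it only has to be tested on the edges
  -- in both directions.
  functional-bound : (s : Fin dim → ℚ) (c : ℚ) →
    (∀ i j → s (left i) -ℚ s (right j) ℚ.≤ c) → (∀ i j → s (right j) -ℚ s (left i) ℚ.≤ c) →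
    ∀ {M x} → Cone vertex M x → sumℚ (λ k → s k *ℚ x k) ℚ.≤ M *ℚ c
  functional-bound s c b₁ b₂ = cone-bound s c bound
    where
    pairing : ∀ v w → sumℚ (λ k → s k *ℚ (e v -ᵖ e w) k) ≡ s v -ℚ s w
    pairing v w = trans (sumℚ-cong (λ k → distrib (s k) (e v k) (e w k)))
      (trans (sumℚ-minus (λ k → e v k *ℚ s k) (λ k → e w k *ℚ s k)) (cong₂ _-ℚ_ (sumℚ-e v s) (sumℚ-e w s)))
      where
      distrib : ∀ s x y → s *ℚ (x -ℚ y) ≡ x *ℚ s -ℚ y *ℚ s
      distrib = solveℚ 3 (λ s x y → s :* (x :- y) := x :* s :- y :* s) refl
    bound : ∀ j → sumℚ (λ k → s k *ℚ vertex j k) ℚ.≤ c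
    bound k with vertex-cases k
    ... | i , j , inj₁ q = subst (ℚ._≤ c) (sym (trans (sumℚ-cong (λ l → cong (λ x → s l *ℚ x l) q))
        (pairing (left i) (right j)))) (b₁ i j)
    ... | i , j , inj₂ q = subst (ℚ._≤ c) (sym (trans (sumℚ-cong (λ l → cong (λ x → s l *ℚ x l) q))
        (pairing (right j) (left i)))) (b₂ i j)

  -- The origin is the midpoint of two opposite generators, so any weight can be spent there.
  cone-origin : ∀ c → 0ℚ ℚ.≤ c → Cone vertex c (λ _ → 0ℚ)
  cone-origin c c≥0 = cone-resp (halves c) (λ i → cancel (c *ℚ ½) (gen⁺ Fin.zero Fin.zero i))
    (cone-+ (cone-* (c *ℚ ½) c½≥0 (cone-gen⁺ Fin.zero Fin.zero))
        (cone-* (c *ℚ ½) c½≥0 (symmetric (cone-gen⁺ Fin.zero Fin.zero))))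
    where
    c½≥0 : 0ℚ ℚ.≤ c *ℚ ½
    c½≥0 = *ℚ-nonNeg c≥0 (ℚₚ.nonNegative⁻¹ ½)
    halves : ∀ c → c *ℚ ½ *ℚ 1ℚ +ℚ c *ℚ ½ *ℚ 1ℚ ≡ c
    halves = solveℚ 1 (λ c → c :* con ½ :* con 1ℚ :+ c :* con ½ :* con 1ℚ := c) refl
    cancel : ∀ c x → c *ℚ x +ℚ c *ℚ (-ℚ x) ≡ 0ℚ
    cancel = solveℚ 2 (λ c x → c :* x :+ c :* (:- x) := con 0ℚ) refl

  cone-pad : ∀ {M x} → M ℚ.≤ 1ℚ → Cone vertex M x → P x
  cone-pad {M} {x} M≤1 c = cone-resp (fill M) (λ i → ℚₚ.+-identityʳ (x i))
    (cone-+ c (cone-origin (1ℚ -ℚ M) (subst (ℚ._≤ 1ℚ -ℚ M) (ℚₚ.+-inverseʳ M) (ℚₚ.+-monoˡ-≤ (-ℚ M) M≤1))))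
    where
    fill : ∀ M → M +ℚ (1ℚ -ℚ M) ≡ 1ℚ
    fill = solveℚ 1 (λ M → M :+ (con 1ℚ :- M) := con 1ℚ) refl

  -- A transportation problem: one unit of α at i and one of β at j are removed together with the
  -- generator e i - e j, which is available for all i and j because the bipartite graph is
  -- complete.
  transport : ∀ u (α : Fin (suc a) → ℕ) (β : Fin (suc b) → ℕ) → sumℕ α ≡ u → sumℕ β ≡ u →
    Cone vertex (toℚ (+ u)) (glue (λ i → toℚ (+ α i)) (λ j → -ℚ toℚ (+ β j)))
  transport zero α β p q = cone-resp refl (Fin-elim (suc a) {Q = λ k → 0ℚ ≡ glue x y k}
    (λ i → sym (trans (glue-ˡ x y i) (cong (toℚ ∘ +_) (sumℕ≡0 α p i))))
    (λ j → sym (trans (glue-ʳ x y j) (cong (λ n → -ℚ toℚ (+ n)) (sumℕ≡0 β q j)))))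
    cone-zero
    where
    x : Fin (suc a) → ℚ
    x i = toℚ (+ α i)
    y : Fin (suc b) → ℚ
    y j = -ℚ toℚ (+ β j)
  transport (suc u) α β p q =
    cone-resp (sym (toℚ-+ (+ 1) (+ u))) (Fin-elim (suc a) {Q = λ k → gen⁺ i j k +ℚ glue x′ y′ k ≡ glue x y k}
      (λ i′ → trans (cong₂ _+ℚ_ (cong₂ _-ℚ_ (e-ˡˡ (suc b) i i′) (e-ʳˡ (suc a) (suc b) i′ j)) (glue-ˡ x′ y′ i′))
        (trans (plus (e i i′) (x′ i′)) (trans (sym (proj₂ (proj₂ (proj₂ α-step)) i′)) (sym (glue-ˡ x y i′)))))
      (λ j′ → trans (cong₂ _+ℚ_ (cong₂ _-ℚ_ (e-ˡʳ (suc a) (suc b) i j′) (e-ʳʳ (suc a) j j′)) (glue-ʳ x′ y′ j′))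
        (trans (minus (e j j′) (toℚ (+ β′ j′))) (trans (cong -ℚ_ (sym (proj₂ (proj₂ (proj₂ β-step)) j′)))
            (sym (glue-ʳ x y j′))))))
    (cone-+ (cone-gen⁺ i j) (transport u α′ β′ (proj₁ (proj₂ (proj₂ α-step))) (proj₁ (proj₂ (proj₂ β-step)))))
    where
    α-step : Σ (Fin (suc a)) λ i → Σ (Fin (suc a) → ℕ) λ α′ → sumℕ α′ ≡ u × (∀ k → toℚ (+ α k) ≡ e i k +ℚ toℚ (+ α′ k))
    α-step = take-one α p
    β-step : Σ (Fin (suc b)) λ j → Σ (Fin (suc b) → ℕ) λ β′ → sumℕ β′ ≡ u × (∀ k → toℚ (+ β k) ≡ e j k +ℚ toℚ (+ β′ k))
    β-step = take-one β q
    i : Fin (suc a)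
    i = proj₁ α-step
    j : Fin (suc b)
    j = proj₁ β-step
    α′ : Fin (suc a) → ℕ
    α′ = proj₁ (proj₂ α-step)
    β′ : Fin (suc b) → ℕ
    β′ = proj₁ (proj₂ β-step)
    x x′ : Fin (suc a) → ℚ
    x  k = toℚ (+ α k)
    x′ k = toℚ (+ α′ k)
    y y′ : Fin (suc b) → ℚ
    y  k = -ℚ toℚ (+ β k)
    y′ k = -ℚ toℚ (+ β′ k)
    plus : ∀ x y → x -ℚ 0ℚ +ℚ y ≡ x +ℚ y
    plus = solveℚ 2 (λ x y → x :- con 0ℚ :+ y := x :+ y) refl
    minus : ∀ x y → 0ℚ -ℚ x +ℚ (-ℚ y) ≡ -ℚ (x +ℚ y)
    minus = solveℚ 2 (λ x y → con 0ℚ :- x :+ :- y := :- (x :+ y)) refl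

-- Supporting functionals and the boundary of `P`.

sgn : ℤ → ℤ
sgn (+ _)    = + 1
sgn -[1+ _ ] = ℤ.- (+ 1)

sgn-* : ∀ z → sgn z *ᶻ z ≡ + ℤ.∣ z ∣
sgn-* (+ n)    = ℤₚ.*-identityˡ (+ n)
sgn-* -[1+ n ] = ℤₚ.-1*i≡-i -[1+ n ]

sgn-≤1 : ∀ z → toℚ (sgn z) ℚ.≤ 1ℚ
sgn-≤1 (+ _)    = ℚₚ.≤-refl
sgn-≤1 -[1+ _ ] = toℚ-mono-≤ {ℤ.- (+ 1)} {+ 1} ℤ.-≤+

-sgn-≤1 : ∀ z → -ℚ toℚ (sgn z) ℚ.≤ 1ℚ
-sgn-≤1 (+ _)    = toℚ-mono-≤ {ℤ.- (+ 1)} {+ 1} ℤ.-≤+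
-sgn-≤1 -[1+ _ ] = ℚₚ.≤-refl

sumℕ-toℚ : ∀ {k} (f : Fin k → ℕ) → sumℚ (λ i → toℚ (+ f i)) ≡ toℚ (+ sumℕ f)
sumℕ-toℚ {zero}  f = refl
sumℕ-toℚ {suc k} f = trans (cong (toℚ (+ f Fin.zero) +ℚ_) (sumℕ-toℚ (f ∘ Fin.suc)))
    (sym (toℚ-+ (+ f Fin.zero) (+ sumℕ (f ∘ Fin.suc))))

sumℤ-neg : ∀ {k} (z : Fin k → ℤ) → sumℤ (λ i → ℤ.- z i) ≡ ℤ.- sumℤ z
sumℤ-neg {zero}  z = refl
sumℤ-neg {suc k} z = trans (cong (ℤ.- z Fin.zero +ᶻ_) (sumℤ-neg (z ∘ Fin.suc))) (sym (ℤₚ.neg-distrib-+ (z Fin.zero) _))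

module Reciprocal (N′ : ℕ) where

  Nℚ : ℚ
  Nℚ = toℚ (+ suc N′)

  instance
    Nℚ-pos : ℚ.Positive Nℚ
    Nℚ-pos = ℚₚ.normalize-pos (suc N′) 1

    Nℚ-nonZero : ℚ.NonZero Nℚ
    Nℚ-nonZero = ℚₚ.pos⇒nonZero Nℚ

  ν : ℚ
  ν = ℚ.1/ Nℚ

  instance
    ν-pos : ℚ.Positive ν
    ν-pos = ℚₚ.1/pos⇒pos Nℚ

  N*ν : Nℚ *ℚ ν ≡ 1ℚ
  N*ν = ℚₚ.*-inverseʳ Nℚ

  0<ν : 0ℚ ℚ.< ν
  0<ν = ℚₚ.positive⁻¹ ν

  0≤ν : 0ℚ ℚ.≤ ν
  0≤ν = ℚₚ.<⇒≤ 0<ν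

  cancel-ν : ∀ x y → toℚ x *ℚ ν ℚ.≤ toℚ y *ℚ ν → x ℤ.≤ y
  cancel-ν x y p = toℚ-cancel-≤ (ℚₚ.*-cancelʳ-≤-pos ν p)

  unscale : ∀ z → Nℚ *ℚ (toℚ z *ℚ ν) ≡ toℚ z
  unscale z = trans (rotate Nℚ (toℚ z) ν) (trans (cong (toℚ z *ℚ_) N*ν) (ℚₚ.*-identityʳ (toℚ z)))
    where
    rotate : ∀ N x ν → N *ℚ (x *ℚ ν) ≡ x *ℚ (N *ℚ ν)
    rotate = solveℚ 3 (λ N x ν → N :* (x :* ν) := x :* (N :* ν)) refl

  -- The triangulated set is the boundary of `P` itself, so a lattice point z of the N-th dilate
  -- enters as z/N.
  scaled : ∀ {n} → (Fin n → ℤ) → Pt n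
  scaled z k = toℚ (z k) *ℚ ν

module Boundaries (a b : ℕ) (E : List (Fin (suc a + suc b) × Fin (suc a + suc b)))
  (complete : Bipartite.IsComplete a b E) where

  open Polytope a b E complete
  open Cones vertex

  norm-left norm-right : (Fin dim → ℤ) → ℕ
  norm-left  z = sumℕ (λ i → ℤ.∣ z (left i) ∣)
  norm-right z = sumℕ (λ j → ℤ.∣ z (right j) ∣)

  sum-glue : ∀ (f : Fin (suc a) → ℚ) (g : Fin (suc b) → ℚ) (x : Pt dim) →
    sumℚ (λ k → glue f g k *ℚ x k) ≡ sumℚ (λ i → f i *ℚ x (left i)) +ℚ sumℚ (λ j → g j *ℚ x (right j))
  sum-glue f g x = trans (sumℚ-split (suc a) (λ k → glue f g k *ℚ x k))
    (cong₂ _+ℚ_ (sumℚ-cong (λ i → cong (_*ℚ x (left i)) (glue-ˡ f g i)))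
                (sumℚ-cong (λ j → cong (_*ℚ x (right j)) (glue-ʳ f g j))))

  abs-sum : ∀ {k} (z : Fin k → ℤ) t → sumℚ (λ i → toℚ (sgn (z i)) *ℚ (toℚ (z i) *ℚ t)) ≡ toℚ
      (+ sumℕ (λ i → ℤ.∣ z i ∣)) *ℚ t
  abs-sum z t = trans (sumℚ-cong (λ i → trans (sym (ℚₚ.*-assoc (toℚ (sgn (z i))) (toℚ (z i)) t))
      (cong (_*ℚ t) (trans (sym (toℚ-* (sgn (z i)) (z i))) (cong toℚ (sgn-* (z i)))))))
    (trans (sumℚ-*ʳ (λ i → toℚ (+ ℤ.∣ z i ∣)) t) (cong (_*ℚ t) (sumℕ-toℚ (λ i → ℤ.∣ z i ∣))))

  x-0 : ∀ x → x ≡ x -ℚ 0ℚ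
  x-0 = solveℚ 1 (λ x → x := x :- con 0ℚ) refl

  0-x : ∀ x → -ℚ x ≡ 0ℚ -ℚ x
  0-x = solveℚ 1 (λ x → :- x := con 0ℚ :- x) refl

  -- The functional is the sign vector of the left half of z, extended by zero: on every generator
  -- it is at most 1, and at z it gives the sum of absolute values of the left half.
  norm-left-bound : ∀ z t {M} → Cone vertex M (λ k → toℚ (z k) *ℚ t) → toℚ (+ norm-left z) *ℚ t ℚ.≤ M
  norm-left-bound z t {M} c = subst₂ ℚ._≤_
    (trans (sum-glue f g (λ k → toℚ (z k) *ℚ t))
      (trans (cong₂ _+ℚ_ (abs-sum (z ∘ left) t) (sumℚ-zero _ (λ j → ℚₚ.*-zeroˡ (toℚ (z (right j)) *ℚ t))))
          (ℚₚ.+-identityʳ _)))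
    (ℚₚ.*-identityʳ M)
    (functional-bound (glue f g) 1ℚ
      (λ i j → subst (ℚ._≤ 1ℚ) (trans (x-0 (f i)) (sym (cong₂ _-ℚ_ (glue-ˡ f g i) (glue-ʳ f g j))))
          (sgn-≤1 (z (left i))))
      (λ i j → subst (ℚ._≤ 1ℚ) (trans (0-x (f i)) (sym (cong₂ _-ℚ_ (glue-ʳ f g j) (glue-ˡ f g i))))
          (-sgn-≤1 (z (left i)))) c)
    where
    f : Fin (suc a) → ℚ
    f i = toℚ (sgn (z (left i)))
    g : Fin (suc b) → ℚ
    g j = 0ℚ

  norm-right-bound : ∀ z t {M} → Cone vertex M (λ k → toℚ (z k) *ℚ t) → toℚ (+ norm-right z) *ℚ t ℚ.≤ M
  norm-right-bound z t {M} c = subst₂ ℚ._≤_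
    (trans (sum-glue f g (λ k → toℚ (z k) *ℚ t))
      (trans (cong₂ _+ℚ_ (sumℚ-zero _ (λ i → ℚₚ.*-zeroˡ (toℚ (z (left i)) *ℚ t))) (abs-sum (z ∘ right) t))
          (ℚₚ.+-identityˡ _)))
    (ℚₚ.*-identityʳ M)
    (functional-bound (glue f g) 1ℚ
      (λ i j → subst (ℚ._≤ 1ℚ) (trans (0-x (g j)) (sym (cong₂ _-ℚ_ (glue-ˡ f g i) (glue-ʳ f g j))))
          (-sgn-≤1 (z (right j))))
      (λ i j → subst (ℚ._≤ 1ℚ) (trans (x-0 (g j)) (sym (cong₂ _-ℚ_ (glue-ʳ f g j) (glue-ˡ f g i))))
          (sgn-≤1 (z (right j)))) c)
    where
    f : Fin (suc a) → ℚ
    f i = 0ℚ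
    g : Fin (suc b) → ℚ
    g j = toℚ (sgn (z (right j)))

  module _ (N′ : ℕ) where

    open Reciprocal N′

    -- The all-ones functional vanishes on every generator; the resulting upper bound 0 is applied
    -- to z and to -z.
    sum-zero : ∀ z {M} → Cone vertex M (scaled z) → sumℤ z ≡ + 0
    sum-zero z {M} c = ℤₚ.≤-antisym (bound {z} c)
      (subst (+ 0 ℤ.≤_) (trans (cong ℤ.-_ (sumℤ-neg z)) (ℤₚ.neg-involutive _))
        (ℤₚ.neg-mono-≤ (bound {λ k → ℤ.- z k} (cone-resp refl
            (λ k → trans (ℚₚ.neg-distribˡ-* (toℚ (z k)) ν) (cong (_*ℚ ν) (sym (toℚ-neg (z k))))) (symmetric c)))))
      where
      bound : ∀ {z : Fin dim → ℤ} {M} → Cone vertex M (scaled z) → sumℤ z ℤ.≤ + 0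
      bound {z} {M} c = cancel-ν (sumℤ z) (+ 0) (subst₂ ℚ._≤_
        (trans (sumℚ-cong (λ k → ℚₚ.*-identityˡ (scaled z k)))
            (trans (sumℚ-*ʳ (toℚ ∘ z) ν) (cong (_*ℚ ν) (sumℚ-toℚ z))))
        (trans (ℚₚ.*-zeroʳ M) (sym (ℚₚ.*-zeroˡ ν)))
        (functional-bound (λ _ → 1ℚ) 0ℚ (λ _ _ → ℚₚ.≤-refl) (λ _ _ → ℚₚ.≤-refl) c))

    norm-left-≤ : ∀ z → P (scaled z) → norm-left z ≤ suc N′
    norm-left-≤ z c = ℤₚ.drop‿+≤+ (cancel-ν (+ norm-left z) (+ suc N′)
      (ℚₚ.≤-trans (norm-left-bound z ν c) (ℚₚ.≤-reflexive (sym N*ν))))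

    norm-right-≤ : ∀ z → P (scaled z) → norm-right z ≤ suc N′
    norm-right-≤ z c = ℤₚ.drop‿+≤+ (cancel-ν (+ norm-right z) (+ suc N′)
      (ℚₚ.≤-trans (norm-right-bound z ν c) (ℚₚ.≤-reflexive (sym N*ν))))

    -- P is symmetric, so a point x of P with a supporting functional is on the boundary:
    -- the segment from -x cannot be prolonged beyond x.
    boundary⁺ : ∀ z → Cone vertex Nℚ (toℚ ∘ z) → norm-left z ≡ suc N′ ⊎ norm-right z ≡ suc N′ →
      Boundary P (scaled z)
    boundary⁺ z c norm = inP , negᵖ (scaled z) , symmetric inP , escape
      where
      inP : P (scaled z)
      inP = cone-resp (trans (ℚₚ.*-comm ν Nℚ) N*ν) (λ k → ℚₚ.*-comm ν (toℚ (z k))) (cone-* ν 0≤ν c)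
      escape : ∀ ε → 0ℚ ℚ.< ε → ¬ P (λ k → scaled z k +ℚ ε *ℚ (scaled z k -ℚ negᵖ (scaled z) k))
      escape ε 0<ε q = ℚₚ.<-irrefl refl (ℚₚ.<-≤-trans 1<t (bounded norm))
        where
        t : ℚ
        -- Prolonging the segment from -x gives x + ε(x + x) = (1 + 2ε)x = tz, and N t = 1 + 2ε
        -- exceeds 1.
        t = ν +ℚ ε *ℚ (ν +ℚ ν)
        regroup : ∀ x ν ε → x *ℚ ν +ℚ ε *ℚ (x *ℚ ν -ℚ -ℚ (x *ℚ ν)) ≡ x *ℚ (ν +ℚ ε *ℚ (ν +ℚ ν))
        regroup = solveℚ 3 (λ x ν ε → x :* ν :+ ε :* (x :* ν :- :- (x :* ν)) := x :* (ν :+ ε :* (ν :+ ν))) refl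
        q′ : Cone vertex 1ℚ (λ k → toℚ (z k) *ℚ t)
        q′ = cone-resp refl (λ k → regroup (toℚ (z k)) ν ε) q
        bounded : norm-left z ≡ suc N′ ⊎ norm-right z ≡ suc N′ → Nℚ *ℚ t ℚ.≤ 1ℚ
        bounded (inj₁ p) = subst (λ m → toℚ (+ m) *ℚ t ℚ.≤ 1ℚ) p (norm-left-bound z t q′)
        bounded (inj₂ p) = subst (λ m → toℚ (+ m) *ℚ t ℚ.≤ 1ℚ) p (norm-right-bound z t q′)
        expand : ∀ n ν ε → n *ℚ (ν +ℚ ε *ℚ (ν +ℚ ν)) ≡ n *ℚ ν +ℚ ε *ℚ (n *ℚ ν +ℚ n *ℚ ν)
        expand = solveℚ 3 (λ n ν ε → n :* (ν :+ ε :* (ν :+ ν)) := n :* ν :+ ε :* (n :* ν :+ n :* ν)) refl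
        double : ∀ ε → 1ℚ +ℚ ε *ℚ (1ℚ +ℚ 1ℚ) ≡ 1ℚ +ℚ (ε +ℚ ε)
        double = solveℚ 1 (λ ε → con 1ℚ :+ ε :* (con 1ℚ :+ con 1ℚ) := con 1ℚ :+ (ε :+ ε)) refl
        1<t : 1ℚ ℚ.< Nℚ *ℚ t
        1<t = subst (1ℚ ℚ.<_) (sym (trans (expand Nℚ ν ε) (trans (cong (λ x → x +ℚ ε *ℚ (x +ℚ x)) N*ν) (double ε))))
          (ℚₚ.+-monoʳ-< 1ℚ (ℚₚ.+-mono-< 0<ε 0<ε))

    -- If z already lies in the smaller dilate K P, then z/N keeps a distance from the boundary that
    -- depends on N alone, so a segment from any y in `P` can be prolonged beyond it.
    boundary⁻ : ∀ z K → K < suc N′ → Cone vertex (toℚ (+ K)) (toℚ ∘ z) → ¬ Boundary P (scaled z)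
    boundary⁻ z K K<N c (_ , y , y∈P , escape) = escape ε 0<ε (cone-pad M≤1
      (cone-resp refl (λ k → regroup (toℚ (z k)) ν ε (y k))
        (cone-+ (cone-* ((1ℚ +ℚ ε) *ℚ ν) (*ℚ-nonNeg (+ℚ-nonNeg (ℚₚ.nonNegative⁻¹ 1ℚ) 0≤ε) 0≤ν) c)
            (cone-* ε 0≤ε (symmetric y∈P)))))
      where
      ε κ slack : ℚ
      -- The prolonged point has weight (1+ε)νK + ε. As νK ≤ 1-ν, this is at most 1 + 2ε - ν - εν,
      -- which for ε = ν/2 equals 1 - εν.
      ε = ν *ℚ ½
      κ = toℚ (+ K)
      slack = 1ℚ -ℚ (1ℚ +ℚ κ) *ℚ ν
      0<ε : 0ℚ ℚ.< ε
      0<ε = subst (ℚ._< ε) (ℚₚ.*-zeroʳ ν) (ℚₚ.*-monoʳ-<-pos ν (ℚₚ.positive⁻¹ ½))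
      0≤ε : 0ℚ ℚ.≤ ε
      0≤ε = ℚₚ.<⇒≤ 0<ε
      0≤slack : 0ℚ ℚ.≤ slack
      0≤slack = subst (ℚ._≤ slack) (ℚₚ.+-inverseʳ ((1ℚ +ℚ κ) *ℚ ν)) (ℚₚ.+-monoˡ-≤ (-ℚ ((1ℚ +ℚ κ) *ℚ ν))
        (subst₂ ℚ._≤_ (cong (_*ℚ ν) (toℚ-+ (+ 1) (+ K))) N*ν
          (ℚₚ.*-monoʳ-≤-nonNeg ν {{ℚₚ.pos⇒nonNeg ν}} (toℚ-mono-≤ (ℤ.+≤+ K<N)))))
      M : ℚ
      M = (1ℚ +ℚ ε) *ℚ ν *ℚ κ +ℚ ε *ℚ 1ℚ
      M-slack : ∀ ν κ → (1ℚ +ℚ ν *ℚ ½) *ℚ ν *ℚ κ +ℚ ν *ℚ ½ *ℚ 1ℚ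
        +ℚ (ν *ℚ ½ *ℚ ν +ℚ (1ℚ +ℚ ν *ℚ ½) *ℚ (1ℚ -ℚ (1ℚ +ℚ κ) *ℚ ν)) ≡ 1ℚ
      M-slack = solveℚ 2 (λ ν κ → (con 1ℚ :+ ν :* con ½) :* ν :* κ :+ ν :* con ½ :* con 1ℚ
        :+ (ν :* con ½ :* ν :+ (con 1ℚ :+ ν :* con ½) :* (con 1ℚ :- (con 1ℚ :+ κ) :* ν)) := con 1ℚ) refl
      M≤1 : M ℚ.≤ 1ℚ
      M≤1 = subst₂ ℚ._≤_ (ℚₚ.+-identityʳ M) (M-slack ν κ) (ℚₚ.+-monoʳ-≤ M
        (+ℚ-nonNeg (*ℚ-nonNeg 0≤ε 0≤ν) (*ℚ-nonNeg (+ℚ-nonNeg (ℚₚ.nonNegative⁻¹ 1ℚ) 0≤ε) 0≤slack)))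
      regroup : ∀ x ν ε y → (1ℚ +ℚ ε) *ℚ ν *ℚ x +ℚ ε *ℚ (-ℚ y) ≡ x *ℚ ν +ℚ ε *ℚ (x *ℚ ν -ℚ y)
      regroup = solveℚ 4 (λ x ν ε y → (con 1ℚ :+ ε) :* ν :* x :+ ε :* (:- y) := x :* ν :+ ε :* (x :* ν :- y)) refl

sumℤ-split : ∀ p {q} (f : Fin (p + q) → ℤ) → sumℤ f ≡ sumℤ (λ i → f (i ↑ˡ q)) +ᶻ sumℤ (λ j → f (p ↑ʳ j))
sumℤ-split zero    f = sym (ℤₚ.+-identityˡ _)
sumℤ-split (suc p) f = trans (cong (f Fin.zero +ᶻ_) (sumℤ-split p (f ∘ Fin.suc))) (sym (ℤₚ.+-assoc (f Fin.zero) _ _))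

-- Integer points with given total positive and negative part

ext : ∀ {a} → ℕ → ℕ → Vec ℤ a → Fin (suc a) → ℤ
ext u v x Fin.zero    = (+ u ℤ.- + posSum x) ℤ.- (+ v ℤ.- + negSum x)
ext u v x (Fin.suc i) = Vec.lookup x i

-- ext u v x = surplus u pos x - surplus v neg x is a difference of nonnegative vectors of entry sums u and v.
surplus : ∀ {a} → ℕ → (ℤ → ℕ) → Vec ℤ a → Fin (suc a) → ℕ
surplus u f x Fin.zero    = u ∸ Vec.sum (Vec.map f x)
surplus u f x (Fin.suc i) = f (Vec.lookup x i)

sum-lookup : ∀ {a} (f : ℤ → ℕ) (x : Vec ℤ a) → sumℕ (λ i → f (Vec.lookup x i)) ≡ Vec.sum (Vec.map f x)
sum-lookup f []      = refl
sum-lookup f (z ∷ x) = cong (_+_ (f z)) (sum-lookup f x)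

sum-surplus : ∀ {a} u f (x : Vec ℤ a) → Vec.sum (Vec.map f x) ≤ u → sumℕ (surplus u f x) ≡ u
sum-surplus u f x p = trans (cong (_+_ (u ∸ Vec.sum (Vec.map f x))) (sum-lookup f x)) (ℕₚ.m∸n+n≡m p)

pos-∸ : ∀ {m n} → m ≤ n → + (n ∸ m) ≡ + n ℤ.- + m
pos-∸ {m} {n} p = trans (sym (ℤₚ.⊖-≥ p)) (sym (ℤₚ.m-n≡m⊖n n m))

pos-neg : ∀ z → + pos z ℤ.- + neg z ≡ z
pos-neg (+ n)    = ℤₚ.+-identityʳ (+ n)
pos-neg -[1+ n ] = refl

ext-surplus : ∀ {a} u v (x : Vec ℤ a) → posSum x ≤ u → negSum x ≤ v → ∀ i →
  + surplus u pos x i ℤ.- + surplus v neg x i ≡ ext u v x i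
ext-surplus u v x p q Fin.zero    = cong₂ ℤ._-_ (pos-∸ p) (pos-∸ q)
ext-surplus u v x p q (Fin.suc i) = pos-neg (Vec.lookup x i)

sumℤ-pos-neg : ∀ {k} (z : Fin k → ℤ) → sumℤ z ≡ + sumℕ (pos ∘ z) ℤ.- + sumℕ (neg ∘ z)
sumℤ-pos-neg {zero}  z = refl
sumℤ-pos-neg {suc k} z = trans (cong₂ _+ᶻ_ (sym (pos-neg (z Fin.zero))) (sumℤ-pos-neg (z ∘ Fin.suc)))
  (regroup (+ pos (z Fin.zero)) (+ neg (z Fin.zero)) (+ sumℕ (pos ∘ z ∘ Fin.suc)) (+ sumℕ (neg ∘ z ∘ Fin.suc)))
  where
  regroup : ∀ a b c d → a ℤ.- b +ᶻ (c ℤ.- d) ≡ a +ᶻ c ℤ.- (b +ᶻ d)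
  regroup = solve-∀

abs-pos-neg : ∀ z → ℤ.∣ z ∣ ≡ pos z + neg z
abs-pos-neg (+ n)    = sym (ℕₚ.+-identityʳ n)
abs-pos-neg -[1+ n ] = refl

sum-abs : ∀ {k} (z : Fin k → ℤ) → sumℕ (λ i → ℤ.∣ z i ∣) ≡ sumℕ (pos ∘ z) + sumℕ (neg ∘ z)
sum-abs z = trans (sumℕ-cong (abs-pos-neg ∘ z)) (sumℕ-+ (pos ∘ z) (neg ∘ z))

sum-ext : ∀ {a} u v (x : Vec ℤ a) → sumℤ (ext u v x) ≡ + u ℤ.- + v
sum-ext u v x = trans (cong ((+ u ℤ.- + posSum x) ℤ.- (+ v ℤ.- + negSum x) +ᶻ_)
    (trans (sumℤ-pos-neg (Vec.lookup x)) (cong₂ (λ m n → + m ℤ.- + n) (sum-lookup pos x) (sum-lookup neg x))))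
  (telescope (+ u) (+ v) (+ posSum x) (+ negSum x))
  where
  telescope : ∀ u v p q → (u ℤ.- p) ℤ.- (v ℤ.- q) +ᶻ (p ℤ.- q) ≡ u ℤ.- v
  telescope = solve-∀

-- Entry 0 is the difference of the slacks in the two bounds. When one slack is zero nothing
-- cancels, and the positive and negative parts have sums exactly u and v.
sum-abs-ext : ∀ {a} u v (x : Vec ℤ a) → posSum x ≤ u → negSum x ≤ v →
  ¬ (posSum x < u × negSum x < v) → sumℕ (λ i → ℤ.∣ ext u v x i ∣) ≡ u + v
sum-abs-ext u v x p q extreme = trans (cong₂ _+_ first
    (trans (sum-abs (Vec.lookup x)) (cong₂ _+_ (sum-lookup pos x) (sum-lookup neg x))))
  (trans (regroup (u ∸ posSum x) (v ∸ negSum x) (posSum x) (negSum x))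
    (cong₂ _+_ (ℕₚ.m∸n+n≡m p) (ℕₚ.m∸n+n≡m q)))
  where
  regroup : ∀ s t p q → s + t + (p + q) ≡ s + p + (t + q)
  regroup = ℕSolver.solve-∀
  disjoint : ∀ m n → m ≡ 0 ⊎ n ≡ 0 → ℤ.∣ + m ℤ.- + n ∣ ≡ m + n
  disjoint zero n    _         = trans (cong ℤ.∣_∣ (ℤₚ.+-identityˡ (ℤ.- (+ n)))) (ℤₚ.∣-i∣≡∣i∣ (+ n))
  disjoint m    zero _         = trans (cong ℤ.∣_∣ (ℤₚ.+-identityʳ (+ m))) (sym (ℕₚ.+-identityʳ m))
  disjoint (suc m) (suc n) (inj₁ ())
  disjoint (suc m) (suc n) (inj₂ ())
  which : u ∸ posSum x ≡ 0 ⊎ v ∸ negSum x ≡ 0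
  which with posSum x ℕ.<? u | negSum x ℕ.<? v
  ... | no r  | _     = inj₁ (ℕₚ.m≤n⇒m∸n≡0 (ℕₚ.≮⇒≥ r))
  ... | yes _ | no r  = inj₂ (ℕₚ.m≤n⇒m∸n≡0 (ℕₚ.≮⇒≥ r))
  ... | yes r | yes s = ⊥-elim (extreme (r , s))
  first : ℤ.∣ ext u v x Fin.zero ∣ ≡ (u ∸ posSum x) + (v ∸ negSum x)
  first = trans (cong ℤ.∣_∣ (sym (ext-surplus u v x p q Fin.zero))) (disjoint (u ∸ posSum x) (v ∸ negSum x) which)

sum-tabulateⱽ : ∀ {a} (f : ℤ → ℕ) (x : Fin a → ℤ) → Vec.sum (Vec.map f (Vec.tabulate x)) ≡ sumℕ (f ∘ x)
sum-tabulateⱽ {zero}  f x = refl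
sum-tabulateⱽ {suc a} f x = cong (_+_ (f (x Fin.zero))) (sum-tabulateⱽ f (x ∘ Fin.suc))

tail-vec : ∀ {a} → (Fin (suc a) → ℤ) → Vec ℤ a
tail-vec x = Vec.tabulate (x ∘ Fin.suc)

ext-tail : ∀ {a} u v (x : Fin (suc a) → ℤ) → + u ℤ.- + v ≡ sumℤ x → ∀ i → ext u v (tail-vec x) i ≡ x i
ext-tail u v x s (Fin.suc i) = Vecₚ.lookup∘tabulate (x ∘ Fin.suc) i
ext-tail u v x s Fin.zero    = trans
  (regroup (+ u) (+ v) (+ posSum (tail-vec x)) (+ negSum (tail-vec x)))
  (trans (cong₂ ℤ._-_ s (trans (cong₂ (λ m n → + m ℤ.- + n) (sum-tabulateⱽ pos (x ∘ Fin.suc))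
      (sum-tabulateⱽ neg (x ∘ Fin.suc)))
      (sym (sumℤ-pos-neg (x ∘ Fin.suc)))))
    (cancel (x Fin.zero) (sumℤ (x ∘ Fin.suc))))
  where
  regroup : ∀ u v p q → (u ℤ.- p) ℤ.- (v ℤ.- q) ≡ (u ℤ.- v) ℤ.- (p ℤ.- q)
  regroup = solve-∀
  cancel : ∀ x y → x +ᶻ y ℤ.- y ≡ x
  cancel = solve-∀

tail-≤ : ∀ {a} f u (x : Fin (suc a) → ℤ) → sumℕ (f ∘ x) ≤ u → Vec.sum (Vec.map f (tail-vec x)) ≤ u
tail-≤ f u x p = ℕₚ.≤-trans (ℕₚ.≤-reflexive (sum-tabulateⱽ f (x ∘ Fin.suc)))
    (ℕₚ.≤-trans (ℕₚ.m≤n+m _ (f (x Fin.zero))) p)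

-- The dropped entry cannot be both positive and negative, so one of the two sums loses nothing.
tail-extreme : ∀ {a} u v (x : Fin (suc a) → ℤ) → sumℕ (pos ∘ x) ≡ u → sumℕ (neg ∘ x) ≡ v →
  ¬ (posSum (tail-vec x) < u × negSum (tail-vec x) < v)
tail-extreme u v x refl refl (p , q) = cases (x Fin.zero) refl
  where
  cases : ∀ z → x Fin.zero ≡ z → ⊥
  cases (+ n)    r = ℕₚ.<-irrefl (trans (sum-tabulateⱽ neg (x ∘ Fin.suc))
      (cong (λ z → neg z + sumℕ (neg ∘ x ∘ Fin.suc)) (sym r))) q
  cases -[1+ n ] r = ℕₚ.<-irrefl (trans (sum-tabulateⱽ pos (x ∘ Fin.suc))
      (cong (λ z → pos z + sumℕ (pos ∘ x ∘ Fin.suc)) (sym r))) p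

lookup-injective : ∀ {A : Set} {k} (x y : Vec A k) → (∀ i → Vec.lookup x i ≡ Vec.lookup y i) → x ≡ y
lookup-injective x y p = trans (sym (Vecₚ.tabulate∘lookup x)) (trans (Vecₚ.tabulate-cong p) (Vecₚ.tabulate∘lookup y))

-- Lattice points on the boundary of dilates of `P`.

module Correspondence (a b : ℕ) (E : List (Fin (suc a + suc b) × Fin (suc a + suc b)))
  (complete : Bipartite.IsComplete a b E) where

  open Polytope a b E complete
  open Cones vertex
  open Boundaries a b E complete

  latticePoint : Point a b → Fin dim → ℤ
  latticePoint ((u , v) , x , y) = glue (ext u v x) (λ j → ℤ.- ext u v y j)

  latticePoint-left : ∀ u v x y i → latticePoint ((u , v) , x , y) (left i) ≡ ext u v x i
  latticePoint-left u v x y i = glue-ˡ (ext u v x) (λ j → ℤ.- ext u v y j) i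

  latticePoint-right : ∀ u v x y j → latticePoint ((u , v) , x , y) (right j) ≡ ℤ.- ext u v y j
  latticePoint-right u v x y j = glue-ʳ (ext u v x) (λ j → ℤ.- ext u v y j) j

  -- The positive surpluses of x and y form a transport of size u, the negative ones a transport of
  -- size v to be subtracted. As `P` is symmetric, the weights simply add.
  cone-latticePoint : ∀ u v x y → Valid a b ((u , v) , x , y) →
    Cone vertex (toℚ (+ (u + v))) (toℚ ∘ latticePoint ((u , v) , x , y))
  cone-latticePoint u v x y (valid p q r s) = cone-resp (sym (toℚ-+ (+ u) (+ v)))
    (Fin-elim (suc a)
      (λ i → trans (cong₂ (λ m n → m +ℚ (-ℚ n)) (glue-ˡ (f₊ x) (λ j → -ℚ f₊ y j) i) (glue-ˡ (f₋ x) (λ j → -ℚ f₋ y j) i))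
        (trans (sym (toℚ-minus (+ surplus u pos x i) (+ surplus v neg x i)))
          (cong toℚ (trans (ext-surplus u v x p q i) (sym (latticePoint-left u v x y i))))))
      (λ j → trans (cong₂ (λ m n → m +ℚ (-ℚ n)) (glue-ʳ (f₊ x) (λ j → -ℚ f₊ y j) j) (glue-ʳ (f₋ x) (λ j → -ℚ f₋ y j) j))
        (trans (sym (ℚₚ.neg-distrib-+ (f₊ y j) (-ℚ f₋ y j)))
        (trans (cong -ℚ_ (trans (sym (toℚ-minus (+ surplus u pos y j) (+ surplus v neg y j)))
            (cong toℚ (ext-surplus u v y r s j))))
          (trans (sym (toℚ-neg (ext u v y j))) (cong toℚ (sym (latticePoint-right u v x y j))))))))
    (cone-+ (transport u (surplus u pos x) (surplus u pos y) (sum-surplus u pos x p) (sum-surplus u pos y r))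
      (symmetric (transport v (surplus v neg x) (surplus v neg y) (sum-surplus v neg x q) (sum-surplus v neg y s))))
    where
    f₊ f₋ : ∀ {k} → Vec ℤ k → Fin (suc k) → ℚ
    f₊ x i = toℚ (+ surplus u pos x i)
    f₋ x i = toℚ (+ surplus v neg x i)

  -- A point that is not interior has a tight bound in x or in y, and that half attains the norm.
  norm-latticePoint : ∀ u v x y → Valid a b ((u , v) , x , y) → ¬ Interior a b ((u , v) , x , y) →
    norm-left (latticePoint ((u , v) , x , y)) ≡ u + v ⊎ norm-right (latticePoint ((u , v) , x , y)) ≡ u + v
  norm-latticePoint u v x y (valid p q r s) exact with (posSum x ℕ.<? u) ×-dec (negSum x ℕ.<? v)
  ... | no extreme = inj₁ (trans (sumℕ-cong (λ i → cong ℤ.∣_∣ (latticePoint-left u v x y i)))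
      (sum-abs-ext u v x p q extreme))
  ... | yes t = inj₂ (trans (sumℕ-cong (λ j → trans (cong ℤ.∣_∣ (latticePoint-right u v x y j))
      (ℤₚ.∣-i∣≡∣i∣ (ext u v y j))))
                  (sum-abs-ext u v y r s (λ t′ → exact (t , t′))))

  -- u and v are the common values max(|x⁺|,|y⁺|) and max(|x⁻|,|y⁻|) for z = (x , -y).
  NormPoint : (Fin dim → ℤ) → Set
  NormPoint z = Σ (Point a b) λ p → Valid a b p × ¬ Interior a b p × (∀ k → latticePoint p k ≡ z k)
    × (proj₁ (proj₁ p) + proj₂ (proj₁ p) ≡ norm-left z ⊎ proj₁ (proj₁ p) + proj₂ (proj₁ p) ≡ norm-right z)

  point-of : ∀ z → sumℤ z ≡ + 0 → NormPoint z
  point-of z sum≡0 = result (ℕₚ.≤-total Y₊ X₊)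
    where
    x : Fin (suc a) → ℤ
    x = z ∘ left
    y : Fin (suc b) → ℤ
    y j = ℤ.- z (right j)
    X₊ X₋ Y₊ Y₋ : ℕ
    X₊ = sumℕ (pos ∘ x)
    X₋ = sumℕ (neg ∘ x)
    Y₊ = sumℕ (pos ∘ y)
    Y₋ = sumℕ (neg ∘ y)
    x≡y : sumℤ x ≡ sumℤ y
    x≡y = trans (add-sub (sumℤ x) (sumℤ (z ∘ right)))
        (trans (cong (ℤ._- sumℤ (z ∘ right)) (trans (sym (sumℤ-split (suc a) z)) sum≡0))
      (trans (ℤₚ.+-identityˡ _) (sym (sumℤ-neg (z ∘ right)))))
      where
      add-sub : ∀ x y → x ≡ x +ᶻ y ℤ.- y
      add-sub = solve-∀
    -- Since x and y have equal entry sums, Y₊ ≤ X₊ entails Y₋ ≤ X₋ and conversely: both maxima are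
    -- attained by the same half, which makes that half tight.
    balance : X₊ + Y₋ ≡ Y₊ + X₋
    balance = ℤₚ.+-injective (trans (move (+ X₊) (+ X₋) (+ Y₋)) (trans (cong (λ t → t +ᶻ + X₋ +ᶻ + Y₋)
        (trans (sym (sumℤ-pos-neg x)) (trans x≡y (sumℤ-pos-neg y)))) (move′ (+ Y₊) (+ Y₋) (+ X₋))))
      where
      move : ∀ p q r → p +ᶻ r ≡ p ℤ.- q +ᶻ q +ᶻ r
      move = solve-∀
      move′ : ∀ p q r → p ℤ.- q +ᶻ r +ᶻ q ≡ p +ᶻ r
      move′ = solve-∀
    build : ∀ u v → X₊ ≤ u → X₋ ≤ v → Y₊ ≤ u → Y₋ ≤ v → + u ℤ.- + v ≡ sumℤ x →
      Valid a b ((u , v) , tail-vec x , tail-vec y) × (∀ k → latticePoint ((u , v) , tail-vec x , tail-vec y) k ≡ z k)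
    build u v p q r s t = valid (tail-≤ pos u x p) (tail-≤ neg v x q) (tail-≤ pos u y r) (tail-≤ neg v y s)
      , Fin-elim (suc a)
          (λ i → trans (latticePoint-left u v (tail-vec x) (tail-vec y) i) (ext-tail u v x t i))
          (λ j → trans (latticePoint-right u v (tail-vec x) (tail-vec y) j)
            (trans (cong ℤ.-_ (ext-tail u v y (trans t x≡y) j)) (ℤₚ.neg-involutive (z (right j)))))
    result : Y₊ ≤ X₊ ⊎ X₊ ≤ Y₊ → NormPoint z
    result (inj₁ l) =
      let va , eq = build X₊ X₋ ℕₚ.≤-refl ℕₚ.≤-refl l
            (ℕₚ.+-cancelˡ-≤ X₊ _ _ (ℕₚ.≤-trans (ℕₚ.≤-reflexive balance) (ℕₚ.+-monoˡ-≤ X₋ l)))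
            (sym (sumℤ-pos-neg x))
      in ((X₊ , X₋) , tail-vec x , tail-vec y) , va , (λ { (t , _) → tail-extreme X₊ X₋ x refl refl t }) , eq , inj₁ (sym (sum-abs x))
    result (inj₂ l) =
      let va , eq = build Y₊ Y₋ l
            (ℕₚ.+-cancelˡ-≤ Y₊ _ _ (ℕₚ.≤-trans (ℕₚ.≤-reflexive (sym balance)) (ℕₚ.+-monoˡ-≤ Y₋ l)))
            ℕₚ.≤-refl ℕₚ.≤-refl (trans (sym (sumℤ-pos-neg y)) (sym x≡y))
      in ((Y₊ , Y₋) , tail-vec x , tail-vec y) , va , (λ { (_ , t) → tail-extreme Y₊ Y₋ y refl refl t }) , eq
         , inj₂ (trans (sym (sum-abs y)) (sumℕ-cong (λ j → ℤₚ.∣-i∣≡∣i∣ (z (right j)))))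

  -- The entry sum of the left half is u - v and the level u + v is shared, so u and v are
  -- determined; x and y are then coordinates of the point.
  latticePoint-injective : ∀ p q → proj₁ (proj₁ p) + proj₂ (proj₁ p) ≡ proj₁ (proj₁ q) + proj₂ (proj₁ q) →
    (∀ k → latticePoint p k ≡ latticePoint q k) → p ≡ q
  latticePoint-injective ((u , v) , x , y) ((u′ , v′) , x′ , y′) s r =
    cong₂ (λ uv xy → uv , xy) (cong₂ _,_ u≡u′ (ℕₚ.+-cancelˡ-≡ u _ _ (trans s (cong (_+ v′) (sym u≡u′)))))
      (cong₂ _,_ (lookup-injective x x′ (ext≡ ∘ Fin.suc)) (lookup-injective y y′ (ext≡′ ∘ Fin.suc)))
    where
    ext≡ : ∀ i → ext u v x i ≡ ext u′ v′ x′ i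
    ext≡ i = trans (sym (latticePoint-left u v x y i)) (trans (r (left i)) (latticePoint-left u′ v′ x′ y′ i))
    ext≡′ : ∀ j → ext u v y j ≡ ext u′ v′ y′ j
    ext≡′ j = ℤₚ.neg-injective (trans (sym (latticePoint-right u v x y j))
        (trans (r (right j)) (latticePoint-right u′ v′ x′ y′ j)))
    difference : + u ℤ.- + v ≡ + u′ ℤ.- + v′
    difference = trans (sym (sum-ext u v x)) (trans (sumℤ-cong ext≡) (sum-ext u′ v′ x′))
    twice : ∀ u v → u ℤ.- v +ᶻ (u +ᶻ v) ≡ u +ᶻ u
    twice = solve-∀
    2u≡2u′ : u + u ≡ u′ + u′
    2u≡2u′ = ℤₚ.+-injective (trans (sym (twice (+ u) (+ v)))
        (trans (cong₂ _+ᶻ_ difference (cong +_ s)) (twice (+ u′) (+ v′))))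
    u≡u′ : u ≡ u′
    u≡u′ = trans (ℕₚ.n≡⌊n+n/2⌋ u) (trans (cong ℕ.⌊_/2⌋ 2u≡2u′) (sym (ℕₚ.n≡⌊n+n/2⌋ u′)))

  module _ (N′ : ℕ) where

    open Reciprocal N′

    exact⇒boundary : ∀ p → p ∈ˡ exactPoints a b (suc N′) → Boundary P (scaled (latticePoint p))
    exact⇒boundary ((u , v) , x , y) p∈ =
      let q , exact = ∈-filter⁻ (¬? ∘ interior? a b) {xs = points a b (suc N′)} p∈
          s , va = ∈-points⁻ a b (suc N′) q
          z = latticePoint ((u , v) , x , y)
      in boundary⁺ N′ z
        (subst (λ m → Cone vertex (toℚ (+ m)) (toℚ ∘ z)) s (cone-latticePoint u v x y va))
        (subst (λ m → norm-left z ≡ m ⊎ norm-right z ≡ m) s (norm-latticePoint u v x y va exact))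

    -- The sign functionals bound the level by N, and by `boundary⁻` a smaller level would place the
    -- point off the boundary.
    boundary⇒exact : ∀ z → Boundary P (scaled z) →
      Σ (Point a b) λ p → p ∈ˡ exactPoints a b (suc N′) × (∀ k → latticePoint p k ≡ z k)
    boundary⇒exact z z∈∂P = conclude (point-of z (sum-zero N′ z (proj₁ z∈∂P)))
      where
      ≤N : ∀ {n} → n ≡ norm-left z ⊎ n ≡ norm-right z → n ≤ suc N′
      ≤N (inj₁ r) = ℕₚ.≤-trans (ℕₚ.≤-reflexive r) (norm-left-≤ N′ z (proj₁ z∈∂P))
      ≤N (inj₂ r) = ℕₚ.≤-trans (ℕₚ.≤-reflexive r) (norm-right-≤ N′ z (proj₁ z∈∂P))
      conclude : NormPoint z → Σ (Point a b) λ p → p ∈ˡ exactPoints a b (suc N′) × (∀ k → latticePoint p k ≡ z k)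
      conclude (((u , v) , x , y) , va , exact , eq , norm) = ((u , v) , x , y)
        , ∈-filter⁺ (¬? ∘ interior? a b) (subst (λ m → ((u , v) , x , y) ∈ˡ points a b m) u+v≡N
            (∈-points⁺ a b va)) exact
        , eq
        where
        ≮N : ¬ u + v < suc N′
        ≮N l = boundary⁻ N′ z (u + v) l (cone-resp refl (λ k → cong toℚ (eq k)) (cone-latticePoint u v x y va)) z∈∂P
        u+v≡N : u + v ≡ suc N′
        u+v≡N = ℕₚ.≤-antisym (≤N norm) (ℕₚ.≮⇒≥ ≮N)

-- Lattice points and vectors supported on faces.

∉-supp : ∀ {m} (c : Vec ℕ m) j → j ∉ supp c → Vec.lookup c j ≡ 0
∉-supp (zero ∷ c)  Fin.zero    p = refl
∉-supp (suc n ∷ c) Fin.zero    p = ⊥-elim (p here)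
∉-supp (n ∷ c)     (Fin.suc j) p = ∉-supp c j (p ∘ there)

supp-⊆ : ∀ {m} (c : Vec ℕ m) σ → (∀ j → j ∉ σ → Vec.lookup c j ≡ 0) → supp c ⊆ σ
supp-⊆ c σ p {j} j∈c with j Subsetₚ.∈? σ
... | yes q = q
... | no q  = ⊥-elim (contra c j j∈c (p j q))
  where
  contra : ∀ {m} (c : Vec ℕ m) j → j ∈ supp c → Vec.lookup c j ≢ 0
  contra (zero ∷ c)  Fin.zero    () q
  contra (suc n ∷ c) Fin.zero    h  ()
  contra (n ∷ c)     (Fin.suc j) (there h) q = contra c j h q

sum-lookupℕ : ∀ {m} (c : Vec ℕ m) → sumℕ (Vec.lookup c) ≡ Vec.sum c
sum-lookupℕ []      = refl
sum-lookupℕ (n ∷ c) = cong (_+_ n) (sum-lookupℕ c)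

difference-zero : ∀ {x y} → x -ℚ y ≡ 0ℚ → x ≡ y
difference-zero {x} {y} p = trans (add-sub x y) (trans (cong (_+ℚ y) p) (ℚₚ.+-identityˡ y))
  where
  add-sub : ∀ x y → x ≡ x -ℚ y +ℚ y
  add-sub = solveℚ 2 (λ x y → x := x :- y :+ y) refl

module Triangulation (a b : ℕ) (E : List (Fin (suc a + suc b) × Fin (suc a + suc b)))
  (complete : Bipartite.IsComplete a b E)
  (𝒯 : UnimodularTriangulation (suc a + suc b) (Boundary (InSEP E))) where

  open UnimodularTriangulation 𝒯
  open Correspondence a b E complete
  open Polytope a b E complete using (dim)

  latticeSum : Vec ℕ m → Fin dim → ℤ
  latticeSum c i = sumℤ (λ j → + Vec.lookup c j *ᶻ φ j i)

  affine-unique : ∀ σ → Face Δ σ → (λs μs : Fin m → ℚ) → (∀ j → j ∉ σ → λs j ≡ 0ℚ) → (∀ j → j ∉ σ → μs j ≡ 0ℚ) →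
    sumℚ λs ≡ sumℚ μs → lincomb λs φℚ ≐ lincomb μs φℚ → ∀ j → λs j ≡ μs j
  affine-unique σ σ∈Δ λs μs λ∉ μ∉ s l j = difference-zero (affIndep σ σ∈Δ (λ j → λs j -ℚ μs j)
    (λ j j∉ → cong₂ _-ℚ_ (λ∉ j j∉) (μ∉ j j∉))
    (trans (sumℚ-minus λs μs) (trans (cong (_-ℚ sumℚ μs) s) (ℚₚ.+-inverseʳ (sumℚ μs))))
    (λ i → trans (sumℚ-cong (λ j → distrib (λs j) (μs j) (φℚ j i)))
      (trans (sumℚ-minus (λ j → λs j *ℚ φℚ j i) (λ j → μs j *ℚ φℚ j i))
      (trans (cong (_-ℚ lincomb μs φℚ i) (l i)) (ℚₚ.+-inverseʳ (lincomb μs φℚ i))))) j)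
    where
    distrib : ∀ x y z → (x -ℚ y) *ℚ z ≡ x *ℚ z -ℚ y *ℚ z
    distrib = solveℚ 3 (λ x y z → (x :- y) :* z := x :* z :- y :* z) refl

  lincomb-toℚ : ∀ (k : Fin m → ℤ) i → lincomb (toℚ ∘ k) φℚ i ≡ toℚ (sumℤ (λ j → k j *ᶻ φ j i))
  lincomb-toℚ k i = trans (sumℚ-cong (λ j → sym (toℚ-* (k j) (φ j i)))) (sumℚ-toℚ (λ j → k j *ᶻ φ j i))

  module _ (N′ : ℕ) where

    open Reciprocal N′

    supported? : Decidable (λ c → isFace Δ (supp c) ≡ true)
    supported? c = isFace Δ (supp c) Boolₚ.≟ true

    faceVectors : List (Vec ℕ m)
    faceVectors = List.filter supported? (comps m (suc N′))

    weights : Vec ℕ m → Fin m → ℚ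
    weights c j = toℚ (+ Vec.lookup c j) *ℚ ν

    inSimplex : ∀ c → Vec.sum c ≡ suc N′ → InSimplex (supp c) (scaled (latticeSum c))
    inSimplex c s = weights c
      , (λ j → *ℚ-nonNeg (toℚ-mono-≤ {+ 0} {+ Vec.lookup c j} (ℤ.+≤+ z≤n)) 0≤ν)
      , (λ j j∉ → trans (cong (λ n → toℚ (+ n) *ℚ ν) (∉-supp c j j∉)) (ℚₚ.*-zeroˡ ν))
      , trans (sumℚ-*ʳ (λ j → toℚ (+ Vec.lookup c j)) ν)
          (trans (cong (_*ℚ ν) (trans (sumℕ-toℚ (Vec.lookup c)) (cong (toℚ ∘ +_) (trans (sum-lookupℕ c) s)))) N*ν)
      , (λ i → trans (sumℚ-cong (λ j → right-comm (toℚ (+ Vec.lookup c j)) ν (φℚ j i)))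
          (trans (sumℚ-*ʳ (λ j → toℚ (+ Vec.lookup c j) *ℚ φℚ j i) ν)
                 (cong (_*ℚ ν) (lincomb-toℚ (λ j → + Vec.lookup c j) i))))
      where
      right-comm : ∀ x y z → x *ℚ y *ℚ z ≡ x *ℚ z *ℚ y
      right-comm = solveℚ 3 (λ x y z → x :* y :* z := x :* z :* y) refl

    record Represents (c : Vec ℕ m) (p : Point a b) : Set where
      constructor represents
      field
        c∈ : c ∈ˡ faceVectors
        p∈ : p ∈ˡ exactPoints a b (suc N′)
        eq : ∀ i → latticePoint p i ≡ latticeSum c i

    sum-of : ∀ {c} → c ∈ˡ faceVectors → Vec.sum c ≡ suc N′
    sum-of c∈ = ∈-comps⁻ m (suc N′) (proj₁ (∈-filter⁻ supported?
        {xs = comps m (suc N′)} c∈))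

    face-of : ∀ {c} → c ∈ˡ faceVectors → Face Δ (supp c)
    face-of c∈ = proj₂ (∈-filter⁻ supported? {xs = comps m (suc N′)} c∈)

    to : ∀ c → c ∈ˡ faceVectors → Σ (Point a b) λ p → p ∈ˡ exactPoints a b (suc N′) × Represents c p
    to c c∈ = conclude (boundary⇒exact N′ (latticeSum c) (inside (supp c) (face-of c∈) _ (inSimplex c (sum-of c∈))))
      where
      conclude : (Σ (Point a b) λ p → p ∈ˡ exactPoints a b (suc N′) × (∀ i → latticePoint p i ≡ latticeSum c i)) →
        Σ (Point a b) λ p → p ∈ˡ exactPoints a b (suc N′) × Represents c p
      conclude (p , p∈ , eq) = p , p∈ , represents c∈ p∈ eq

    -- z lies in the cone over a face σ, but unimodularity speaks of the affine hull of σ: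
    -- subtract N - 1 copies of one vertex of σ.
    vertex-coordinates : ∀ z σ → Face Δ σ → (λs : Fin m → ℚ) → (∀ j → j ∉ σ → λs j ≡ 0ℚ) → sumℚ λs ≡ 1ℚ →
      lincomb λs φℚ ≐ scaled z → ∀ j₀ → j₀ ∈ σ → Σ (Fin m → ℤ) λ k → ∀ j → toℚ (k j) ≡ Nℚ *ℚ λs j
    vertex-coordinates z σ σ∈Δ λs λ∉ s l j₀ j₀∈σ = k , k≡
      where
      nℚ : ℚ
      nℚ = toℚ (+ N′)
      μs : Fin m → ℚ
      μs j = Nℚ *ℚ λs j -ℚ nℚ *ℚ e j₀ j
      μ∉ : ∀ j → j ∉ σ → μs j ≡ 0ℚ
      μ∉ j j∉ = trans (cong₂ (λ x y → Nℚ *ℚ x -ℚ nℚ *ℚ y) (λ∉ j j∉) (e-≢ j₀ j (λ { refl → j∉ j₀∈σ }))) (vanish Nℚ nℚ)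
        where
        vanish : ∀ x y → x *ℚ 0ℚ -ℚ y *ℚ 0ℚ ≡ 0ℚ
        vanish = solveℚ 2 (λ x y → x :* con 0ℚ :- y :* con 0ℚ := con 0ℚ) refl
      sum-μ : sumℚ μs ≡ 1ℚ
      sum-μ = trans (sumℚ-minus (λ j → Nℚ *ℚ λs j) (λ j → nℚ *ℚ e j₀ j))
        (trans (cong₂ _-ℚ_ (trans (sumℚ-* Nℚ λs) (cong (Nℚ *ℚ_) s))
            (trans (sumℚ-* nℚ (e j₀)) (cong (nℚ *ℚ_) (sumℚ-e₁ j₀))))
        (trans (cong (λ t → t *ℚ 1ℚ -ℚ nℚ *ℚ 1ℚ) (toℚ-+ (+ 1) (+ N′))) (unit nℚ)))
        where
        unit : ∀ n → (1ℚ +ℚ n) *ℚ 1ℚ -ℚ n *ℚ 1ℚ ≡ 1ℚ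
        unit = solveℚ 1 (λ n → (con 1ℚ :+ n) :* con 1ℚ :- n :* con 1ℚ := con 1ℚ) refl
      z′ : Fin dim → ℤ
      z′ i = z i ℤ.- + N′ *ᶻ φ j₀ i
      lincomb-μ : lincomb μs φℚ ≐ (toℚ ∘ z′)
      lincomb-μ i = trans (sumℚ-cong (λ j → distrib Nℚ (λs j) nℚ (e j₀ j) (φℚ j i)))
        (trans (sumℚ-minus (λ j → Nℚ *ℚ (λs j *ℚ φℚ j i)) (λ j → nℚ *ℚ (e j₀ j *ℚ φℚ j i)))
        (trans (cong₂ _-ℚ_
            (trans (sumℚ-* Nℚ (λ j → λs j *ℚ φℚ j i)) (trans (cong (Nℚ *ℚ_) (l i)) (unscale (z i))))
            (trans (sumℚ-* nℚ (λ j → e j₀ j *ℚ φℚ j i))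
                (trans (cong (nℚ *ℚ_) (sumℚ-e j₀ (λ j → φℚ j i))) (sym (toℚ-* (+ N′) (φ j₀ i))))))
          (sym (toℚ-minus (z i) (+ N′ *ᶻ φ j₀ i)))))
        where
        distrib : ∀ N l n d f → (N *ℚ l -ℚ n *ℚ d) *ℚ f ≡ N *ℚ (l *ℚ f) -ℚ n *ℚ (d *ℚ f)
        distrib = solveℚ 5 (λ N l n d f → (N :* l :- n :* d) :* f := N :* (l :* f) :- n :* (d :* f)) refl
      lattice : Σ (Fin m → ℤ) λ κ → (∀ j → j ∉ σ → κ j ≡ + 0) × (sumℤ κ ≡ + 1) ×
          (∀ i → sumℤ (λ j → κ j *ᶻ φ j i) ≡ z′ i)
      lattice = unimodular σ σ∈Δ z′ (μs , μ∉ , sum-μ , lincomb-μ)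
      κ k : Fin m → ℤ
      κ = proj₁ lattice
      k j = κ j +ᶻ + N′ *ᶻ eᶻ j₀ j
      κ≡μ : ∀ j → toℚ (κ j) ≡ μs j
      κ≡μ = affine-unique σ σ∈Δ (toℚ ∘ κ) μs
        (λ j j∉ → cong toℚ (proj₁ (proj₂ lattice) j j∉)) μ∉
        (trans (sumℚ-toℚ κ) (trans (cong toℚ (proj₁ (proj₂ (proj₂ lattice)))) (sym sum-μ)))
        (λ i → trans (lincomb-toℚ κ i) (trans (cong toℚ (proj₂ (proj₂ (proj₂ lattice)) i)) (sym (lincomb-μ i))))
      k≡ : ∀ j → toℚ (k j) ≡ Nℚ *ℚ λs j
      k≡ j = trans (toℚ-+ (κ j) (+ N′ *ᶻ eᶻ j₀ j)) (trans
          (cong₂ _+ℚ_ (κ≡μ j) (trans (toℚ-* (+ N′) (eᶻ j₀ j)) (cong (nℚ *ℚ_) (toℚ-eᶻ j₀ j))))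
        (sub-add (Nℚ *ℚ λs j) (nℚ *ℚ e j₀ j)))
        where
        sub-add : ∀ x y → x -ℚ y +ℚ y ≡ x
        sub-add = solveℚ 2 (λ x y → x :- y :+ y := x) refl

    integral-coordinates : ∀ z σ → Face Δ σ → (λs : Fin m → ℚ) → (∀ j → j ∉ σ → λs j ≡ 0ℚ) → sumℚ λs ≡ 1ℚ →
      lincomb λs φℚ ≐ scaled z → Σ (Fin m → ℤ) λ k → ∀ j → toℚ (k j) ≡ Nℚ *ℚ λs j
    integral-coordinates z σ σ∈Δ λs λ∉ s l = cases (Subsetₚ.nonempty? σ)
      where
      0≢1 : 0ℚ ≢ 1ℚ
      0≢1 ()
      cases : Dec (Nonempty σ) → Σ (Fin m → ℤ) λ k → ∀ j → toℚ (k j) ≡ Nℚ *ℚ λs j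
      cases (yes (j₀ , j₀∈σ)) = vertex-coordinates z σ σ∈Δ λs λ∉ s l j₀ j₀∈σ
      cases (no empty) = ⊥-elim (0≢1 (trans (sym (sumℚ-zero λs (λ j → λ∉ j (λ j∈ → empty (j , j∈))))) s))

    -- N times the barycentric coordinates in a covering simplex are nonnegative integers with sum
    -- N; they are the entries of c.
    from-simplex : ∀ p → p ∈ˡ exactPoints a b (suc N′) →
      (Σ (Subset m) λ σ → Face Δ σ × InSimplex σ (scaled (latticePoint p))) → Σ (Vec ℕ m) λ c
          → c ∈ˡ faceVectors × Represents c p
    from-simplex p p∈ (σ , σ∈Δ , λs , λ≥0 , λ∉ , s , l) = c , c∈ , represents c∈ p∈ eq
      where
      coordinates : Σ (Fin m → ℤ) λ k → ∀ j → toℚ (k j) ≡ Nℚ *ℚ λs j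
      coordinates = integral-coordinates (latticePoint p) σ σ∈Δ λs λ∉ s l
      k : Fin m → ℤ
      k = proj₁ coordinates
      c : Vec ℕ m
      -- The k j are nonnegative, so the absolute value is a mere coercion to naturals.
      c = Vec.tabulate (λ j → ℤ.∣ k j ∣)
      0≤N : 0ℚ ℚ.≤ Nℚ
      0≤N = toℚ-mono-≤ {+ 0} {+ suc N′} (ℤ.+≤+ z≤n)
      k≥0 : ∀ j → + 0 ℤ.≤ k j
      k≥0 j = toℚ-cancel-≤ (subst (0ℚ ℚ.≤_) (sym (proj₂ coordinates j)) (*ℚ-nonNeg 0≤N (λ≥0 j)))
      c≡k : ∀ j → + Vec.lookup c j ≡ k j
      c≡k j = trans (cong +_ (Vecₚ.lookup∘tabulate (λ j → ℤ.∣ k j ∣) j)) (ℤₚ.0≤i⇒+∣i∣≡i (k≥0 j))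
      c≡λ : ∀ j → toℚ (+ Vec.lookup c j) ≡ Nℚ *ℚ λs j
      c≡λ j = trans (cong toℚ (c≡k j)) (proj₂ coordinates j)
      c∉ : ∀ j → j ∉ σ → Vec.lookup c j ≡ 0
      c∉ j j∉ = ℤₚ.+-injective (toℚ-injective (trans (c≡λ j) (trans (cong (Nℚ *ℚ_) (λ∉ j j∉)) (ℚₚ.*-zeroʳ Nℚ))))
      sum-c : Vec.sum c ≡ suc N′
      sum-c = trans (sym (sum-lookupℕ c)) (ℤₚ.+-injective (toℚ-injective (trans (sym (sumℕ-toℚ (Vec.lookup c)))
        (trans (sumℚ-cong c≡λ) (trans (sumℚ-* Nℚ λs) (trans (cong (Nℚ *ℚ_) s) (ℚₚ.*-identityʳ Nℚ)))))))
      c∈ : c ∈ˡ faceVectors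
      c∈ = ∈-filter⁺ supported? (subst (λ n → c ∈ˡ comps m n) sum-c (∈-comps⁺ c))
        (downward Δ σ (supp c) (supp-⊆ c σ c∉) σ∈Δ)
      eq : ∀ i → latticePoint p i ≡ latticeSum c i
      eq i = toℚ-injective (sym (trans (sym (lincomb-toℚ (λ j → + Vec.lookup c j) i))
        (trans (sumℚ-cong (λ j → trans (cong (_*ℚ φℚ j i) (c≡λ j)) (ℚₚ.*-assoc Nℚ (λs j) (φℚ j i))))
        (trans (sumℚ-* Nℚ (λ j → λs j *ℚ φℚ j i)) (trans (cong (Nℚ *ℚ_) (l i))
        (unscale (latticePoint p i)))))))

    from : ∀ p → p ∈ˡ exactPoints a b (suc N′) → Σ (Vec ℕ m) λ c → c ∈ˡ faceVectors × Represents c p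
    from p p∈ = from-simplex p p∈ (covers (scaled (latticePoint p)) (exact⇒boundary N′ p p∈))

    simplex-at : ∀ {c p} → Represents c p → InSimplex (supp c) (scaled (latticePoint p))
    simplex-at {c} r = let λs , λ≥0 , λ∉ , s , l = inSimplex c (sum-of (Represents.c∈ r)) in
      λs , λ≥0 , λ∉ , s , (λ i → trans (l i) (cong (λ z → toℚ z *ℚ ν) (sym (Represents.eq r i))))

    weights-unique : ∀ {c p} → Represents c p → ∀ τ → τ ⊆ supp c →
      (μ : InSimplex τ (scaled (latticePoint p))) → ∀ j → weights c j ≡ proj₁ μ j
    weights-unique {c} r τ τ⊆ (μs , _ , μ∉ , μ-sum , μ-l) =
      let _ , _ , λ∉ , λ-sum , λ-l = simplex-at r in affine-unique (supp c) (face-of (Represents.c∈ r)) (weights c) μs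
      λ∉ (λ j j∉ → μ∉ j (j∉ ∘ τ⊆)) (trans λ-sum (sym μ-sum)) (λ i → trans (λ-l i) (sym (μ-l i)))

    -- By `meet` the point has coordinates over the intersection of the two supports, and affine
    -- independence of either simplex identifies its own coordinates with these.
    represents-injective : ∀ {c c′ p} → Represents c p → Represents c′ p → c ≡ c′
    represents-injective {c} {c′} {p} r r′ = lookup-injective c c′ (λ j → ℤₚ.+-injective (ℤₚ.≤-antisym
        (cancel-ν (+ Vec.lookup c j) (+ Vec.lookup c′ j) (ℚₚ.≤-reflexive (same j)))
        (cancel-ν (+ Vec.lookup c′ j) (+ Vec.lookup c j) (ℚₚ.≤-reflexive (sym (same j))))))
      where
      common : InSimplex (supp c ∩ supp c′) (scaled (latticePoint p))
      common = meet (supp c) (supp c′) (face-of (Represents.c∈ r)) (face-of (Represents.c∈ r′)) _ (simplex-at r)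
          (simplex-at r′)
      same : ∀ j → weights c j ≡ weights c′ j
      same j = trans (weights-unique r (supp c ∩ supp c′) (Subsetₚ.p∩q⊆p (supp c) (supp c′)) common j)
        (sym (weights-unique r′ (supp c ∩ supp c′) (Subsetₚ.p∩q⊆q (supp c) (supp c′)) common j))

    represents-functional : ∀ {c p p′} → Represents c p → Represents c p′ → p ≡ p′
    represents-functional {p = p} {p′} r r′ = latticePoint-injective p p′
      (trans (size p (Represents.p∈ r)) (sym (size p′ (Represents.p∈ r′))))
      (λ k → trans (Represents.eq r k) (sym (Represents.eq r′ k)))
      where
      size : ∀ p → p ∈ˡ exactPoints a b (suc N′) → proj₁ (proj₁ p) + proj₂ (proj₁ p) ≡ suc N′
      size p p∈ = proj₁ (∈-points⁻ a b (suc N′) (proj₁ (∈-filter⁻ (¬? ∘ interior? a b) {xs = points a b (suc N′)} p∈)))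

    count-faceVectors : length faceVectors ≡ length (exactPoints a b (suc N′))
    count-faceVectors = bijection-length faceVectors (exactPoints a b (suc N′)) Represents
      (Uniqueₚ.filter⁺ supported? (comps-unique m (suc N′)))
      (Uniqueₚ.filter⁺ (¬? ∘ interior? a b) (points-unique a b (suc N′)))
      to from represents-injective represents-functional

  hilbert : Seq
  hilbert = ev J (fPoly Δ) δ

  -- Level 0 is treated apart, since points are scaled by 1/N; its only vector is zero, supported on
  -- the empty face.
  hilbert-zero : hilbert 0 ≡ + 1
  hilbert-zero = trans (Evaluation.ev-cong J-linear (fPoly Δ) (subsetPoly m (isFace Δ))
      (λ k → trans (coeff-fPoly Δ k) (sym (coeff-subsetPoly m (isFace Δ) k))) δ 0)
    (trans (ev-zeroth (subsetPoly m (isFace Δ))) (trans (constant m (isFace Δ))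
        (cong (λ b → + (if b then 1 else 0)) (emptyFace Δ))))
    where
    ev-zeroth : ∀ p → ev J p δ 0 ≡ coeff p 0
    ev-zeroth []      = refl
    ev-zeroth (x ∷ p) = trans (ℤₚ.+-identityʳ _) (ℤₚ.*-identityʳ x)
    constant : ∀ m (g : Subset m → Bool) → coeff (subsetPoly m g) 0 ≡ + (if g ∅ then 1 else 0)
    constant zero    g = refl
    constant (suc m) g = trans (coeff-+ᴾ (subsetPoly m (g ∘ (false ∷_))) _ 0)
        (trans (ℤₚ.+-identityʳ _) (constant m (g ∘ (false ∷_))))

  hilbert-D : (hilbert ⊕ shift (shift (D a b))) ≗ D a b
  hilbert-D zero     = trans (ℤₚ.+-identityʳ _) (trans hilbert-zero (sym (D-zero a b)))
  hilbert-D (suc N′) = trans (cong (_+ᶻ shift (shift (D a b)) (suc N′))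
      (trans (ev-fPoly Δ (suc N′)) (cong +_ (count-faceVectors N′))))
    (exactPoints-length a b (suc N′))

theorem4p12 : (a b : ℕ)
    → (T : UnimodularTriangulation (suc a + suc b) (Boundary (InSEP (Kbip a b))))
    → IsFlag (UnimodularTriangulation.Δ T)
    → (h : Fin (suc (suc (a + b))) → ℤ)
    → fPoly (UnimodularTriangulation.Δ T) ≈ᴾ hExpansion (suc (a + b)) h
    → Σ (Fin (suc ⌊ suc (a + b) /2⌋) → ℤ) λ γ →
    (polyOf h ≈ᴾ γExpansion (suc (a + b)) γ)
    × Σ ℕ λ m′ → Σ (Complex m′) λ Γ → IsFlag Γ × IsBalanced Γ × (fPoly Γ ≈ᴾ polyOf γ)
theorem4p12 a b 𝒯 _ h f≈h = γ-of a b , h≈γ , _ , Matchings.Γ a b , Matchings.Γ-flag a b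
    , Matchings.Γ-balanced a b , Γ-polynomial a b
  where
  open UnimodularTriangulation 𝒯 using (Δ)
  h≈γ : polyOf h ≈ᴾ γExpansion (suc (a + b)) (γ-of a b)
  -- Both polynomials are numerators over (1-s)^(a+b+1) of the same Hilbert series, and repeated
  -- summation is injective.
  h≈γ = ≗-trans (iter-psum-injective (suc (a + b)) (≗-trans (≗-sym (ev-hExpansion (suc (a + b)) h))
      (≗-trans (≗-sym (Evaluation.ev-cong J-linear (fPoly Δ) (hExpansion (suc (a + b)) h) f≈h δ))
               (H-G a b (Triangulation.hilbert a b (Kbip a b) (Bipartite.Kbip-complete a b) 𝒯)
                   (Triangulation.hilbert-D a b (Kbip a b) (Bipartite.Kbip-complete a b) 𝒯)))))
    (G-γ a b)
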